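{- Let $n\ge1$ and $\delta=(n,n-1,\ldots,1)$. Then $$2^{n^2}=\sum_{ST\in\mathcal{ST}^{\delta}(n,\overline n)}2^{\mathrm{str}(ST)-n}=\sum_{UA\in\mathcal{UA}^{\delta}(2n)}2^{\mathrm{neg}(UA)}=\sum_{CM\in\mathcal{CM}^{\delta}(2n)}2^{\mathrm{ns}(CM)}.$$
   Context: Let $[n,\overline n]=\{1,\ldots,n\}\cup\{\overline1,\ldots,\overline n\}$ be ordered by $\overline1<1<\overline2<2<\cdots<\overline n<n$. Matrix rows are numbered from the top, columns from the left. Shifted tableaux: $SF^\delta=\{(i,j):1\le i\le j\le n\}$. $\mathcal{ST}^\delta(n,\overline n)$ is the set of fillings $ST=(\eta_{ij})_{(i,j)\in SF^\delta}$ with $\eta_{ij}\in[n,\overline n]$, $\eta_{ii}\in\{i,\overline i\}$, $\eta_{ij}\le\eta_{i,j+1}$, $\eta_{ij}\le\eta_{i+1,j}$, $\eta_{ij}<\eta_{i+1,j+1}$ whenever the boxes lie in $SF^\delta$. $\mathrm{str}(ST)$ is the sum over all $c\in[n,\overline n]$ of the number of connected components of the set of boxes of $ST$ with entry $c$ (boxes being adjacent when they share an edge). U-turn matrices: $\mathcal{UA}^\delta(2n)$ is the set of $2n\times n$ matrices $UA=(a_{iq})$ with: $a_{iq}\in\{ -1,0,1\}$; $\sum_{q=p}^n a_{iq}\in\{0,1\}$ for $1\le i\le 2n$, $1\le p\le n$; $\sum_{i=j}^{2n}a_{iq}\in\{0,1\}$ for $1\le j\le 2n$, $1\le q\le n$;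 $\sum_{q=1}^n(a_{2i-1,q}+a_{2i,q})=1$ for $1\le i\le n$; and $\sum_{i=1}^{2n}a_{iq}=1$ for $1\le q\le n$. $\mathrm{neg}(UA)$ is the number of entries $-1$. Square ice configuration matrices: consider the $2n\times n$ grid of internal vertices, each with four edges (up, down, left, right), shared with the neighbouring vertex or, at the border, a boundary edge. Orient all edges so that each internal vertex has exactly two incoming and two outgoing edges, and: every right boundary edge is incoming (points into the grid); every bottom and every top boundary edge is outgoing; for each $1\le i\le n$, exactly one of the left boundary edges of rows $2i-1$ and $2i$ is incoming and the other outgoing. To each such orientation associate the $2n\times n$ matrix $CM$ whose element at each vertex is: WE if the incoming edges are the left and right ones; NS if the incoming edges are the upper and lower ones; otherwise NE, SW, NW or SE according as the two outgoing edges are up and right, down and left, up and left, or down and right. $\mathcal{CM}^\delta(2n)$ is the set of all such $CM$, and $\mathrm{ns}(CM)$ is the number of elements NS. -}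

module Defs where

open import Data.Fin as Fin using (Fin; zero; suc; toℕ; inject₁; fromℕ; combine)
open import Data.Fin.Patterns using (0F; 1F; 2F; 3F; 4F; 5F)
open import Data.Fin.Properties as Finₚ using (0↔⊥; 1↔⊤; +↔⊎; *↔×)
open import Data.Integer as ℤ using (ℤ; 0ℤ; 1ℤ; -1ℤ)
import Data.Integer.Properties as ℤₚ
open import Data.List as List using (List; []; _∷_; allFin; deduplicate; filter; foldr; length; map)
open import Data.List.Membership.Propositional using (_∈_)
open import Data.List.Membership.Propositional.Properties using (∈-allFin; ∈-map⁺)
open import Data.List.Relation.Unary.Any using (here; there)
open import Data.Nat as ℕ using (ℕ; zero; suc; _*_)
open import Data.Nat.ListAction using (sum)
import Data.Nat.Properties as ℕₚ
open import Data.Product using (Σ; ∃; _×_; _,_)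
open import Data.Product.Function.NonDependent.Propositional using (_×-↔_)
open import Data.Sum using (_⊎_; inj₁; inj₂)
open import Data.Sum.Function.Propositional using (_⊎-↔_)
open import Data.Unit using (⊤; tt)
open import Data.Vec as Vec using (Vec; []; _∷_; lookup)
open import Function using (_∘_; _↔_; Inverse; mk↔ₛ′)
open import Function.Properties.Inverse using (↔-refl; ↔-sym; ↔-trans; Inverse⇒Injection)
open import Level using (0ℓ)
open import Relation.Binary.Construct.Closure.ReflexiveTransitive using (Star; ε; _◅_; _◅◅_)
open import Relation.Binary.Definitions using (DecidableEquality) renaming (Decidable to Decidable₂)
open import Relation.Binary.PropositionalEquality using (_≡_; refl; sym; subst)
open import Relation.Nullary.Decidable using (Dec; map′; _×-dec_; _⊎-dec_; _→-dec_; via-injection)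
open import Relation.Unary using (Pred; Decidable)

record Finite (A : Set) : Set where
  constructor finite
  field
    {size} : ℕ
    index  : Fin size ↔ A

  open Inverse index using (to; from; strictlyInverseˡ)

  elements : List A
  elements = map to (allFin size)

  complete : ∀ a → a ∈ elements
  complete a = subst (_∈ elements) (strictlyInverseˡ a) (∈-map⁺ to (∈-allFin (from a)))

  infix 4 _≟_
  _≟_ : DecidableEquality A
  _≟_ = via-injection (Inverse⇒Injection (↔-sym index)) Fin._≟_

  ∀? : {P : Pred A 0ℓ} → Decidable P → Dec (∀ a → P a)
  ∀? {P} P? = map′ (λ p a → subst P (strictlyInverseˡ a) (p (from a)))
                   (λ p k → p (to k)) (Finₚ.all? (P? ∘ to))

  ∃? : {P : Pred A 0ℓ} → Decidable P → Dec (∃ P)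
  ∃? {P} P? = map′ (λ (k , p) → to k , p)
                   (λ (a , p) → from a , subst P (sym (strictlyInverseˡ a)) p)
                   (Finₚ.any? (P? ∘ to))

sumOver : {A : Set} → Finite A → {P : Pred A 0ℓ} → Decidable P → (A → ℕ) → ℕ
sumOver A P? w = sum (map w (filter P? (Finite.elements A)))

transport : {A B : Set} → A ↔ B → Finite A → Finite B
transport A↔B (finite A) = finite (↔-trans A A↔B)

fins : ∀ n → Finite (Fin n)
fins n = finite ↔-refl

_⊎-finite_ : {A B : Set} → Finite A → Finite B → Finite (A ⊎ B)
finite A ⊎-finite finite B = finite (↔-trans +↔⊎ (A ⊎-↔ B))

_×-finite_ : {A B : Set} → Finite A → Finite B → Finite (A × B)
finite A ×-finite finite B = finite (↔-trans *↔× (A ×-↔ B))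

vecs : {A : Set} → Finite A → ∀ n → Finite (Vec A n)
vecs A zero    = transport (mk↔ₛ′ (λ _ → []) (λ _ → tt) (λ { [] → refl }) (λ _ → refl))
                           (finite 1↔⊤)
vecs A (suc n) = transport (mk↔ₛ′ (λ (x , xs) → x ∷ xs) (λ { (x ∷ xs) → x , xs })
                                  (λ { (_ ∷ _) → refl }) (λ { (_ , _) → refl }))
                           (A ×-finite vecs A n)

Matrix : Set → ℕ → ℕ → Set
Matrix A m n = Vec (Vec A n) m

_at_,_ : {A : Set} {m n : ℕ} → Matrix A m n → Fin m → Fin n → A
M at i , q = lookup (lookup M i) q

matrices : {A : Set} → Finite A → ∀ m n → Finite (Matrix A m n)
matrices A m n = vecs (vecs A n) m

-- Warshall's algorithm.

module _ {A : Set} (A-finite : Finite A) {R : A → A → Set} (R? : Decidable₂ R) where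
  open Finite A-finite

  -- Paths all of whose intermediate points lie in the given list.
  private
    Via : List A → A → A → Set
    Via []       a b = a ≡ b ⊎ R a b
    Via (x ∷ xs) a b = Via xs a b ⊎ (Via xs a x × Via xs x b)

    via? : ∀ xs → Decidable₂ (Via xs)
    via? []       a b = (a ≟ b) ⊎-dec R? a b
    via? (x ∷ xs) a b = via? xs a b ⊎-dec (via? xs a x ×-dec via? xs x b)

    weaken : ∀ xs {a b} → Via [] a b → Via xs a b
    weaken []       p = p
    weaken (x ∷ xs) p = inj₁ (weaken xs p)

    join : ∀ {xs x a b} → x ∈ xs → Via xs a x → Via xs x b → Via xs a b
    join (here refl) (inj₁ p)       (inj₁ q)       = inj₂ (p , q)
    join (here refl) (inj₁ p)       (inj₂ (_ , q)) = inj₂ (p , q)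
    join (here refl) (inj₂ (p , _)) (inj₁ q)       = inj₂ (p , q)
    join (here refl) (inj₂ (p , _)) (inj₂ (_ , q)) = inj₂ (p , q)
    join (there i)   (inj₁ p)       (inj₁ q)       = inj₁ (join i p q)
    join (there i)   (inj₁ p)       (inj₂ (q , r)) = inj₂ (join i p q , r)
    join (there i)   (inj₂ (p , q)) (inj₁ r)       = inj₂ (p , join i q r)
    join (there i)   (inj₂ (p , _)) (inj₂ (_ , r)) = inj₂ (p , r)

    via⇒star : ∀ xs {a b} → Via xs a b → Star R a b
    via⇒star []       (inj₁ refl)    = ε
    via⇒star []       (inj₂ r)       = r ◅ ε
    via⇒star (x ∷ xs) (inj₁ p)       = via⇒star xs p
    via⇒star (x ∷ xs) (inj₂ (p , q)) = via⇒star xs p ◅◅ via⇒star xs q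

    star⇒via : ∀ {a b} → Star R a b → Via elements a b
    star⇒via ε            = weaken elements (inj₁ refl)
    star⇒via (_◅_ {j = j} r rs) = join (complete j) (weaken elements (inj₂ r)) (star⇒via rs)

  star? : Decidable₂ (Star R)
  star? a b = map′ (via⇒star elements) star⇒via (via? elements a b)

-- All indices start at 0, so `plain k` and `bar k` stand for the letters k+1
-- and its barred version.
data Letter (n : ℕ) : Set where
  bar plain : Fin n → Letter n

letters : ∀ n → Finite (Letter n)
letters n = transport (mk↔ₛ′ (λ { (inj₁ k) → bar k ; (inj₂ k) → plain k })
                             (λ { (bar k) → inj₁ k ; (plain k) → inj₂ k })
                             (λ { (bar _) → refl ; (plain _) → refl })
                             (λ { (inj₁ _) → refl ; (inj₂ _) → refl }))
                      (fins n ⊎-finite fins n)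

rank : ∀ {n} → Letter n → ℕ
rank (bar k)   = 2 * toℕ k
rank (plain k) = suc (2 * toℕ k)

infix 4 _≼_ _≺_
_≼_ _≺_ : ∀ {n} → Letter n → Letter n → Set
x ≼ y = rank x ℕ.≤ rank y
x ≺ y = rank x ℕ.< rank y

record Box (n : ℕ) : Set where
  constructor box
  field
    row col  : Fin n
    .row≤col : row Fin.≤ col
open Box using (row; col)

boxes : ∀ n → Finite (Box n)
boxes zero    = transport (mk↔ₛ′ (λ ()) (λ { (box () _ _) }) (λ { (box () _ _) }) (λ ()))
                          (finite 0↔⊥)
boxes (suc n) = transport (mk↔ₛ′ to from to∘from from∘to) (fins (suc n) ⊎-finite boxes n)
  where
  to : Fin (suc n) ⊎ Box n → Box (suc n)
  to (inj₁ j)            = box zero j ℕ.z≤n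
  to (inj₂ (box i j le)) = box (suc i) (suc j) (ℕ.s≤s le)

  from : Box (suc n) → Fin (suc n) ⊎ Box n
  from (box zero    j       _)  = inj₁ j
  from (box (suc i) (suc j) le) = inj₂ (box i j (ℕ.s≤s⁻¹ le))

  to∘from : ∀ b → to (from b) ≡ b
  to∘from (box zero    j       _) = refl
  to∘from (box (suc i) (suc j) _) = refl

  from∘to : ∀ x → from (to x) ≡ x
  from∘to (inj₁ _)           = refl
  from∘to (inj₂ (box _ _ _)) = refl

-- The rows of a staircase filling, of lengths n, n-1, …, 1.
data Triangle (A : Set) : ℕ → Set where
  []  : Triangle A zero
  _∷_ : ∀ {n} → Vec A (suc n) → Triangle A n → Triangle A (suc n)

triangles : {A : Set} → Finite A → ∀ n → Finite (Triangle A n)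
triangles A zero    = transport (mk↔ₛ′ (λ _ → []) (λ _ → tt) (λ { [] → refl }) (λ _ → refl))
                                (finite 1↔⊤)
triangles A (suc n) = transport (mk↔ₛ′ (λ (r , T) → r ∷ T) (λ { (r ∷ T) → r , T })
                                       (λ { (_ ∷ _) → refl }) (λ { (_ , _) → refl }))
                                (vecs A (suc n) ×-finite triangles A n)

-- Row i of the shifted diagram starts in column i.
entry : {A : Set} {n : ℕ} → Triangle A n → Box n → A
entry (r ∷ _) (box zero    j       _)  = lookup r j
entry (_ ∷ T) (box (suc i) (suc j) le) = entry T (box i j (ℕ.s≤s⁻¹ le))

Filling : ℕ → Set
Filling n = Triangle (Letter n) n

fillings : ∀ n → Finite (Filling n)
fillings n = triangles (letters n) n

-- In `RightOf b b′`, `Below b b′` and `Diagonal b b′` it is b′ that lies to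
-- the right of, below, or diagonally below and to the right of b.
RightOf Below Diagonal : ∀ {n} → Box n → Box n → Set
RightOf  b b′ = row b′ ≡ row b × toℕ (col b′) ≡ suc (toℕ (col b))
Below    b b′ = toℕ (row b′) ≡ suc (toℕ (row b)) × col b′ ≡ col b
Diagonal b b′ = toℕ (row b′) ≡ suc (toℕ (row b)) × toℕ (col b′) ≡ suc (toℕ (col b))

rightOf? : ∀ {n} → Decidable₂ (RightOf {n})
rightOf? b b′ = (row b′ Fin.≟ row b) ×-dec (toℕ (col b′) ℕ.≟ suc (toℕ (col b)))

below? : ∀ {n} → Decidable₂ (Below {n})
below? b b′ = (toℕ (row b′) ℕ.≟ suc (toℕ (row b))) ×-dec (col b′ Fin.≟ col b)

diagonal? : ∀ {n} → Decidable₂ (Diagonal {n})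
diagonal? b b′ = (toℕ (row b′) ℕ.≟ suc (toℕ (row b))) ×-dec (toℕ (col b′) ℕ.≟ suc (toℕ (col b)))

record IsShiftedTableau {n : ℕ} (T : Filling n) : Set where
  field
    diagonal : ∀ i → entry T (box i i ℕₚ.≤-refl) ≡ plain i ⊎ entry T (box i i ℕₚ.≤-refl) ≡ bar i
    along-rows      : ∀ b b′ → RightOf b b′ → entry T b ≼ entry T b′
    down-columns    : ∀ b b′ → Below b b′ → entry T b ≼ entry T b′
    along-diagonals : ∀ b b′ → Diagonal b b′ → entry T b ≺ entry T b′

isShiftedTableau? : ∀ {n} → Decidable (IsShiftedTableau {n})
isShiftedTableau? {n} T = map′
  (λ (d , r , c , s) → record { diagonal = d ; along-rows = r ; down-columns = c ; along-diagonals = s })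
  (λ t → let open IsShiftedTableau t in diagonal , along-rows , down-columns , along-diagonals)
  (Finₚ.all? (λ i → let η = entry T (box i i ℕₚ.≤-refl) in (η ≟ plain i) ⊎-dec (η ≟ bar i))
   ×-dec ∀? (λ b → ∀? (λ b′ → rightOf?  b b′ →-dec (rank (entry T b) ℕ.≤? rank (entry T b′))))
   ×-dec ∀? (λ b → ∀? (λ b′ → below?    b b′ →-dec (rank (entry T b) ℕ.≤? rank (entry T b′))))
   ×-dec ∀? (λ b → ∀? (λ b′ → diagonal? b b′ →-dec (rank (entry T b) ℕ.<? rank (entry T b′)))))
  where
  open Finite (boxes n) using (∀?)
  open Finite (letters n) using (_≟_)

Adjacent : ∀ {n} → Box n → Box n → Set
Adjacent b b′ = RightOf b b′ ⊎ RightOf b′ b ⊎ Below b b′ ⊎ Below b′ b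

adjacent? : ∀ {n} → Decidable₂ (Adjacent {n})
adjacent? b b′ = rightOf? b b′ ⊎-dec rightOf? b′ b ⊎-dec below? b b′ ⊎-dec below? b′ b

Connected : ∀ {n} → Filling n → Letter n → Box n → Box n → Set
Connected T c = Star (λ b b′ → Adjacent b b′ × entry T b ≡ c × entry T b′ ≡ c)

connected? : ∀ {n} (T : Filling n) c → Decidable₂ (Connected T c)
connected? {n} T c =
  star? (boxes n) (λ b b′ → adjacent? b b′ ×-dec (entry T b ≟ c) ×-dec (entry T b′ ≟ c))
  where open Finite (letters n) using (_≟_)

-- `deduplicate` keeps exactly one box of every connected component.
components : ∀ {n} → Filling n → Letter n → ℕ
components {n} T c =
  length (deduplicate (connected? T c) (filter (λ b → entry T b ≟ c) (Finite.elements (boxes n))))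
  where open Finite (letters n) using (_≟_)

str : ∀ {n} → Filling n → ℕ
str {n} T = sum (map (components T) (Finite.elements (letters n)))

-- 2n × n matrices are indexed by Fin (n * 2) × Fin n; for k : Fin n these are
-- rows 2k+1 and 2k+2 counted from 1, that is 2k and 2k+1 counted from 0.
oddRow evenRow : ∀ n → Fin n → Fin (n * 2)
oddRow  n k = combine k 0F
evenRow n k = combine k 1F

data Sign : Set where
  neg zer pos : Sign

value : Sign → ℤ
value neg = -1ℤ
value zer = 0ℤ
value pos = 1ℤ

signs : Finite Sign
signs = finite {size = 3} (mk↔ₛ′ (λ { 0F → neg ; 1F → zer ; 2F → pos })
                      (λ { neg → 0F ; zer → 1F ; pos → 2F })
                      (λ { neg → refl ; zer → refl ; pos → refl })
                      (λ { 0F → refl ; 1F → refl ; 2F → refl }))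

∑ : ∀ {n} → (Fin n → ℤ) → ℤ
∑ {n} f = foldr ℤ._+_ 0ℤ (map f (allFin n))

∑-from : ∀ {n} → Fin n → (Fin n → ℤ) → ℤ
∑-from {n} p f = foldr ℤ._+_ 0ℤ (map f (filter (p Fin.≤?_) (allFin n)))

ZeroOrOne : ℤ → Set
ZeroOrOne x = x ≡ 0ℤ ⊎ x ≡ 1ℤ

zeroOrOne? : Decidable ZeroOrOne
zeroOrOne? x = (x ℤ.≟ 0ℤ) ⊎-dec (x ℤ.≟ 1ℤ)

record IsUTurn {n : ℕ} (M : Matrix Sign (n * 2) n) : Set where
  a : Fin (n * 2) → Fin n → ℤ
  a i q = value (M at i , q)

  field
    row-tails    : ∀ i p → ZeroOrOne (∑-from p (λ q → a i q))
    column-tails : ∀ j q → ZeroOrOne (∑-from j (λ i → a i q))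
    row-pairs    : ∀ k → ∑ (λ q → a (oddRow n k) q ℤ.+ a (evenRow n k) q) ≡ 1ℤ
    columns      : ∀ q → ∑ (λ i → a i q) ≡ 1ℤ

isUTurn? : ∀ {n} → Decidable (IsUTurn {n})
isUTurn? {n} M = map′
  (λ (r , c , p , s) → record { row-tails = r ; column-tails = c ; row-pairs = p ; columns = s })
  (λ u → let open IsUTurn u in row-tails , column-tails , row-pairs , columns)
  (Finₚ.all? (λ i → Finₚ.all? (λ p → zeroOrOne? (∑-from p (λ q → a i q))))
   ×-dec Finₚ.all? (λ j → Finₚ.all? (λ q → zeroOrOne? (∑-from j (λ i → a i q))))
   ×-dec Finₚ.all? (λ k → ∑ (λ q → a (oddRow n k) q ℤ.+ a (evenRow n k) q) ℤ.≟ 1ℤ)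
   ×-dec Finₚ.all? (λ q → ∑ (λ i → a i q) ℤ.≟ 1ℤ))
  where
  a : Fin (n * 2) → Fin n → ℤ
  a i q = value (M at i , q)

negs : ∀ {m n} → Matrix Sign m n → ℕ
negs M = Vec.count (_≟ neg) (Vec.concat M)
  where open Finite signs using (_≟_)

data Vertical : Set where
  upward downward : Vertical

data Horizontal : Set where
  leftward rightward : Horizontal

data Direction : Set where
  up down left right : Direction

data Flow : Set where
  incoming outgoing : Flow

data Element : Set where
  WE NS NE SW NW SE : Element

verticals : Finite Vertical
verticals = finite {size = 2} (mk↔ₛ′ (λ { 0F → upward ; 1F → downward })
                          (λ { upward → 0F ; downward → 1F })
                          (λ { upward → refl ; downward → refl })
                          (λ { 0F → refl ; 1F → refl }))

horizontals : Finite Horizontal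
horizontals = finite {size = 2} (mk↔ₛ′ (λ { 0F → leftward ; 1F → rightward })
                            (λ { leftward → 0F ; rightward → 1F })
                            (λ { leftward → refl ; rightward → refl })
                            (λ { 0F → refl ; 1F → refl }))

directions : Finite Direction
directions = finite {size = 4} (mk↔ₛ′ (λ { 0F → up ; 1F → down ; 2F → left ; 3F → right })
                           (λ { up → 0F ; down → 1F ; left → 2F ; right → 3F })
                           (λ { up → refl ; down → refl ; left → refl ; right → refl })
                           (λ { 0F → refl ; 1F → refl ; 2F → refl ; 3F → refl }))

flows : Finite Flow
flows = finite {size = 2} (mk↔ₛ′ (λ { 0F → incoming ; 1F → outgoing })
                      (λ { incoming → 0F ; outgoing → 1F })
                      (λ { incoming → refl ; outgoing → refl })
                      (λ { 0F → refl ; 1F → refl }))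

elementTypes : Finite Element
elementTypes = finite {size = 6} (mk↔ₛ′
  (λ { 0F → WE ; 1F → NS ; 2F → NE ; 3F → SW ; 4F → NW ; 5F → SE })
  (λ { WE → 0F ; NS → 1F ; NE → 2F ; SW → 3F ; NW → 4F ; SE → 5F })
  (λ { WE → refl ; NS → refl ; NE → refl ; SW → refl ; NW → refl ; SE → refl })
  (λ { 0F → refl ; 1F → refl ; 2F → refl ; 3F → refl ; 4F → refl ; 5F → refl }))

-- Vertical edges form 2n+1 levels, level i joining vertex rows i-1 and i
-- (counted from 0), so that levels 0 and 2n are the top and bottom boundary.
-- Likewise horizontal edge q of a row lies immediately left of column q, and
-- edges 0 and n are the left and right boundary.
record Orientation (n : ℕ) : Set where
  constructor orientation
  field
    vertical   : Matrix Vertical (suc (n * 2)) n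
    horizontal : Matrix Horizontal (n * 2) (suc n)
open Orientation

orientations : ∀ n → Finite (Orientation n)
orientations n = transport
  (mk↔ₛ′ (λ (v , h) → orientation v h) (λ o → vertical o , horizontal o) (λ _ → refl) (λ _ → refl))
  (matrices verticals (suc (n * 2)) n ×-finite matrices horizontals (n * 2) (suc n))

upEdge downEdge : Vertical → Flow
upEdge upward      = outgoing
upEdge downward    = incoming
downEdge upward   = incoming
downEdge downward = outgoing

leftEdge rightEdge : Horizontal → Flow
leftEdge leftward   = outgoing
leftEdge rightward  = incoming
rightEdge leftward  = incoming
rightEdge rightward = outgoing

flow : ∀ {n} → Orientation n → Fin (n * 2) → Fin n → Direction → Flow
flow o i q up    = upEdge    (vertical o at inject₁ i , q)
flow o i q down  = downEdge  (vertical o at suc i , q)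
flow o i q left  = leftEdge  (horizontal o at i , inject₁ q)
flow o i q right = rightEdge (horizontal o at i , suc q)

numberOf : Flow → (Direction → Flow) → ℕ
numberOf x f = length (filter (λ d → f d ≟ x) (Finite.elements directions))
  where open Finite flows using (_≟_)

record IsSquareIce {n : ℕ} (o : Orientation n) : Set where
  field
    two-in  : ∀ i q → numberOf incoming (flow o i q) ≡ 2
    two-out : ∀ i q → numberOf outgoing (flow o i q) ≡ 2
    right-boundary  : ∀ i → horizontal o at i , fromℕ n ≡ leftward
    bottom-boundary : ∀ q → vertical o at fromℕ (n * 2) , q ≡ downward
    top-boundary    : ∀ q → vertical o at zero , q ≡ upward
    left-boundary   : ∀ k →
        (horizontal o at oddRow n k , zero ≡ rightward × horizontal o at evenRow n k , zero ≡ leftward)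
      ⊎ (horizontal o at oddRow n k , zero ≡ leftward × horizontal o at evenRow n k , zero ≡ rightward)

isSquareIce? : ∀ {n} → Decidable (IsSquareIce {n})
isSquareIce? {n} o = map′
  (λ (i , o , r , b , t , l) → record
    { two-in = i ; two-out = o ; right-boundary = r
    ; bottom-boundary = b ; top-boundary = t ; left-boundary = l })
  (λ s → let open IsSquareIce s in
    two-in , two-out , right-boundary , bottom-boundary , top-boundary , left-boundary)
  (Finₚ.all? (λ i → Finₚ.all? (λ q → numberOf incoming (flow o i q) ℕ.≟ 2))
   ×-dec Finₚ.all? (λ i → Finₚ.all? (λ q → numberOf outgoing (flow o i q) ℕ.≟ 2))
   ×-dec Finₚ.all? (λ i → (horizontal o at i , fromℕ n) ≟ʰ leftward)
   ×-dec Finₚ.all? (λ q → (vertical o at fromℕ (n * 2) , q) ≟ᵛ downward)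
   ×-dec Finₚ.all? (λ q → (vertical o at zero , q) ≟ᵛ upward)
   ×-dec Finₚ.all? (λ k →
           (((horizontal o at oddRow n k , zero) ≟ʰ rightward)
             ×-dec ((horizontal o at evenRow n k , zero) ≟ʰ leftward))
     ⊎-dec (((horizontal o at oddRow n k , zero) ≟ʰ leftward)
             ×-dec ((horizontal o at evenRow n k , zero) ≟ʰ rightward))))
  where
  open Finite horizontals renaming (_≟_ to _≟ʰ_) using ()
  open Finite verticals renaming (_≟_ to _≟ᵛ_) using ()

-- WE and NS name the two incoming edges, the other elements the two outgoing ones.
flowOf : Element → Direction → Flow
flowOf WE left  = incoming
flowOf WE right = incoming
flowOf WE _     = outgoing
flowOf NS up    = incoming
flowOf NS down  = incoming
flowOf NS _     = outgoing
flowOf NE up    = outgoing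
flowOf NE right = outgoing
flowOf NE _     = incoming
flowOf SW down  = outgoing
flowOf SW left  = outgoing
flowOf SW _     = incoming
flowOf NW up    = outgoing
flowOf NW left  = outgoing
flowOf NW _     = incoming
flowOf SE down  = outgoing
flowOf SE right = outgoing
flowOf SE _     = incoming

IsMatrixOf : ∀ {n} → Orientation n → Matrix Element (n * 2) n → Set
IsMatrixOf o M = ∀ i q d → flow o i q d ≡ flowOf (M at i , q) d

isMatrixOf? : ∀ {n} (o : Orientation n) → Decidable (IsMatrixOf o)
isMatrixOf? o M = Finₚ.all? (λ i → Finₚ.all? (λ q → ∀? (λ d → flow o i q d ≟ flowOf (M at i , q) d)))
  where
  open Finite flows using (_≟_)
  open Finite directions using (∀?)

IsIceMatrix : ∀ {n} → Matrix Element (n * 2) n → Set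
IsIceMatrix {n} M = Σ (Orientation n) λ o → IsSquareIce o × IsMatrixOf o M

isIceMatrix? : ∀ {n} → Decidable (IsIceMatrix {n})
isIceMatrix? {n} M = Finite.∃? (orientations n) (λ o → isSquareIce? o ×-dec isMatrixOf? o M)

ns : ∀ {m n} → Matrix Element m n → ℕ
ns M = Vec.count (_≟ NS) (Vec.concat M)
  where open Finite elementTypes using (_≟_)

{-# OPTIONS --safe #-}
-- All three families are monotone triangles in disguise.  In a U-turn matrix,
-- or in the corresponding ice configuration, read off for every vertical line
-- between columns the rows whose horizontal edge points right; in a tableau,
-- read off the diagonals.  The successive sets interlace, the first consists
-- of one element from each pair {2k, 2k+1}, and each entry of a set not in its
-- predecessor carries weight 2.
--
-- Weighted interlacing is the trapezoidal rule: summing a determinant of rows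
-- e(s), for s interlacing r₁ < … < r_k, gives the determinant with the rows
-- E(r₂) - E(r₁), …, E(r_k) - E(r_{k-1}), where E(r+1) - E(r) = e(r) + e(r+1).
-- By Laplace expansion this is the determinant with the k rows (1, E(r_i)), so
-- that the number of triangles over r is det (e(r_i)) for rows e(r) given by
-- e(r) = (1, E(r)).  Choosing one element from each pair replaces the rows by
-- e(2i) + e(2i+1).  With A f (r) = f(r) + f(r+1), expanding the determinant
-- of the rows (Aᵐe)(2i) gives a factor 2ᵐ and leaves the rows (Aᵐ⁺²e)(2i), so
-- that the total is 2¹⁺³⁺⋯⁺⁽²ⁿ⁻¹⁾.
module Submission where

import Algebra.Properties.CommutativeMonoid.Sum
open import Data.Bool using (false; if_then_else_; true)
open import Data.Fin as Fin using (Fin; fromℕ; inject₁; suc; toℕ; zero)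
import Data.Fin.Properties as Finₚ
open import Data.Fin.Relation.Unary.Top using (view; ‵fromℕ; ‵inject₁)
open import Data.Integer as ℤ using (+_; 0ℤ; 1ℤ; ℤ)
import Data.Integer.Properties as ℤₚ
open import Data.Integer.Tactic.RingSolver using (solve-∀)
open import Data.List as List using (_++_; List; []; allFin; cartesianProduct; deduplicate; filter; foldr; length; map; _∷_)
open import Data.List.Membership.Propositional using (find; _∈_)
open import Data.List.Membership.Propositional.Properties using (∈-++⁺ʳ; ∈-++⁺ˡ; ∈-cartesianProduct⁺; ∈-deduplicate⁻; ∈-filter⁺; ∈-filter⁻; ∈-map⁺; ∈-map⁻)
open import Data.List.Membership.Propositional.Properties.WithK using (unique∧set⇒bag)
open import Data.List.Properties using (filter-accept; filter-all; filter-reject; filter-≐; length-map; map-++; map-id; map-tabulate; map-∘)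
open import Data.List.Relation.Binary.BagAndSetEquality using (∼bag⇒↭)
open import Data.List.Relation.Binary.Permutation.Propositional as Perm using (_↭_)
open import Data.List.Relation.Binary.Permutation.Propositional.Properties using (↭-length)
open import Data.List.Relation.Unary.All as All using (All; []; _∷_)
open import Data.List.Relation.Unary.AllPairs using (AllPairs; []; _∷_)
open import Data.List.Relation.Unary.Any as Any using (here; there)
import Data.List.Relation.Unary.Any.Properties as Anyₚ
import Data.List.Relation.Unary.Unique.DecSetoid.Properties as DecUniqueₚ
open import Data.List.Relation.Unary.Unique.Propositional using (Unique)
import Data.List.Relation.Unary.Unique.Propositional.Properties as Uniqueₚ
open import Data.Nat as ℕ using (suc; zero; ℕ)
open import Data.Nat.ListAction using (sum)
import Data.Nat.Properties as ℕₚ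
open import Data.Product using (_,_; proj₁; proj₂; _×_; ∃)
open import Data.Sum using (inj₁; inj₂; _⊎_)
open import Data.Vec as Vec using (Vec; []; lookup; tabulate; _∷_)
open import Data.Vec.Properties using (lookup∘tabulate; tabulate-cong; tabulate∘lookup)
open import Function using (Inverse; id; mk↔ₛ′; mk⇔; _↔_; _∘_)
open import Level using (0ℓ)
open import Relation.Binary using (DecSetoid; IsEquivalence; Rel) renaming (Decidable to Decidable₂)
open import Relation.Binary.Construct.Closure.ReflexiveTransitive using (reverse; ε; _◅_; _◅◅_)
open import Relation.Binary.PropositionalEquality using (cong; cong₂; refl; subst; subst₂; sym; trans; _≡_; _≢_; module ≡-Reasoning)
open import Relation.Nullary using (Dec; contradiction; does; no; recompute; yes; ¬_; ¬?; _×-dec_; _→-dec_; _⊎-dec_)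
open import Relation.Unary using (Decidable; Pred)
open import Defs
open ≡-Reasoning

-- No bijection between tableaux and matrices is used: the two sides are evaluated separately and
-- meet only in the determinant of averaged rows. U-turn and ice matrices, in contrast, are matched
-- with the same orientations. Membership in a family is turned into an integer weight, a product of
-- local factors that is a power of 2 on the family and 0 off it; sums of such weights can be split
-- and exchanged freely.
--
-- The obstacle is strictness. The trapezoidal rule chooses one entry in each closed interval
-- independently, so neighbouring intervals may both choose their common endpoint. The ice rule and
-- the strict diagonals forbid this, yet the sums agree, because a determinant with two equal rows
-- vanishes. For tableaux this is applied to a whole diagonal, for ice row by row down a column.
--
-- The exponent `str T ∸ n` comes from the shape of components: in a monotone filling equal letters
-- form strips without branching, each with one south-western end. The `n` boxes of the main
-- diagonal are always such ends; any other box is one exactly if its letter differs from its two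
-- neighbours on the preceding diagonal.

module _ where
  open import Data.Integer using (_+_; _-_; _*_)

  -- Determinants

  infixl 6 _⊕_ _⊖_
  _⊕_ _⊖_ : ∀ {k} → Vec ℤ k → Vec ℤ k → Vec ℤ k
  _⊕_ = Vec.zipWith _+_
  _⊖_ = Vec.zipWith _-_

  ⊖-⊕ : ∀ {k} (u v : Vec ℤ k) → (u ⊖ v) ⊕ v ≡ u
  ⊖-⊕ []      []      = refl
  ⊖-⊕ (x ∷ u) (y ∷ v) = cong₂ _∷_ (lemma x y) (⊖-⊕ u v)
    where
    lemma : ∀ x y → (x - y) + y ≡ x
    lemma = solve-∀

  -- Over ℤ, additivity in each row gives linearity, and vanishing on adjacent equal rows gives
  -- antisymmetry. Functionals on lists of every length let leading rows be fixed without tracking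
  -- dimensions.
  record Alternating {k} (F : List (Vec ℤ k) → ℤ) : Set where
    field
      additive : ∀ us v w ws → F (us ++ (v ⊕ w) ∷ ws) ≡ F (us ++ v ∷ ws) + F (us ++ w ∷ ws)
      repeated : ∀ us v ws → F (us ++ v ∷ v ∷ ws) ≡ 0ℤ

    subtractive : ∀ v w ws → F ((v ⊖ w) ∷ ws) ≡ F (v ∷ ws) - F (w ∷ ws)
    subtractive v w ws = begin
      F ((v ⊖ w) ∷ ws)                               ≡⟨ lemma _ (F (w ∷ ws)) ⟩
      (F ((v ⊖ w) ∷ ws) + F (w ∷ ws)) - F (w ∷ ws)   ≡⟨ cong (_- F (w ∷ ws)) (additive [] (v ⊖ w) w ws) ⟨
      F (((v ⊖ w) ⊕ w) ∷ ws) - F (w ∷ ws)            ≡⟨ cong (λ u → F (u ∷ ws) - F (w ∷ ws)) (⊖-⊕ v w) ⟩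
      F (v ∷ ws) - F (w ∷ ws)                        ∎
      where
      lemma : ∀ x y → x ≡ (x + y) - y
      lemma = solve-∀

  open Alternating

  -- Nearly every induction below fixes the leading row and continues with the rest. Alternating
  -- functionals are closed under this operation and determinants are not, hence the generality of
  -- the lemmas.
  fix-first : ∀ {k} {F : List (Vec ℤ k) → ℤ} → Alternating F → ∀ v → Alternating (λ ws → F (v ∷ ws))
  fix-first A v = record
    { additive = λ us → additive A (v ∷ us)
    ; repeated = λ us → repeated A (v ∷ us)
    }

  -- Laplace expansion along the first coordinate.
  contract : ∀ {k} → (List (Vec ℤ k) → ℤ) → List (Vec ℤ (suc k)) → ℤ
  contract F []             = 0ℤ
  contract F ((x ∷ v) ∷ ws) = x * F (map Vec.tail ws) - contract (λ us → F (v ∷ us)) ws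

  -- `contract` recurses with the leading row fixed in the functional; when that row is a sum, it is
  -- the functional that splits.
  contract-+ : ∀ {k} {F G H : List (Vec ℤ k) → ℤ} → (∀ us → F us ≡ G us + H us) →
               ∀ ws → contract F ws ≡ contract G ws + contract H ws
  contract-+ F≡G+H []             = refl
  contract-+ F≡G+H ((x ∷ v) ∷ ws) = trans
    (cong₂ (λ y z → x * y - z) (F≡G+H _) (contract-+ (λ us → F≡G+H (v ∷ us)) ws))
    (lemma x _ _ _ _)
    where
    lemma : ∀ x y y′ z z′ → x * (y + y′) - (z + z′) ≡ (x * y - z) + (x * y′ - z′)
    lemma = solve-∀

  contract-0 : ∀ {k} {F : List (Vec ℤ k) → ℤ} → (∀ us → F us ≡ 0ℤ) → ∀ ws → contract F ws ≡ 0ℤ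
  contract-0 F≡0 []             = refl
  contract-0 F≡0 ((x ∷ v) ∷ ws) = trans
    (cong₂ (λ y z → x * y - z) (F≡0 _) (contract-0 (λ us → F≡0 (v ∷ us)) ws))
    (lemma x)
    where
    lemma : ∀ x → x * 0ℤ - 0ℤ ≡ 0ℤ
    lemma = solve-∀

  -- For two equal leading rows the first two terms of the expansion cancel, and all later terms
  -- have both rows fixed, where the functional vanishes. Otherwise the leading row is fixed and the
  -- claim is passed on to the others.
  contract-alternating : ∀ {k} {F : List (Vec ℤ k) → ℤ} → Alternating F → Alternating (contract F)
  contract-alternating A = record { additive = add A ; repeated = rep A }
    where
    add : ∀ {k} {F : List (Vec ℤ k) → ℤ} → Alternating F → ∀ us v w ws →
          contract F (us ++ (v ⊕ w) ∷ ws) ≡ contract F (us ++ v ∷ ws) + contract F (us ++ w ∷ ws)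
    add A [] (x ∷ v) (y ∷ w) ws = trans
      (cong (λ z → (x + y) * _ - z) (contract-+ (additive A [] v w) ws))
      (lemma x y _ _ _)
      where
      lemma : ∀ x y f z z′ → (x + y) * f - (z + z′) ≡ (x * f - z) + (y * f - z′)
      lemma = solve-∀
    add {F = F} A ((x ∷ u) ∷ us) (y ∷ v) (z ∷ w) ws = trans
      (cong₂ (λ f g → x * f - g) eq (add (fix-first A u) us (y ∷ v) (z ∷ w) ws))
      (lemma x _ _ _ _)
      where
      lemma : ∀ x y y′ z z′ → x * (y + y′) - (z + z′) ≡ (x * y - z) + (x * y′ - z′)
      lemma = solve-∀
      eq : F (map Vec.tail (us ++ (y + z ∷ v ⊕ w) ∷ ws))
           ≡ F (map Vec.tail (us ++ (y ∷ v) ∷ ws)) + F (map Vec.tail (us ++ (z ∷ w) ∷ ws))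
      eq rewrite map-++ Vec.tail us ((y + z ∷ v ⊕ w) ∷ ws) | map-++ Vec.tail us ((y ∷ v) ∷ ws)
               | map-++ Vec.tail us ((z ∷ w) ∷ ws) = additive A _ v w _

    rep : ∀ {k} {F : List (Vec ℤ k) → ℤ} → Alternating F → ∀ us v ws →
          contract F (us ++ v ∷ v ∷ ws) ≡ 0ℤ
    rep {F = F} A [] (x ∷ v) ws = trans
      (cong (λ z → x * f - (x * f - z)) (contract-0 (repeated A [] v) ws))
      (lemma x f)
      where
      f = F (v ∷ map Vec.tail ws)
      lemma : ∀ x f → x * f - (x * f - 0ℤ) ≡ 0ℤ
      lemma = solve-∀
    rep {F = F} A ((x ∷ u) ∷ us) (y ∷ v) ws = trans
      (cong₂ (λ f g → x * f - g) eq (rep (fix-first A u) us (y ∷ v) ws))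
      (lemma x)
      where
      lemma : ∀ x → x * 0ℤ - 0ℤ ≡ 0ℤ
      lemma = solve-∀
      eq : F (map Vec.tail (us ++ (y ∷ v) ∷ (y ∷ v) ∷ ws)) ≡ 0ℤ
      eq rewrite map-++ Vec.tail us ((y ∷ v) ∷ (y ∷ v) ∷ ws) = repeated A _ v _

  -- The determinant, extended by 0 to lists whose length is not the dimension.
  det : ∀ k → List (Vec ℤ k) → ℤ
  det zero    []      = 1ℤ
  det zero    (_ ∷ _) = 0ℤ
  det (suc k)         = contract (det k)

  det-alternating : ∀ k → Alternating (det k)
  det-alternating zero    = record
    { additive = λ { [] _ _ _ → refl ; (_ ∷ _) _ _ _ → refl }
    ; repeated = λ { [] _ _ → refl ; (_ ∷ _) _ _ → refl }
    }
  det-alternating (suc k) = contract-alternating (det-alternating k)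

  differences : ∀ {k} → Vec ℤ k → List (Vec ℤ k) → List (Vec ℤ k)
  differences v []       = []
  differences v (w ∷ ws) = (w ⊖ v) ∷ differences w ws

  module _ {k : ℕ} where

    -- Each row is diminished by its predecessor, starting from the last, so that the predecessor is
    -- still unchanged when it is subtracted.
    cumulate : ∀ {F : List (Vec ℤ k) → ℤ} → Alternating F → ∀ v ws →
               F (v ∷ ws) ≡ F (v ∷ differences v ws)
    cumulate     A v []       = refl
    cumulate {F} A v (w ∷ ws) = begin
      F (v ∷ w ∷ ws)                                    ≡⟨ cumulate (fix-first A v) w ws ⟩
      F (v ∷ w ∷ ds)                                    ≡⟨ lemma _ ⟩
      F (v ∷ w ∷ ds) - 0ℤ                               ≡⟨ cong (λ y → F (v ∷ w ∷ ds) - y) (repeated A [] v ds) ⟨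
      F (v ∷ w ∷ ds) - F (v ∷ v ∷ ds)                   ≡⟨ subtractive (fix-first A v) w v ds ⟨
      F (v ∷ (w ⊖ v) ∷ ds)                              ∎
      where
      ds = differences w ws
      lemma : ∀ x → x ≡ x - 0ℤ
      lemma = solve-∀

    -- Subtracting from each row its predecessor clears the constant first coordinate in all rows
    -- but the first, so a single Laplace term survives. The induction performs these subtractions
    -- inside the expansion.
    contract-constant : ∀ {F : List (Vec ℤ k) → ℤ} → Alternating F → ∀ x v ws →
                        contract F (map (x ∷_) (v ∷ ws)) ≡ x * F (differences v ws)
    contract-constant     A x v []       = lemma _
      where
      lemma : ∀ x → x - 0ℤ ≡ x
      lemma = solve-∀
    contract-constant {F} A x v (w ∷ ws) = begin
      x * F (w ∷ map Vec.tail (map (x ∷_) ws)) - contract (λ us → F (v ∷ us)) (map (x ∷_) (w ∷ ws))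
        ≡⟨ cong₂ (λ us y → x * F (w ∷ us) - y) (tails ws) (contract-constant (fix-first A v) x w ws) ⟩
      x * F (w ∷ ws) - x * F (v ∷ ds)
        ≡⟨ cong (λ y → x * y - x * F (v ∷ ds)) (cumulate A w ws) ⟩
      x * F (w ∷ ds) - x * F (v ∷ ds)
        ≡⟨ lemma x _ _ ⟩
      x * (F (w ∷ ds) - F (v ∷ ds))
        ≡⟨ cong (x *_) (subtractive A w v ds) ⟨
      x * F ((w ⊖ v) ∷ ds) ∎
      where
      ds = differences w ws
      tails : ∀ us → map Vec.tail (map (x ∷_) us) ≡ us
      tails []       = refl
      tails (u ∷ us) = cong (u ∷_) (tails us)
      lemma : ∀ x y z → x * y - x * z ≡ x * (y - z)
      lemma = solve-∀

  -- The rows whose determinants count monotone triangles: coordinate j of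
  -- `basis k r` is the coefficient of x^j in ((1 + x) / (1 - x))^r, so that
  -- integral k r = Σ_{s<r} (basis k s ⊕ basis k (s+1)) is the trapezoidal sum.
  basis integral : ∀ k → ℕ → Vec ℤ k
  basis zero    r = []
  basis (suc k) r = 1ℤ ∷ integral k r
  integral k zero    = Vec.replicate k 0ℤ
  integral k (suc r) = integral k r ⊕ (basis k r ⊕ basis k (suc r))

  -- Averaged rows and the value of their determinant

  average : ∀ {k} → (ℕ → Vec ℤ k) → ℕ → Vec ℤ k
  average f r = f r ⊕ f (suc r)

  averages : ∀ {k} → ℕ → (ℕ → Vec ℤ k) → ℕ → Vec ℤ k
  averages zero    f = f
  averages (suc m) f = average (averages m f)

  ⊕-swap : ∀ {k} (a b c d e f : Vec ℤ k) → (a ⊕ (c ⊕ d)) ⊕ (b ⊕ (e ⊕ f)) ≡ (a ⊕ b) ⊕ ((c ⊕ e) ⊕ (d ⊕ f))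
  ⊕-swap []      []      []      []      []      []      = refl
  ⊕-swap (a ∷ u) (b ∷ v) (c ∷ w) (d ∷ x) (e ∷ y) (f ∷ z) = cong₂ _∷_ (lemma a b c d e f) (⊕-swap u v w x y z)
    where
    lemma : ∀ a b c d e f → (a + (c + d)) + (b + (e + f)) ≡ (a + b) + ((c + e) + (d + f))
    lemma = solve-∀

  -- The first coordinate of `basis` is constantly 1 and doubles with each averaging: this is the
  -- source of all powers of 2 in the total.
  averages-basis : ∀ {k} m r → averages m (basis (suc k)) r ≡ (+ (2 ℕ.^ m)) ∷ averages m (integral k) r
  averages-basis zero    r = refl
  averages-basis (suc m) r = trans (cong₂ _⊕_ (averages-basis m r) (averages-basis m (suc r)))
    (cong (λ x → x ∷ averages (suc m) (integral _) r) (cong +_ (cong (2 ℕ.^ m ℕ.+_) (sym (ℕₚ.+-identityʳ _)))))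

  -- The successive differences of `integral` are `average basis`, and averaging commutes with
  -- taking differences.
  averages-integral : ∀ {k} m r → averages m (integral k) (suc r) ≡ averages m (integral k) r ⊕ averages (suc m) (basis k) r
  averages-integral zero    r = refl
  averages-integral (suc m) r = trans
    (cong₂ _⊕_ (averages-integral m r) (averages-integral m (suc r)))
    (⊕-swap _ _ _ _ _ _)

  cancel : ∀ {k} (u v w : Vec ℤ k) → ((u ⊕ v) ⊕ w) ⊖ u ≡ v ⊕ w
  cancel []      []      []      = refl
  cancel (x ∷ u) (y ∷ v) (z ∷ w) = cong₂ _∷_ (lemma x y z) (cancel u v w)
    where
    lemma : ∀ x y z → ((x + y) + z) - x ≡ y + z
    lemma = solve-∀

  -- A step of length two adds two consecutive differences, which is one more averaging. Since the
  -- rows lie two apart, each expansion raises the number of averagings by two.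
  averages-integral-⊖ : ∀ {k} m r →
    averages m (integral k) (2 ℕ.+ r) ⊖ averages m (integral k) r ≡ averages (2 ℕ.+ m) (basis k) r
  averages-integral-⊖ {k} m r = begin
    averages m (integral k) (2 ℕ.+ r) ⊖ averages m (integral k) r
      ≡⟨ cong (_⊖ averages m (integral k) r) (trans (averages-integral m (suc r))
           (cong (_⊕ averages (suc m) (basis k) (suc r)) (averages-integral m r))) ⟩
    ((averages m (integral k) r ⊕ averages (suc m) (basis k) r) ⊕ averages (suc m) (basis k) (suc r)) ⊖ averages m (integral k) r
      ≡⟨ cancel _ _ _ ⟩
    averages (2 ℕ.+ m) (basis k) r ∎

  everyOther : {A : Set} → (ℕ → A) → ℕ → ℕ → List A
  everyOther f r zero    = []
  everyOther f r (suc n) = f r ∷ everyOther f (2 ℕ.+ r) n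

  everyOther-cong : {A : Set} {f g : ℕ → A} → (∀ r → f r ≡ g r) → ∀ r n → everyOther f r n ≡ everyOther g r n
  everyOther-cong f≡g r zero    = refl
  everyOther-cong f≡g r (suc n) = cong₂ _∷_ (f≡g r) (everyOther-cong f≡g (2 ℕ.+ r) n)

  everyOther-map : {A B : Set} (h : A → B) (f : ℕ → A) → ∀ r n → everyOther (λ s → h (f s)) r n ≡ map h (everyOther f r n)
  everyOther-map h f r zero    = refl
  everyOther-map h f r (suc n) = cong (h (f r) ∷_) (everyOther-map h f (2 ℕ.+ r) n)

  differences-everyOther : ∀ {k} m r n →
    differences (averages m (integral k) r) (everyOther (averages m (integral k)) (2 ℕ.+ r) n)
    ≡ everyOther (averages (2 ℕ.+ m) (basis k)) r n
  differences-everyOther m r zero    = refl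
  differences-everyOther m r (suc n) =
    cong₂ _∷_ (averages-integral-⊖ m r) (differences-everyOther m (2 ℕ.+ r) n)

  -- Each expansion yields a factor 2 to the power `m` and replaces `m` by `m` + 2, so the exponent
  -- is m + (m + 2) + ... + (m + 2(n - 1)). The starting row `r` stays arbitrary and does not affect
  -- the value.
  det-averages : ∀ n m r → det n (everyOther (averages m (basis n)) r n) ≡ + (2 ℕ.^ (n ℕ.* m ℕ.+ n ℕ.* (n ℕ.∸ 1)))
  det-averages zero    m r = refl
  det-averages (suc n) m r = begin
    contract (det n) (everyOther (averages m (basis (suc n))) r (suc n))
      ≡⟨ cong (contract (det n)) (trans (everyOther-cong (averages-basis m) r (suc n))
           (everyOther-map (+ (2 ℕ.^ m) ∷_) (averages m (integral n)) r (suc n))) ⟩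
    contract (det n) (map (+ (2 ℕ.^ m) ∷_) (everyOther (averages m (integral n)) r (suc n)))
      ≡⟨ contract-constant (det-alternating n) (+ (2 ℕ.^ m)) (averages m (integral n) r)
           (everyOther (averages m (integral n)) (2 ℕ.+ r) n) ⟩
    + (2 ℕ.^ m) * det n (differences (averages m (integral n) r) (everyOther (averages m (integral n)) (2 ℕ.+ r) n))
      ≡⟨ cong (λ ws → + (2 ℕ.^ m) * det n ws) (differences-everyOther m r n) ⟩
    + (2 ℕ.^ m) * det n (everyOther (averages (2 ℕ.+ m) (basis n)) r n)
      ≡⟨ cong (+ (2 ℕ.^ m) *_) (det-averages n (2 ℕ.+ m) r) ⟩
    + (2 ℕ.^ m) * + (2 ℕ.^ (n ℕ.* (2 ℕ.+ m) ℕ.+ n ℕ.* (n ℕ.∸ 1)))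
      ≡⟨ ℤₚ.pos-* (2 ℕ.^ m) _ ⟨
    + (2 ℕ.^ m ℕ.* 2 ℕ.^ (n ℕ.* (2 ℕ.+ m) ℕ.+ n ℕ.* (n ℕ.∸ 1)))
      ≡⟨ cong +_ (ℕₚ.^-distribˡ-+-* 2 m _) ⟨
    + (2 ℕ.^ (m ℕ.+ (n ℕ.* (2 ℕ.+ m) ℕ.+ n ℕ.* (n ℕ.∸ 1))))
      ≡⟨ cong (λ p → + (2 ℕ.^ p)) (exponent n m) ⟩
    + (2 ℕ.^ (suc n ℕ.* m ℕ.+ suc n ℕ.* n)) ∎
    where
    open import Data.Nat.Tactic.RingSolver using () renaming (solve-∀ to solveℕ)
    exponent : ∀ n m → m ℕ.+ (n ℕ.* (2 ℕ.+ m) ℕ.+ n ℕ.* (n ℕ.∸ 1)) ≡ suc n ℕ.* m ℕ.+ suc n ℕ.* n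
    exponent zero    = lemma
      where
      lemma : ∀ m → m ℕ.+ 0 ≡ (m ℕ.+ 0) ℕ.+ 0
      lemma = solveℕ
    exponent (suc n) = lemma n
      where
      lemma : ∀ n m → m ℕ.+ (suc n ℕ.* (2 ℕ.+ m) ℕ.+ suc n ℕ.* n) ≡ suc (suc n) ℕ.* m ℕ.+ suc (suc n) ℕ.* suc n
      lemma = solveℕ

  -- Finite sums

  private variable A B : Set

  sumBy : (A → ℤ) → List A → ℤ
  sumBy f []       = 0ℤ
  sumBy f (x ∷ xs) = f x + sumBy f xs

  sumBy-cong : {f g : A → ℤ} → (∀ x → f x ≡ g x) → ∀ xs → sumBy f xs ≡ sumBy g xs
  sumBy-cong f≡g []       = refl
  sumBy-cong f≡g (x ∷ xs) = cong₂ _+_ (f≡g x) (sumBy-cong f≡g xs)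

  sumBy-cong-∈ : {f g : A → ℤ} → ∀ xs → (∀ {x} → x ∈ xs → f x ≡ g x) → sumBy f xs ≡ sumBy g xs
  sumBy-cong-∈ []       f≡g = refl
  sumBy-cong-∈ (x ∷ xs) f≡g = cong₂ _+_ (f≡g (here refl)) (sumBy-cong-∈ xs (f≡g ∘ there))

  sumBy-++ : (f : A → ℤ) → ∀ xs ys → sumBy f (xs ++ ys) ≡ sumBy f xs + sumBy f ys
  sumBy-++ f []       ys = sym (ℤₚ.+-identityˡ _)
  sumBy-++ f (x ∷ xs) ys = trans (cong (λ s → f x + s) (sumBy-++ f xs ys)) (sym (ℤₚ.+-assoc (f x) _ _))

  sumBy-map : (f : B → ℤ) (g : A → B) → ∀ xs → sumBy f (map g xs) ≡ sumBy (f ∘ g) xs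
  sumBy-map f g []       = refl
  sumBy-map f g (x ∷ xs) = cong (λ s → f (g x) + s) (sumBy-map f g xs)

  sumBy-↭ : (f : A → ℤ) → ∀ {xs ys} → xs ↭ ys → sumBy f xs ≡ sumBy f ys
  sumBy-↭ f Perm.refl        = refl
  sumBy-↭ f (Perm.prep x p)  = cong (λ s → f x + s) (sumBy-↭ f p)
  sumBy-↭ f (Perm.swap {ys = ys} x y p) = trans (cong (λ s → f x + (f y + s)) (sumBy-↭ f p)) (lemma (f x) (f y) (sumBy f ys))
    where
    lemma : ∀ x y s → x + (y + s) ≡ y + (x + s)
    lemma = solve-∀
  sumBy-↭ f (Perm.trans p q) = trans (sumBy-↭ f p) (sumBy-↭ f q)

  sumBy-* : (c : ℤ) (f : A → ℤ) → ∀ xs → sumBy (λ x → c * f x) xs ≡ c * sumBy f xs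
  sumBy-* c f []       = sym (ℤₚ.*-zeroʳ c)
  sumBy-* c f (x ∷ xs) = trans (cong (λ s → c * f x + s) (sumBy-* c f xs)) (sym (ℤₚ.*-distribˡ-+ c (f x) _))

  sumBy-+ : (f g : A → ℤ) → ∀ xs → sumBy (λ x → f x + g x) xs ≡ sumBy f xs + sumBy g xs
  sumBy-+ f g []       = refl
  sumBy-+ f g (x ∷ xs) = trans (cong (λ s → f x + g x + s) (sumBy-+ f g xs)) (lemma (f x) (g x) (sumBy f xs) (sumBy g xs))
    where
    lemma : ∀ a b c d → (a + b) + (c + d) ≡ (a + c) + (b + d)
    lemma = solve-∀

  sumBy-0 : ∀ (xs : List A) → sumBy (λ _ → 0ℤ) xs ≡ 0ℤ
  sumBy-0 []       = refl
  sumBy-0 (_ ∷ xs) = trans (ℤₚ.+-identityˡ _) (sumBy-0 xs)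

  sumBy-swap : (f : A → B → ℤ) → ∀ xs ys →
               sumBy (λ x → sumBy (f x) ys) xs ≡ sumBy (λ y → sumBy (λ x → f x y) xs) ys
  sumBy-swap f []       ys = sym (sumBy-0 ys)
  sumBy-swap f (x ∷ xs) ys = trans (cong (λ s → sumBy (f x) ys + s) (sumBy-swap f xs ys))
                                     (sym (sumBy-+ (f x) _ ys))

  sumBy-cartesianProduct : (f : A × B → ℤ) → ∀ xs ys →
                           sumBy f (cartesianProduct xs ys) ≡ sumBy (λ x → sumBy (λ y → f (x , y)) ys) xs
  sumBy-cartesianProduct f []       ys = refl
  sumBy-cartesianProduct f (x ∷ xs) ys = trans (sumBy-++ f (map (x ,_) ys) _)
    (cong₂ _+_ (sumBy-map f (x ,_) ys) (sumBy-cartesianProduct f xs ys))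

  sum-as-sumBy : (w : A → ℕ) → ∀ xs → + sum (map w xs) ≡ sumBy (λ x → + w x) xs
  sum-as-sumBy w []       = refl
  sum-as-sumBy w (x ∷ xs) = trans (ℤₚ.pos-+ (w x) _) (cong (λ s → + w x + s) (sum-as-sumBy w xs))

  same-members⇒↭ : {xs ys : List A} → Unique xs → Unique ys →
                   (∀ {x} → x ∈ xs → x ∈ ys) → (∀ {x} → x ∈ ys → x ∈ xs) → xs ↭ ys
  same-members⇒↭ xs! ys! to from = ∼bag⇒↭ (unique∧set⇒bag xs! ys! (mk⇔ to from))

  unique-map : (f : A → B) → ∀ {xs} → Unique xs →
               (∀ {x y} → x ∈ xs → y ∈ xs → f x ≡ f y → x ≡ y) → Unique (map f xs)
  unique-map f []         inj = []
  unique-map f {x ∷ xs} (x∉ ∷ xs!) inj =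
    All.tabulate (λ fy∈ fx≡fy → let y , y∈ , eq = ∈-map⁻ f fy∈ in
      All.lookup x∉ y∈ (inj (here refl) (there y∈) (trans fx≡fy eq)))
    ∷ unique-map f xs! (λ x∈ y∈ → inj (there x∈) (there y∈))

  elements-unique : (F : Finite A) → Unique (Finite.elements F)
  elements-unique F = Uniqueₚ.map⁺ (λ {i} {j} eq → trans (sym (strictlyInverseʳ i)) (trans (cong from eq) (strictlyInverseʳ j)))
                                   (Uniqueₚ.allFin⁺ _)
    where open Inverse (Finite.index F)

  total : Finite A → (A → ℤ) → ℤ
  total F f = sumBy f (Finite.elements F)

  total-* : {A : Set} (F : Finite A) (c : ℤ) (f : A → ℤ) → total F (λ x → c * f x) ≡ c * total F f
  total-* F c f = sumBy-* c f (Finite.elements F)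

  total-cong : {A : Set} (F : Finite A) {f g : A → ℤ} → (∀ x → f x ≡ g x) → total F f ≡ total F g
  total-cong F f≡g = sumBy-cong f≡g (Finite.elements F)

  total-swap : {A B : Set} (F : Finite A) (G : Finite B) (f : A → B → ℤ) →
               total F (λ x → total G (f x)) ≡ total G (λ y → total F (λ x → f x y))
  total-swap F G f = sumBy-swap f (Finite.elements F) (Finite.elements G)

  total-↭ : (F : Finite A) (f : A → ℤ) → ∀ {xs} → Unique xs → (∀ x → x ∈ xs) → total F f ≡ sumBy f xs
  total-↭ F f xs! complete = sumBy-↭ f
    (same-members⇒↭ (elements-unique F) xs! (λ _ → complete _) (λ _ → Finite.complete F _))

  total-transport : (A↔B : A ↔ B) (F : Finite A) (f : B → ℤ) →
                    total (transport A↔B F) f ≡ total F (f ∘ Inverse.to A↔B)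
  total-transport A↔B F f = trans (cong (sumBy f) (map-∘ {g = Inverse.to A↔B} {f = Inverse.to (Finite.index F)} (allFin _)))
    (sumBy-map f (Inverse.to A↔B) (Finite.elements F))

  total-× : (F : Finite A) (G : Finite B) (f : A × B → ℤ) →
            total (F ×-finite G) f ≡ total F (λ a → total G (λ b → f (a , b)))
  total-× F G f = trans
    (total-↭ (F ×-finite G) f
      (Uniqueₚ.cartesianProduct⁺ (elements-unique F) (elements-unique G))
      (λ (a , b) → ∈-cartesianProduct⁺ (Finite.complete F a) (Finite.complete G b)))
    (sumBy-cartesianProduct f (Finite.elements F) (Finite.elements G))

  total-⊎ : (F : Finite A) (G : Finite B) (f : A ⊎ B → ℤ) →
            total (F ⊎-finite G) f ≡ total F (f ∘ inj₁) + total G (f ∘ inj₂)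
  total-⊎ {A = A} {B} F G f = begin
    total (F ⊎-finite G) f
      ≡⟨ total-↭ (F ⊎-finite G) f unique complete ⟩
    sumBy f (map inj₁ xs ++ map inj₂ ys)
      ≡⟨ sumBy-++ f (map inj₁ xs) _ ⟩
    sumBy f (map inj₁ xs) + sumBy f (map inj₂ ys)
      ≡⟨ cong₂ _+_ (sumBy-map f inj₁ xs) (sumBy-map f inj₂ ys) ⟩
    total F (f ∘ inj₁) + total G (f ∘ inj₂) ∎
    where
    xs = Finite.elements F
    ys = Finite.elements G
    unique : Unique (map inj₁ xs ++ map inj₂ ys)
    unique = Uniqueₚ.++⁺ (Uniqueₚ.map⁺ (λ { refl → refl }) (elements-unique F))
                         (Uniqueₚ.map⁺ (λ { refl → refl }) (elements-unique G))
                         (λ (x∈ , y∈) → disjoint (∈-map⁻ inj₁ x∈) (∈-map⁻ inj₂ y∈))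
      where
      disjoint : ∀ {z : A ⊎ B} → (∃ λ x → x ∈ xs × z ≡ inj₁ x) → ¬ (∃ λ y → y ∈ ys × z ≡ inj₂ y)
      disjoint (_ , _ , refl) (_ , _ , ())
    complete : ∀ z → z ∈ map inj₁ xs ++ map inj₂ ys
    complete (inj₁ a) = ∈-++⁺ˡ (∈-map⁺ inj₁ (Finite.complete F a))
    complete (inj₂ b) = ∈-++⁺ʳ (map inj₁ xs) (∈-map⁺ inj₂ (Finite.complete G b))

  -- A sum over a finite type is independent of its enumeration: the one carried over from `F` and
  -- that of `G` both list every element once, hence are permutations of each other. The splittings
  -- of sums over vectors, triangles, letters and boxes all rest on this.
  total-inverse : (F : Finite A) (G : Finite B) (A↔B : A ↔ B) (f : B → ℤ) →
                  total F (f ∘ Inverse.to A↔B) ≡ total G f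
  total-inverse F G A↔B f = trans (sym (total-transport A↔B F f))
    (total-↭ (transport A↔B F) f (elements-unique G) (Finite.complete G))

  total-vecs : (F : Finite A) (n : ℕ) (f : Vec A (suc n) → ℤ) →
               total (vecs F (suc n)) f ≡ total F (λ x → total (vecs F n) (λ xs → f (x ∷ xs)))
  total-vecs F n f = trans (sym (total-inverse (F ×-finite vecs F n) (vecs F (suc n)) cons f)) (total-× F (vecs F n) _)
    where
    cons = mk↔ₛ′ (λ (x , xs) → x ∷ xs) (λ { (x ∷ xs) → x , xs }) (λ { (_ ∷ _) → refl }) (λ { (_ , _) → refl })

  total-vecs-0 : (F : Finite A) (f : Vec A zero → ℤ) → total (vecs F zero) f ≡ f []
  total-vecs-0 F f = ℤₚ.+-identityʳ (f [])

  total-triangles : (F : Finite A) (n : ℕ) (f : Triangle A (suc n) → ℤ) →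
                    total (triangles F (suc n)) f
                    ≡ total (vecs F (suc n)) (λ r → total (triangles F n) (λ T → f (r ∷ T)))
  total-triangles F n f = trans
    (sym (total-inverse (vecs F (suc n) ×-finite triangles F n) (triangles F (suc n)) cons f))
    (total-× (vecs F (suc n)) (triangles F n) _)
    where
    cons = mk↔ₛ′ (λ (r , T) → r ∷ T) (λ { (r ∷ T) → r , T }) (λ { (_ ∷ _) → refl }) (λ { (_ , _) → refl })

  total-triangles-0 : (F : Finite A) (f : Triangle A zero → ℤ) → total (triangles F zero) f ≡ f []
  total-triangles-0 F f = ℤₚ.+-identityʳ (f [])

  -- Restricted sums as sums of weights

  infixl 5 _when_
  _when_ : {P : Set} → ℤ → Dec P → ℤ
  x when P? = if does P? then x else 0ℤ

  when-yes : {P : Set} (P? : Dec P) → P → ∀ {x} → (x when P?) ≡ x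
  when-yes (yes _) _ = refl
  when-yes (no ¬p) p = contradiction p ¬p

  when-no : {P : Set} (P? : Dec P) → ¬ P → ∀ {x} → (x when P?) ≡ 0ℤ
  when-no (yes p) ¬p = contradiction p ¬p
  when-no (no _)  _  = refl

  when-⇔ : {P Q : Set} (P? : Dec P) (Q? : Dec Q) → (P → Q) → (Q → P) → ∀ {x} → (x when P?) ≡ (x when Q?)
  when-⇔ (yes p) Q? to from = sym (when-yes Q? (to p))
  when-⇔ (no ¬p) Q? to from = sym (when-no Q? (¬p ∘ from))

  sumBy-filter : {P : Pred A 0ℓ} (P? : Decidable P) (f : A → ℤ) →
                 ∀ xs → sumBy f (filter P? xs) ≡ sumBy (λ x → f x when P? x) xs
  sumBy-filter P? f []       = refl
  sumBy-filter P? f (x ∷ xs) with P? x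
  ... | yes p = cong (λ s → f x + s) (sumBy-filter P? f xs)
  ... | no ¬p = trans (sumBy-filter P? f xs) (sym (ℤₚ.+-identityˡ _))

  -- Trades the restriction to a predicate for a weight vanishing off it. The weight is an integer
  -- because it will be summed by determinants.
  sumOver-total : (F : Finite A) {P : Pred A 0ℓ} (P? : Decidable P) (w : A → ℕ) (v : A → ℤ) →
                  (∀ a → P a → v a ≡ + w a) → (∀ a → ¬ P a → v a ≡ 0ℤ) →
                  + sumOver F P? w ≡ total F v
  sumOver-total F P? w v on off = begin
    + sumOver F P? w                                      ≡⟨ sum-as-sumBy w (filter P? (Finite.elements F)) ⟩
    sumBy (λ x → + w x) (filter P? (Finite.elements F))   ≡⟨ sumBy-filter P? _ (Finite.elements F) ⟩
    sumBy (λ x → + w x when P? x) (Finite.elements F)     ≡⟨ sumBy-cong eq (Finite.elements F) ⟩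
    total F v                                             ∎
    where
    eq : ∀ x → (+ w x when P? x) ≡ v x
    eq x with P? x
    ... | yes p = sym (on x p)
    ... | no ¬p = sym (off x ¬p)

  -- The hypotheses concern the two subsets alone: reading signs or elements off an arbitrary
  -- orientation loses information.
  sumOver-image : (F : Finite A) (G : Finite B) {P : Pred A 0ℓ} {Q : Pred B 0ℓ}
                  (P? : Decidable P) (Q? : Decidable Q) (v : A → ℕ) (w : B → ℕ) (f : A → B) →
                  (∀ a → P a → Q (f a)) → (∀ b → Q b → ∃ λ a → P a × f a ≡ b) →
                  (∀ a a′ → P a → P a′ → f a ≡ f a′ → a ≡ a′) →
                  (∀ a → P a → v a ≡ w (f a)) →
                  sumOver F P? v ≡ sumOver G Q? w
  sumOver-image F G {P} {Q} P? Q? v w f into onto inj v≡w = ℤₚ.+-injective (begin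
    + sumOver F P? v                 ≡⟨ sum-as-sumBy v xs ⟩
    sumBy (λ x → + v x) xs           ≡⟨ sumBy-cong-∈ xs (λ x∈ → cong +_ (v≡w _ (P-of x∈))) ⟩
    sumBy (λ x → + w (f x)) xs       ≡⟨ sumBy-map (λ y → + w y) f xs ⟨
    sumBy (λ y → + w y) (map f xs)   ≡⟨ sumBy-↭ _ (same-members⇒↭ unique (Uniqueₚ.filter⁺ Q? (elements-unique G)) to from) ⟩
    sumBy (λ y → + w y) ys           ≡⟨ sum-as-sumBy w ys ⟨
    + sumOver G Q? w                 ∎)
    where
    xs = filter P? (Finite.elements F)
    ys = filter Q? (Finite.elements G)
    P-of : ∀ {x} → x ∈ xs → P x
    P-of x∈ = proj₂ (∈-filter⁻ P? {xs = Finite.elements F} x∈)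
    unique : Unique (map f xs)
    unique = unique-map f (Uniqueₚ.filter⁺ P? (elements-unique F)) (λ x∈ y∈ → inj _ _ (P-of x∈) (P-of y∈))
    to : ∀ {y} → y ∈ map f xs → y ∈ ys
    to y∈ with ∈-map⁻ f y∈
    ... | x , x∈ , refl = ∈-filter⁺ Q? (Finite.complete G (f x)) (into x (P-of x∈))
    from : ∀ {y} → y ∈ ys → y ∈ map f xs
    from {y} y∈ with onto y (proj₂ (∈-filter⁻ Q? {xs = Finite.elements G} y∈))
    ... | x , p , refl = ∈-map⁺ f (∈-filter⁺ P? (Finite.complete F x) p)

  -- Ice configurations, column by column

  -- What Laplace expansion makes of rows (1, v). An empty list of rows in positive dimension has
  -- determinant 0, hence the first clause.
  chain : ∀ {k} → (List (Vec ℤ k) → ℤ) → List (Vec ℤ k) → ℤ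
  chain F []       = 0ℤ
  chain F (v ∷ vs) = F (differences v vs)

  contract-ones : ∀ {k} {F : List (Vec ℤ k) → ℤ} → Alternating F → ∀ vs → contract F (map (1ℤ ∷_) vs) ≡ chain F vs
  contract-ones A []       = refl
  contract-ones A (v ∷ vs) = trans (contract-constant A 1ℤ v vs) (ℤₚ.*-identityˡ _)

  -- The arguments are the edges above, left, right and below of a vertex.
  vertexWeight : Vertical → Horizontal → Horizontal → Vertical → ℤ
  vertexWeight upward   leftward  leftward  upward   = 1ℤ
  vertexWeight upward   rightward rightward upward   = 1ℤ
  vertexWeight upward   rightward leftward  downward = 1ℤ
  vertexWeight downward leftward  leftward  downward = 1ℤ
  vertexWeight downward rightward rightward downward = 1ℤ
  vertexWeight downward leftward  rightward upward   = + 2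
  vertexWeight _        _         _         _        = 0ℤ

  isUpward isDownward : Vertical → ℤ
  isUpward upward   = 1ℤ
  isUpward downward = 0ℤ
  isDownward upward   = 0ℤ
  isDownward downward = 1ℤ

  -- `hs` and `hs′` are the edges to the left and to the right of one column, read from the top; the
  -- last factor is the lower boundary condition. The upper one is kept apart because the recursion
  -- meets both directions of the edge above.
  columnWeight : ∀ {N} → Vec Horizontal N → Vec Vertical (suc N) → Vec Horizontal N → ℤ
  columnWeight []       (v ∷ [])      []        = isDownward v
  columnWeight (h ∷ hs) (v ∷ v′ ∷ vs) (h′ ∷ hs′) = vertexWeight v h h′ v′ * columnWeight hs (v′ ∷ vs) hs′

  rightwards : {A : Set} → (ℕ → A) → ℕ → ∀ {N} → Vec Horizontal N → List A
  rightwards f a []               = []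
  rightwards f a (leftward  ∷ hs) = rightwards f (suc a) hs
  rightwards f a (rightward ∷ hs) = f a ∷ rightwards f (suc a) hs

  rightwards-map : {A B : Set} (g : A → B) (f : ℕ → A) → ∀ a {N} (hs : Vec Horizontal N) →
                   rightwards (g ∘ f) a hs ≡ map g (rightwards f a hs)
  rightwards-map g f a []               = refl
  rightwards-map g f a (leftward  ∷ hs) = rightwards-map g f (suc a) hs
  rightwards-map g f a (rightward ∷ hs) = cong (g (f a) ∷_) (rightwards-map g f (suc a) hs)

  module _ {k : ℕ} where

    private
      Functional : Set
      Functional = List (Vec ℤ k) → ℤ

    -- A rightward edge in row `a` contributes its row of the determinant at once, so that the rest
    -- of the column is again summed for an alternating functional.
    cons : Functional → ℕ → Horizontal → Functional
    cons F a leftward  us = F us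
    cons F a rightward us = F (basis k a ∷ us)

    basisRows : ℕ → ∀ {N} → Vec Horizontal N → List (Vec ℤ k)
    basisRows = rightwards (basis k)

    -- The part of a column from row `a` downwards. The direction of the edge `v` above it is all
    -- that these rows remember of the rows above.
    transfer : Vertical → ℕ → ∀ {N} → Vec Horizontal N → Functional → ℤ
    transfer v a {N} hs F = total (vecs verticals N) (λ vs → total (vecs horizontals N) (λ hs′ →
      columnWeight hs (v ∷ vs) hs′ * F (basisRows a hs′)))

    transfer-step : ∀ v a {N} h (hs : Vec Horizontal N) F →
      transfer v a (h ∷ hs) F ≡ total verticals (λ v′ → total horizontals (λ h′ →
        vertexWeight v h h′ v′ * transfer v′ (suc a) hs (cons F a h′)))
    transfer-step v a {N} h hs F = trans (total-vecs verticals N _) (sumBy-cong (λ v′ → begin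
      total V (λ vs → total (vecs horizontals (suc N)) (λ hs′ → columnWeight (h ∷ hs) (v ∷ v′ ∷ vs) hs′ * F (basisRows a hs′)))
        ≡⟨ sumBy-cong (λ vs → trans (total-vecs horizontals N _) (sumBy-cong (λ h′ → begin
             total H (λ hs′ → vertexWeight v h h′ v′ * columnWeight hs (v′ ∷ vs) hs′ * F (basisRows a (h′ ∷ hs′)))
               ≡⟨ sumBy-cong (λ hs′ → trans
                    (ℤₚ.*-assoc (vertexWeight v h h′ v′) (columnWeight hs (v′ ∷ vs) hs′) (F (basisRows a (h′ ∷ hs′))))
                    (cong (λ y → vertexWeight v h h′ v′ * (columnWeight hs (v′ ∷ vs) hs′ * y)) (cons-rows h′ hs′)))
                    (Finite.elements H) ⟩
             total H (λ hs′ → vertexWeight v h h′ v′ * rest v′ vs h′ hs′)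
               ≡⟨ sumBy-* (vertexWeight v h h′ v′) (rest v′ vs h′) (Finite.elements H) ⟩
             vertexWeight v h h′ v′ * total H (rest v′ vs h′) ∎)
             (Finite.elements horizontals))) (Finite.elements V) ⟩
      total V (λ vs → total horizontals (λ h′ → vertexWeight v h h′ v′ * total H (rest v′ vs h′)))
        ≡⟨ sumBy-swap (λ vs h′ → vertexWeight v h h′ v′ * total H (rest v′ vs h′)) (Finite.elements V) (Finite.elements horizontals) ⟩
      total horizontals (λ h′ → total V (λ vs → vertexWeight v h h′ v′ * total H (rest v′ vs h′)))
        ≡⟨ sumBy-cong (λ h′ → sumBy-* (vertexWeight v h h′ v′) (λ vs → total H (rest v′ vs h′)) (Finite.elements V))
             (Finite.elements horizontals) ⟩
      total horizontals (λ h′ → vertexWeight v h h′ v′ * transfer v′ (suc a) hs (cons F a h′)) ∎) (Finite.elements verticals))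
      where
      V = vecs verticals N
      H = vecs horizontals N
      rest : Vertical → Vec Vertical N → Horizontal → Vec Horizontal N → ℤ
      rest v′ vs h′ hs′ = columnWeight hs (v′ ∷ vs) hs′ * cons F a h′ (basisRows (suc a) hs′)
      cons-rows : ∀ h′ hs′ → F (basisRows a (h′ ∷ hs′)) ≡ cons F a h′ (basisRows (suc a) hs′)
      cons-rows leftward  hs′ = refl
      cons-rows rightward hs′ = refl

    integrals : ℕ → ∀ {N} → Vec Horizontal N → List (Vec ℤ k)
    integrals = rightwards (integral k)

    -- Write e for `basis` and E for `integral`. If the edge above row `a` points down, an interval
    -- opened above `a` still awaits its element of the next set. Up to its right end u the rows
    -- from `a` on contribute 2 e(a) + ... + 2 e(u - 1) + e(u), which is E(u) - (E(a) - e(a)): a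
    -- lower limit at which `a` counts as an interior point.
    before : ℕ → Vec ℤ k
    before a = integral k a ⊖ basis k a

    private
      before-suc : ∀ a → before (suc a) ≡ integral k a ⊕ basis k a
      before-suc a = lemma (integral k a) (basis k a) (basis k (suc a))
        where
        lemma : ∀ {k} (u v w : Vec ℤ k) → (u ⊕ (v ⊕ w)) ⊖ w ≡ u ⊕ v
        lemma []      []      []      = refl
        lemma (x ∷ u) (y ∷ v) (z ∷ w) = cong₂ _∷_ (scalar x y z) (lemma u v w)
          where
          scalar : ∀ x y z → (x + (y + z)) - z ≡ x + y
          scalar = solve-∀

      integral⊖before : ∀ a → integral k a ⊖ before a ≡ basis k a
      integral⊖before a = lemma (integral k a) (basis k a)
        where
        lemma : ∀ {k} (u v : Vec ℤ k) → u ⊖ (u ⊖ v) ≡ v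
        lemma []      []      = refl
        lemma (x ∷ u) (y ∷ v) = cong₂ _∷_ (scalar x y) (lemma u v)
          where
          scalar : ∀ x y → x - (x - y) ≡ y
          scalar = solve-∀

      head-before-suc : ∀ {F : Functional} → Alternating F → ∀ a u ws →
        F ((u ⊖ before (suc a)) ∷ ws) ≡ (F (u ∷ ws) - F (integral k a ∷ ws)) - F (basis k a ∷ ws)
      head-before-suc {F} A a u ws = begin
        F ((u ⊖ before (suc a)) ∷ ws)                              ≡⟨ cong (λ b → F ((u ⊖ b) ∷ ws)) (before-suc a) ⟩
        F ((u ⊖ (integral k a ⊕ basis k a)) ∷ ws)                  ≡⟨ subtractive A u _ ws ⟩
        F (u ∷ ws) - F ((integral k a ⊕ basis k a) ∷ ws)           ≡⟨ cong (λ y → F (u ∷ ws) - y) (additive A [] _ _ ws) ⟩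
        F (u ∷ ws) - (F (integral k a ∷ ws) + F (basis k a ∷ ws))  ≡⟨ lemma (F (u ∷ ws)) _ _ ⟩
        (F (u ∷ ws) - F (integral k a ∷ ws)) - F (basis k a ∷ ws)  ∎
        where
        lemma : ∀ x y z → x - (y + z) ≡ (x - y) - z
        lemma = solve-∀

      fix-cons : ∀ {F : Functional} → Alternating F → ∀ a h → Alternating (cons F a h)
      fix-cons A a leftward  = record { additive = additive A ; repeated = repeated A }
      fix-cons A a rightward = record { additive = additive (fix-first A _) ; repeated = repeated (fix-first A _) }

      -- Row `a` opens an interval and, as its endpoint, counts once: either it is chosen, or the
      -- choice is left to the rows after it. With e and E for `basis` and `integral`, e(a) + (E(u)
      -- - (E(a) + e(a))) is E(u) - E(a).
      step-up-right : ∀ {F : Functional} → Alternating F → ∀ a vs →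
        chain (cons F a rightward) vs + F (differences (before (suc a)) vs) ≡ F (differences (integral k a) vs)
      step-up-right A a []       = ℤₚ.+-identityˡ _
      step-up-right {F} A a (u ∷ us) = begin
        F (basis k a ∷ ws) + F ((u ⊖ before (suc a)) ∷ ws)
          ≡⟨ cong (λ y → F (basis k a ∷ ws) + y) (head-before-suc A a u ws) ⟩
        F (basis k a ∷ ws) + ((F (u ∷ ws) - F (integral k a ∷ ws)) - F (basis k a ∷ ws))
          ≡⟨ lemma (F (basis k a ∷ ws)) (F (u ∷ ws)) (F (integral k a ∷ ws)) ⟩
        F (u ∷ ws) - F (integral k a ∷ ws)
          ≡⟨ subtractive A u (integral k a) ws ⟨
        F ((u ⊖ integral k a) ∷ ws) ∎
        where
        ws = differences u us
        lemma : ∀ x y z → x + ((y - z) - x) ≡ y - z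
        lemma = solve-∀

      -- Here `a` is interior to the waiting interval, and choosing it costs the weight 2 of an NS
      -- vertex. Advancing the lower limit `before` by one row removes exactly twice `basis k a`.
      step-down-left : ∀ {F : Functional} → Alternating F → ∀ a vs →
        + 2 * chain (cons F a rightward) vs + F (differences (before (suc a)) vs) ≡ F (differences (before a) vs)
      step-down-left A a []       = ℤₚ.+-identityˡ _
      step-down-left {F} A a (u ∷ us) = begin
        + 2 * F (basis k a ∷ ws) + F ((u ⊖ before (suc a)) ∷ ws)
          ≡⟨ cong (λ y → + 2 * F (basis k a ∷ ws) + y) (head-before-suc A a u ws) ⟩
        + 2 * F (basis k a ∷ ws) + ((F (u ∷ ws) - F (integral k a ∷ ws)) - F (basis k a ∷ ws))
          ≡⟨ lemma (F (basis k a ∷ ws)) (F (u ∷ ws)) (F (integral k a ∷ ws)) ⟩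
        F (u ∷ ws) - (F (integral k a ∷ ws) - F (basis k a ∷ ws))
          ≡⟨ cong (λ y → F (u ∷ ws) - y) (subtractive A (integral k a) (basis k a) ws) ⟨
        F (u ∷ ws) - F (before a ∷ ws)
          ≡⟨ subtractive A u (before a) ws ⟨
        F ((u ⊖ before a) ∷ ws) ∎
        where
        ws = differences u us
        lemma : ∀ x y z → + 2 * x + ((y - z) - x) ≡ y - (z - x)
        lemma = solve-∀

      -- Row `a` closes the waiting interval, whose element it must be, and opens the next one. The
      -- ice rule forbids choosing it for both; the functional vanishes on the repeated row, so the
      -- second interval may be extended back to its endpoint `a` as the trapezoidal rule requires.
      step-down-right : ∀ {F : Functional} → Alternating F → ∀ a vs →
        F (basis k a ∷ differences (before (suc a)) vs) ≡ F ((integral k a ⊖ before a) ∷ differences (integral k a) vs)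
      step-down-right {F} A a vs = trans (go vs) (cong (λ b → F (b ∷ differences (integral k a) vs)) (sym (integral⊖before a)))
        where
        lemma : ∀ x → x - 0ℤ ≡ x
        lemma = solve-∀
        go : ∀ vs → F (basis k a ∷ differences (before (suc a)) vs) ≡ F (basis k a ∷ differences (integral k a) vs)
        go []       = refl
        go (u ∷ us) = begin
          G ((u ⊖ before (suc a)) ∷ ws)
            ≡⟨ head-before-suc (fix-first A (basis k a)) a u ws ⟩
          (G (u ∷ ws) - G (integral k a ∷ ws)) - G (basis k a ∷ ws)
            ≡⟨ cong (λ y → (G (u ∷ ws) - G (integral k a ∷ ws)) - y) (repeated A [] (basis k a) ws) ⟩
          (G (u ∷ ws) - G (integral k a ∷ ws)) - 0ℤ
            ≡⟨ lemma _ ⟩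
          G (u ∷ ws) - G (integral k a ∷ ws)
            ≡⟨ subtractive (fix-first A (basis k a)) u (integral k a) ws ⟨
          G ((u ⊖ integral k a) ∷ ws) ∎
          where
          ws = differences u us
          G : Functional
          G us = F (basis k a ∷ us)

    -- Mutual induction over the rows. `upward` means that every interval opened so far has its
    -- element of the next set, `downward` that the last one is still waiting. One must be left
    -- waiting at the bottom, as the next set is smaller by one.
    transfer-up   : ∀ {F : Functional} → Alternating F → ∀ a {N} (hs : Vec Horizontal N) →
                    transfer upward a hs F ≡ chain F (integrals a hs)
    transfer-down : ∀ {F : Functional} → Alternating F → ∀ a {N} (hs : Vec Horizontal N) →
                    transfer downward a hs F ≡ F (differences (before a) (integrals a hs))

    transfer-up {F} A a [] = refl
    transfer-up {F} A a (leftward ∷ hs) = begin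
      transfer upward a (leftward ∷ hs) F
        ≡⟨ transfer-step upward a leftward hs F ⟩
      _
        -- The four summands are the choices of lower and right edge; the vertex weights annul three
        -- of them.
        ≡⟨ lemma UL UR DL DR ⟩
      transfer upward (suc a) hs (cons F a leftward)
        ≡⟨ transfer-up (fix-cons A a leftward) (suc a) hs ⟩
      _
        ≡⟨ chain-leftward F a (integrals (suc a) hs) ⟩
      chain F (integrals (suc a) hs) ∎
      where
      UL = transfer upward (suc a) hs (cons F a leftward)
      UR = transfer upward (suc a) hs (cons F a rightward)
      DL = transfer downward (suc a) hs (cons F a leftward)
      DR = transfer downward (suc a) hs (cons F a rightward)
      lemma : ∀ w x y z → (1ℤ * w + (0ℤ * x + 0ℤ)) + ((0ℤ * y + (0ℤ * z + 0ℤ)) + 0ℤ) ≡ w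
      lemma = solve-∀
      chain-leftward : ∀ F a vs → chain (cons F a leftward) vs ≡ chain F vs
      chain-leftward F a []       = refl
      chain-leftward F a (_ ∷ _)  = refl
    transfer-up {F} A a (rightward ∷ hs) = begin
      transfer upward a (rightward ∷ hs) F
        ≡⟨ transfer-step upward a rightward hs F ⟩
      _
        ≡⟨ lemma UL UR DL DR ⟩
      transfer upward (suc a) hs (cons F a rightward) + transfer downward (suc a) hs (cons F a leftward)
        ≡⟨ cong₂ _+_ (transfer-up (fix-cons A a rightward) (suc a) hs) (transfer-down (fix-cons A a leftward) (suc a) hs) ⟩
      chain (cons F a rightward) (integrals (suc a) hs) + F (differences (before (suc a)) (integrals (suc a) hs))
        ≡⟨ step-up-right A a (integrals (suc a) hs) ⟩
      F (differences (integral k a) (integrals (suc a) hs)) ∎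
      where
      UL = transfer upward (suc a) hs (cons F a leftward)
      UR = transfer upward (suc a) hs (cons F a rightward)
      DL = transfer downward (suc a) hs (cons F a leftward)
      DR = transfer downward (suc a) hs (cons F a rightward)
      lemma : ∀ w x y z → (0ℤ * w + (1ℤ * x + 0ℤ)) + ((1ℤ * y + (0ℤ * z + 0ℤ)) + 0ℤ) ≡ x + y
      lemma = solve-∀

    transfer-down {F} A a [] = lemma (F [])
      where
      lemma : ∀ x → ((1ℤ * x) + 0ℤ) + 0ℤ ≡ x
      lemma = solve-∀
    transfer-down {F} A a (leftward ∷ hs) = begin
      transfer downward a (leftward ∷ hs) F
        ≡⟨ transfer-step downward a leftward hs F ⟩
      _
        ≡⟨ lemma UL UR DL DR ⟩
      + 2 * transfer upward (suc a) hs (cons F a rightward) + transfer downward (suc a) hs (cons F a leftward)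
        ≡⟨ cong₂ (λ x y → + 2 * x + y) (transfer-up (fix-cons A a rightward) (suc a) hs) (transfer-down (fix-cons A a leftward) (suc a) hs) ⟩
      + 2 * chain (cons F a rightward) (integrals (suc a) hs) + F (differences (before (suc a)) (integrals (suc a) hs))
        ≡⟨ step-down-left A a (integrals (suc a) hs) ⟩
      F (differences (before a) (integrals (suc a) hs)) ∎
      where
      UL = transfer upward (suc a) hs (cons F a leftward)
      UR = transfer upward (suc a) hs (cons F a rightward)
      DL = transfer downward (suc a) hs (cons F a leftward)
      DR = transfer downward (suc a) hs (cons F a rightward)
      lemma : ∀ w x y z → (0ℤ * w + (+ 2 * x + 0ℤ)) + ((1ℤ * y + (0ℤ * z + 0ℤ)) + 0ℤ) ≡ + 2 * x + y
      lemma = solve-∀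
    transfer-down {F} A a (rightward ∷ hs) = begin
      transfer downward a (rightward ∷ hs) F
        ≡⟨ transfer-step downward a rightward hs F ⟩
      _
        ≡⟨ lemma UL UR DL DR ⟩
      transfer downward (suc a) hs (cons F a rightward)
        ≡⟨ transfer-down (fix-cons A a rightward) (suc a) hs ⟩
      F (basis k a ∷ differences (before (suc a)) (integrals (suc a) hs))
        ≡⟨ step-down-right A a (integrals (suc a) hs) ⟩
      F ((integral k a ⊖ before a) ∷ differences (integral k a) (integrals (suc a) hs)) ∎
      where
      UL = transfer upward (suc a) hs (cons F a leftward)
      UR = transfer upward (suc a) hs (cons F a rightward)
      DL = transfer downward (suc a) hs (cons F a leftward)
      DR = transfer downward (suc a) hs (cons F a rightward)
      lemma : ∀ w x y z → (0ℤ * w + (0ℤ * x + 0ℤ)) + ((0ℤ * y + (1ℤ * z + 0ℤ)) + 0ℤ) ≡ z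
      lemma = solve-∀

  noRightward : ∀ {N} → Vec Horizontal N → ℤ
  noRightward []              = 1ℤ
  noRightward (leftward ∷ hs) = noRightward hs
  noRightward (rightward ∷ _) = 0ℤ

  noRightward-det : ∀ a {N} (hs : Vec Horizontal N) → noRightward hs ≡ det 0 (rightwards (basis 0) a hs)
  noRightward-det a []               = refl
  noRightward-det a (leftward  ∷ hs) = noRightward-det (suc a) hs
  noRightward-det a (rightward ∷ hs) = refl

  pathWeight : ∀ {N k} → Vec Horizontal N → Vec (Vec Vertical (suc N)) k → Vec (Vec Horizontal N) k → ℤ
  pathWeight c []       []       = noRightward c
  pathWeight c (v ∷ vs) (h ∷ hs) = isUpward (Vec.head v) * (columnWeight c v h * pathWeight h vs hs)

  total-up : ∀ N (f : Vec Vertical (suc N) → ℤ) →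
             total (vecs verticals (suc N)) (λ v → isUpward (Vec.head v) * f v)
             ≡ total (vecs verticals N) (λ v → f (upward ∷ v))
  total-up N f = begin
    total (vecs verticals (suc N)) (λ v → isUpward (Vec.head v) * f v)
      ≡⟨ total-vecs verticals N _ ⟩
    total verticals (λ d → total V (λ v → isUpward d * f (d ∷ v)))
      ≡⟨ total-cong verticals (λ d → total-* V (isUpward d) (λ v → f (d ∷ v))) ⟩
    total verticals (λ d → isUpward d * total V (λ v → f (d ∷ v)))
      ≡⟨ lemma (total V (λ v → f (upward ∷ v))) (total V (λ v → f (downward ∷ v))) ⟩
    total V (λ v → f (upward ∷ v)) ∎
    where
    V = vecs verticals N
    lemma : ∀ x y → 1ℤ * x + (0ℤ * y + 0ℤ) ≡ x
    lemma = solve-∀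

  -- Induction on the columns: the trapezoidal rule of the first column is applied to the
  -- determinant that counts the continuations through the others. The dimension is the number of
  -- columns still to cross; in dimension 0 the determinant is the right boundary condition.
  pathWeight-total : ∀ {N} k (c : Vec Horizontal N) →
    total (vecs (vecs verticals (suc N)) k) (λ vs → total (vecs (vecs horizontals N) k) (λ hs → pathWeight c vs hs))
    ≡ det k (rightwards (basis k) 0 c)
  pathWeight-total {N} zero c = begin
    total (vecs (vecs verticals (suc N)) zero) (λ vs → total (vecs (vecs horizontals N) zero) (λ hs → pathWeight c vs hs))
      ≡⟨ total-vecs-0 (vecs verticals (suc N)) (λ vs → total (vecs (vecs horizontals N) zero) (pathWeight c vs)) ⟩
    total (vecs (vecs horizontals N) zero) (λ hs → pathWeight c [] hs)
      ≡⟨ total-vecs-0 (vecs horizontals N) (pathWeight c []) ⟩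
    noRightward c
      ≡⟨ noRightward-det 0 c ⟩
    det 0 (rightwards (basis 0) 0 c) ∎
  pathWeight-total {N} (suc k) c = begin
    total (vecs V (suc k)) (λ vs → total (vecs H (suc k)) (λ hs → pathWeight c vs hs))
      ≡⟨ total-vecs V k _ ⟩
    total V (λ v → total Vs (λ vs → total (vecs H (suc k)) (λ hs → pathWeight c (v ∷ vs) hs)))
      ≡⟨ total-cong V (λ v → total-cong Vs (λ vs → total-vecs H k _)) ⟩
    total V (λ v → total Vs (λ vs → total H (λ h → total Hs (λ hs → pathWeight c (v ∷ vs) (h ∷ hs)))))
      ≡⟨ total-cong V inner ⟩
    total V (λ v → isUpward (Vec.head v) * total H (λ h → columnWeight c v h * next h))
      ≡⟨ total-up N (λ v → total H (λ h → columnWeight c v h * next h)) ⟩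
    transfer upward 0 c (det k)
      ≡⟨ transfer-up (det-alternating k) 0 c ⟩
    chain (det k) (rightwards (integral k) 0 c)
      -- Laplace expansion backwards: a first coordinate 1 turns the differences of integrals into
      -- one row more, and these are the rows of `basis (suc k)`.
      ≡⟨ contract-ones (det-alternating k) (rightwards (integral k) 0 c) ⟨
    contract (det k) (map (1ℤ ∷_) (rightwards (integral k) 0 c))
      ≡⟨ cong (contract (det k)) (rightwards-map (1ℤ ∷_) (integral k) 0 c) ⟨
    det (suc k) (rightwards (basis (suc k)) 0 c) ∎
    where
    V  = vecs verticals (suc N)
    H  = vecs horizontals N
    Vs = vecs V k
    Hs = vecs H k
    next : Vec Horizontal N → ℤ
    next h = det k (rightwards (basis k) 0 h)
    inner : ∀ v → total Vs (λ vs → total H (λ h → total Hs (λ hs → pathWeight c (v ∷ vs) (h ∷ hs))))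
                ≡ isUpward (Vec.head v) * total H (λ h → columnWeight c v h * next h)
    inner v = begin
      total Vs (λ vs → total H (λ h → total Hs (λ hs → u * (columnWeight c v h * pathWeight h vs hs))))
        ≡⟨ total-swap Vs H (λ vs h → total Hs (λ hs → u * (columnWeight c v h * pathWeight h vs hs))) ⟩
      total H (λ h → total Vs (λ vs → total Hs (λ hs → u * (columnWeight c v h * pathWeight h vs hs))))
        ≡⟨ total-cong H (λ h → begin
             total Vs (λ vs → total Hs (λ hs → u * (columnWeight c v h * pathWeight h vs hs)))
               ≡⟨ total-cong Vs (λ vs → trans (total-* Hs u (λ hs → columnWeight c v h * pathWeight h vs hs))
                    (cong (u *_) (total-* Hs (columnWeight c v h) (pathWeight h vs)))) ⟩
             total Vs (λ vs → u * (columnWeight c v h * total Hs (pathWeight h vs)))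
               ≡⟨ trans (total-* Vs u (λ vs → columnWeight c v h * total Hs (pathWeight h vs)))
                    (cong (u *_) (total-* Vs (columnWeight c v h) (λ vs → total Hs (pathWeight h vs)))) ⟩
             u * (columnWeight c v h * total Vs (λ vs → total Hs (pathWeight h vs)))
               ≡⟨ cong (λ y → u * (columnWeight c v h * y)) (pathWeight-total k h) ⟩
             u * (columnWeight c v h * next h) ∎) ⟩
      total H (λ h → u * (columnWeight c v h * next h))
        ≡⟨ total-* H u (λ h → columnWeight c v h * next h) ⟩
      u * total H (λ h → columnWeight c v h * next h) ∎
      where
      u = isUpward (Vec.head v)

  -- The left boundary and the total weight of the lattice

  pairWeight : Horizontal → Horizontal → ℤ
  pairWeight rightward leftward  = 1ℤ
  pairWeight leftward  rightward = 1ℤ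
  pairWeight _         _         = 0ℤ

  pairsWeight : ∀ n → Vec Horizontal (n ℕ.* 2) → ℤ
  pairsWeight zero    []           = 1ℤ
  pairsWeight (suc n) (h ∷ h′ ∷ hs) = pairWeight h h′ * pairsWeight n hs

  pairsWeight-total : ∀ {k} {F : List (Vec ℤ k) → ℤ} → Alternating F → (f : ℕ → Vec ℤ k) → ∀ n a →
    total (vecs horizontals (n ℕ.* 2)) (λ c → pairsWeight n c * F (rightwards f a c))
    ≡ F (everyOther (average f) a n)
  pairsWeight-total {F = F} A f zero a = trans (total-vecs-0 horizontals (λ c → pairsWeight 0 c * F (rightwards f a c))) (ℤₚ.*-identityˡ (F []))
  pairsWeight-total {k} {F} A f (suc n) a = begin
    total (vecs horizontals (suc n ℕ.* 2)) (λ c → pairsWeight (suc n) c * F (rightwards f a c))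
      ≡⟨ trans (total-vecs horizontals (suc (n ℕ.* 2)) summand)
           (total-cong horizontals (λ h → total-vecs horizontals (n ℕ.* 2) (λ c → summand (h ∷ c)))) ⟩
    total horizontals (λ h → total horizontals (λ h′ → total H (λ c →
      pairWeight h h′ * pairsWeight n c * F (rightwards f a (h ∷ h′ ∷ c)))))
      ≡⟨ total-cong horizontals (λ h → total-cong horizontals (λ h′ → trans
           (total-cong H (λ c → ℤₚ.*-assoc (pairWeight h h′) (pairsWeight n c) (F (rightwards f a (h ∷ h′ ∷ c)))))
           (total-* H (pairWeight h h′) (rest h h′)))) ⟩
    total horizontals (λ h → total horizontals (λ h′ → pairWeight h h′ * total H (rest h h′)))
      ≡⟨ lemma (total H (rest leftward leftward)) (total H (rest leftward rightward))
               (total H (rest rightward leftward)) (total H (rest rightward rightward)) ⟩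
    total H (rest rightward leftward) + total H (rest leftward rightward)
      ≡⟨ cong₂ _+_ (pairsWeight-total (fix-first A (f a)) f n (2 ℕ.+ a))
                   (pairsWeight-total (fix-first A (f (suc a))) f n (2 ℕ.+ a)) ⟩
    F (f a ∷ everyOther (average f) (2 ℕ.+ a) n) + F (f (suc a) ∷ everyOther (average f) (2 ℕ.+ a) n)
      ≡⟨ additive A [] (f a) (f (suc a)) _ ⟨
    F (everyOther (average f) a (suc n)) ∎
    where
    H = vecs horizontals (n ℕ.* 2)
    summand : Vec Horizontal (suc n ℕ.* 2) → ℤ
    summand c = pairsWeight (suc n) c * F (rightwards f a c)
    rest : Horizontal → Horizontal → Vec Horizontal (n ℕ.* 2) → ℤ
    rest h h′ c = pairsWeight n c * F (rightwards f a (h ∷ h′ ∷ c))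
    lemma : ∀ w x y z → (0ℤ * w + (1ℤ * x + 0ℤ)) + ((1ℤ * y + (0ℤ * z + 0ℤ)) + 0ℤ) ≡ y + x
    lemma = solve-∀

  n*1+n*[n∸1]≡n^2 : ∀ n → n ℕ.* 1 ℕ.+ n ℕ.* (n ℕ.∸ 1) ≡ n ℕ.^ 2
  n*1+n*[n∸1]≡n^2 zero    = refl
  n*1+n*[n∸1]≡n^2 (suc n) = lemma n
    where
    open import Data.Nat.Tactic.RingSolver using () renaming (solve-∀ to solveℕ)
    lemma : ∀ n → suc n ℕ.* 1 ℕ.+ suc n ℕ.* n ≡ suc n ℕ.* (suc n ℕ.* 1)
    lemma = solveℕ

  latticeWeight : ∀ n → Vec (Vec Vertical (suc (n ℕ.* 2))) n → Vec (Vec Horizontal (n ℕ.* 2)) (suc n) → ℤ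
  latticeWeight n vs (c ∷ hs) = pairsWeight n c * pathWeight c vs hs

  latticeWeight-total : ∀ n →
    total (vecs (vecs verticals (suc (n ℕ.* 2))) n) (λ vs →
      total (vecs (vecs horizontals (n ℕ.* 2)) (suc n)) (latticeWeight n vs))
    ≡ + (2 ℕ.^ (n ℕ.^ 2))
  latticeWeight-total n = begin
    total Vs (λ vs → total (vecs H (suc n)) (latticeWeight n vs))
      ≡⟨ total-cong Vs (λ vs → trans (total-vecs H n _)
           (total-cong H (λ c → total-* Hs (pairsWeight n c) (pathWeight c vs)))) ⟩
    total Vs (λ vs → total H (λ c → pairsWeight n c * total Hs (pathWeight c vs)))
      ≡⟨ total-swap Vs H (λ vs c → pairsWeight n c * total Hs (pathWeight c vs)) ⟩
    total H (λ c → total Vs (λ vs → pairsWeight n c * total Hs (pathWeight c vs)))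
      ≡⟨ total-cong H (λ c → trans
           (total-* Vs (pairsWeight n c) (λ vs → total Hs (pathWeight c vs)))
           (cong (pairsWeight n c *_) (pathWeight-total n c))) ⟩
    total H (λ c → pairsWeight n c * det n (rightwards (basis n) 0 c))
      ≡⟨ pairsWeight-total (det-alternating n) (basis n) n 0 ⟩
    det n (everyOther (average (basis n)) 0 n)
      -- `m` is 1 because the choice in each pair of rows has averaged the rows once.
      ≡⟨ det-averages n 1 0 ⟩
    + (2 ℕ.^ (n ℕ.* 1 ℕ.+ n ℕ.* (n ℕ.∸ 1)))
      ≡⟨ cong (λ p → + (2 ℕ.^ p)) (n*1+n*[n∸1]≡n^2 n) ⟩
    + (2 ℕ.^ (n ℕ.^ 2)) ∎
    where
    H  = vecs horizontals (n ℕ.* 2)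
    Hs = vecs H n
    Vs = vecs (vecs verticals (suc (n ℕ.* 2))) n

  -- Orientations, ice matrices and U-turn matrices

  open Orientation

  open Algebra.Properties.CommutativeMonoid.Sum ℤₚ.*-1-commutativeMonoid
    using () renaming (sum to ∏; sum-cong-≗ to ∏-cong; ∑-comm to ∏-comm)

  -- Recovers membership from the weight: a family is the support of a product of local factors, and
  -- each factor encodes one of its conditions.
  ∏-nonzero : ∀ {n} (f : Fin n → ℤ) → ∏ f ≢ 0ℤ → ∀ i → f i ≢ 0ℤ
  ∏-nonzero f ∏≢0 zero    f≡0 = ∏≢0 (cong (_* ∏ (f ∘ suc)) f≡0)
  ∏-nonzero f ∏≢0 (suc i) f≡0 = ∏-nonzero (f ∘ suc)
    (λ ∏≡0 → ∏≢0 (trans (cong (f zero *_) ∏≡0) (ℤₚ.*-zeroʳ (f zero)))) i f≡0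

  ∏-ones : ∀ {n} (f : Fin n → ℤ) → (∀ i → f i ≡ 1ℤ) → ∏ f ≡ 1ℤ
  ∏-ones {zero}  f f≡1 = refl
  ∏-ones {suc n} f f≡1 = cong₂ _*_ (f≡1 zero) (∏-ones (f ∘ suc) (f≡1 ∘ suc))

  nonzeroˡ : ∀ x {y} → x * y ≢ 0ℤ → x ≢ 0ℤ
  nonzeroˡ x {y} xy≢0 x≡0 = xy≢0 (cong (_* y) x≡0)

  nonzeroʳ : ∀ x {y} → x * y ≢ 0ℤ → y ≢ 0ℤ
  nonzeroʳ x xy≢0 y≡0 = xy≢0 (trans (cong (x *_) y≡0) (ℤₚ.*-zeroʳ x))

  module _ {A : Set} {P : Pred A 0ℓ} (P? : Decidable P) where

    mark : A → ℤ
    mark x = if does (P? x) then + 2 else 1ℤ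

    count-++ : ∀ {m n} (xs : Vec A m) (ys : Vec A n) → Vec.count P? (xs Vec.++ ys) ≡ Vec.count P? xs ℕ.+ Vec.count P? ys
    count-++ []       ys = refl
    count-++ (x ∷ xs) ys with does (P? x)
    ... | true  = cong suc (count-++ xs ys)
    ... | false = count-++ xs ys

    2^count : ∀ {n} (xs : Vec A n) → + (2 ℕ.^ Vec.count P? xs) ≡ ∏ (λ i → mark (lookup xs i))
    2^count []       = refl
    2^count (x ∷ xs) with does (P? x)
    ... | true  = trans (ℤₚ.pos-* 2 (2 ℕ.^ Vec.count P? xs)) (cong (+ 2 *_) (2^count xs))
    ... | false = trans (2^count xs) (sym (ℤₚ.*-identityˡ (∏ (λ i → mark (lookup xs i)))))

    2^count-concat : ∀ {m n} (M : Matrix A m n) → + (2 ℕ.^ Vec.count P? (Vec.concat M)) ≡ ∏ (λ i → ∏ (λ q → mark (M at i , q)))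
    2^count-concat []       = refl
    2^count-concat (r ∷ M) = begin
      + (2 ℕ.^ Vec.count P? (r Vec.++ Vec.concat M))
        ≡⟨ cong (λ c → + (2 ℕ.^ c)) (count-++ r (Vec.concat M)) ⟩
      + (2 ℕ.^ (Vec.count P? r ℕ.+ Vec.count P? (Vec.concat M)))
        ≡⟨ cong +_ (ℕₚ.^-distribˡ-+-* 2 (Vec.count P? r) _) ⟩
      + (2 ℕ.^ Vec.count P? r ℕ.* 2 ℕ.^ Vec.count P? (Vec.concat M))
        ≡⟨ ℤₚ.pos-* (2 ℕ.^ Vec.count P? r) _ ⟩
      + (2 ℕ.^ Vec.count P? r) * + (2 ℕ.^ Vec.count P? (Vec.concat M))
        ≡⟨ cong₂ _*_ (2^count r) (2^count-concat M) ⟩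
      ∏ (λ i → ∏ (λ q → mark ((r ∷ M) at i , q))) ∎

  isLeftward : Horizontal → ℤ
  isLeftward leftward  = 1ℤ
  isLeftward rightward = 0ℤ

  columnWeight-∏ : ∀ {N} (c : Vec Horizontal N) v h → columnWeight c v h ≡
    ∏ (λ i → vertexWeight (lookup v (inject₁ i)) (lookup c i) (lookup h i) (lookup v (suc i))) * isDownward (lookup v (fromℕ N))
  columnWeight-∏ []      (v ∷ [])     []        = sym (ℤₚ.*-identityˡ (isDownward v))
  columnWeight-∏ (h ∷ hs) (v ∷ v′ ∷ vs) (h′ ∷ hs′) =
    trans (cong (vertexWeight v h h′ v′ *_) (columnWeight-∏ hs (v′ ∷ vs) hs′))
          (sym (ℤₚ.*-assoc (vertexWeight v h h′ v′) _ _))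

  noRightward-∏ : ∀ {N} (c : Vec Horizontal N) → noRightward c ≡ ∏ (λ i → isLeftward (lookup c i))
  noRightward-∏ []              = refl
  noRightward-∏ (leftward ∷ c)  = trans (noRightward-∏ c) (sym (ℤₚ.*-identityˡ (∏ (λ i → isLeftward (lookup c i)))))
  noRightward-∏ (rightward ∷ c) = refl

  pairsWeight-∏ : ∀ n (c : Vec Horizontal (n ℕ.* 2)) →
    pairsWeight n c ≡ ∏ (λ k → pairWeight (lookup c (oddRow n k)) (lookup c (evenRow n k)))
  pairsWeight-∏ zero    []           = refl
  pairsWeight-∏ (suc n) (h ∷ h′ ∷ c) = cong (pairWeight h h′ *_) (pairsWeight-∏ n c)

  stripWeight : ∀ {N} → Vec Horizontal N → Vec Vertical (suc N) → Vec Horizontal N → ℤ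
  stripWeight c v h = isUpward (Vec.head v) * columnWeight c v h

  pathWeight-∏ : ∀ {N k} (c : Vec Horizontal N) (vs : Vec (Vec Vertical (suc N)) k) (hs : Vec (Vec Horizontal N) k) →
    pathWeight c vs hs ≡
    ∏ (λ q → stripWeight (lookup (c ∷ hs) (inject₁ q)) (lookup vs q) (lookup (c ∷ hs) (suc q)))
    * noRightward (lookup (c ∷ hs) (fromℕ k))
  pathWeight-∏ c []       []       = sym (ℤₚ.*-identityˡ (noRightward c))
  pathWeight-∏ c (v ∷ vs) (h ∷ hs) = trans
    (cong (λ x → isUpward (Vec.head v) * (columnWeight c v h * x)) (pathWeight-∏ h vs hs))
    (lemma (isUpward (Vec.head v)) (columnWeight c v h) _ _)
    where
    lemma : ∀ a b c d → a * (b * (c * d)) ≡ ((a * b) * c) * d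
    lemma = solve-∀

  -- The summation proceeds by columns, while `Orientation` stores rows.
  flip : ∀ {A : Set} {m n} → Matrix A m n → Matrix A n m
  flip M = tabulate (λ q → tabulate (λ i → M at i , q))

  at-tabulate : ∀ {A : Set} {m n} (f : Fin m → Fin n → A) i q → tabulate (λ i → tabulate (f i)) at i , q ≡ f i q
  at-tabulate f i q = trans (cong (λ r → lookup r q) (lookup∘tabulate (λ i → tabulate (f i)) i)) (lookup∘tabulate (f i) q)

  matrix-ext : ∀ {A : Set} {m n} {M N : Matrix A m n} → (∀ i q → M at i , q ≡ N at i , q) → M ≡ N
  matrix-ext {M = M} {N} M≡N = trans (sym (tabulate∘lookup M))
    (trans (tabulate-cong (λ i → trans (sym (tabulate∘lookup (lookup M i)))
             (trans (tabulate-cong (M≡N i)) (tabulate∘lookup (lookup N i)))))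
           (tabulate∘lookup N))

  flip-flip : ∀ {A : Set} {m n} (M : Matrix A m n) → flip (flip M) ≡ M
  flip-flip M = matrix-ext (λ i q → trans (at-tabulate (λ i q → flip M at q , i) i q) (at-tabulate (λ q i → M at i , q) q i))

  flip↔ : ∀ {A : Set} {m n} → Matrix A m n ↔ Matrix A n m
  flip↔ = mk↔ₛ′ flip flip flip-flip flip-flip

  orientationWeight : ∀ {n} → Orientation n → ℤ
  orientationWeight {n} o = latticeWeight n (flip (vertical o)) (flip (horizontal o))

  orientationWeight-total : ∀ n → total (orientations n) orientationWeight ≡ + (2 ℕ.^ (n ℕ.^ 2))
  orientationWeight-total n = begin
    total (orientations n) orientationWeight
      ≡⟨ total-inverse (V ×-finite H) (orientations n) pair orientationWeight ⟨
    total (V ×-finite H) (λ (v , h) → latticeWeight n (flip v) (flip h))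
      ≡⟨ total-× V H (λ (v , h) → latticeWeight n (flip v) (flip h)) ⟩
    total V (λ v → total H (λ h → latticeWeight n (flip v) (flip h)))
      ≡⟨ total-cong V (λ v → total-inverse H H′ flip↔ (latticeWeight n (flip v))) ⟩
    total V (λ v → total H′ (latticeWeight n (flip v)))
      ≡⟨ total-inverse V V′ flip↔ (λ vs → total H′ (latticeWeight n vs)) ⟩
    total V′ (λ vs → total H′ (latticeWeight n vs))
      ≡⟨ latticeWeight-total n ⟩
    + (2 ℕ.^ (n ℕ.^ 2)) ∎
    where
    V  = matrices verticals (suc (n ℕ.* 2)) n
    H  = matrices horizontals (n ℕ.* 2) (suc n)
    V′ = matrices verticals n (suc (n ℕ.* 2))
    H′ = matrices horizontals (suc n) (n ℕ.* 2)
    pair : (Matrix Vertical (suc (n ℕ.* 2)) n × Matrix Horizontal (n ℕ.* 2) (suc n)) ↔ Orientation n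
    pair = mk↔ₛ′ (λ (v , h) → orientation v h) (λ o → vertical o , horizontal o) (λ _ → refl) (λ _ → refl)

  vertexWeightAt : ∀ {n} → Orientation n → Fin (n ℕ.* 2) → Fin n → ℤ
  vertexWeightAt o i q = vertexWeight (vertical o at inject₁ i , q) (horizontal o at i , inject₁ q)
                                      (horizontal o at i , suc q) (vertical o at suc i , q)

  -- Separates left boundary, top, vertices, bottom and right boundary. Both the value of the weight
  -- on square ice and its vanishing elsewhere are read off these factors.
  orientationWeight-∏ : ∀ {n} (o : Orientation n) → orientationWeight o ≡
    ∏ (λ k → pairWeight (horizontal o at oddRow n k , zero) (horizontal o at evenRow n k , zero))
    * (∏ (λ q → isUpward (vertical o at zero , q) *
                (∏ (λ i → vertexWeightAt o i q) * isDownward (vertical o at fromℕ (n ℕ.* 2) , q)))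
       * ∏ (λ i → isLeftward (horizontal o at i , fromℕ n)))
  orientationWeight-∏ {n} o = cong₂ _*_
    (trans (pairsWeight-∏ n (lookup hs zero)) (∏-cong (λ k →
      cong₂ pairWeight (h-at zero (oddRow n k)) (h-at zero (evenRow n k)))))
    (trans (pathWeight-∏ (Vec.head hs) vs (Vec.tail hs)) (cong₂ _*_
      (∏-cong (λ q → cong₂ _*_
        (cong isUpward (trans (head-lookup (lookup vs q)) (v-at q zero)))
        (trans (columnWeight-∏ (lookup hs (inject₁ q)) (lookup vs q) (lookup hs (suc q)))
          (cong₂ _*_
            (∏-cong (λ i → vertexWeight-cong (v-at q (inject₁ i)) (h-at (inject₁ q) i) (h-at (suc q) i) (v-at q (suc i))))
            (cong isDownward (v-at q (fromℕ (n ℕ.* 2))))))))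
      (trans (noRightward-∏ (lookup hs (fromℕ n))) (∏-cong (λ i → cong isLeftward (h-at (fromℕ n) i))))))
    where
    vs = flip (vertical o)
    hs = flip (horizontal o)
    v-at : ∀ q i → vs at q , i ≡ vertical o at i , q
    v-at = at-tabulate (λ q i → vertical o at i , q)
    h-at : ∀ q i → hs at q , i ≡ horizontal o at i , q
    h-at = at-tabulate (λ q i → horizontal o at i , q)
    head-lookup : ∀ {A : Set} {m} (xs : Vec A (suc m)) → Vec.head xs ≡ lookup xs zero
    head-lookup (x ∷ xs) = refl
    vertexWeight-cong : ∀ {a a′ b b′ c c′ d d′} → a ≡ a′ → b ≡ b′ → c ≡ c′ → d ≡ d′ →
                        vertexWeight a b c d ≡ vertexWeight a′ b′ c′ d′
    vertexWeight-cong refl refl refl refl = refl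

  edgeFlow : Vertical → Horizontal → Horizontal → Vertical → Direction → Flow
  edgeFlow v h h′ v′ up    = upEdge v
  edgeFlow v h h′ v′ down  = downEdge v′
  edgeFlow v h h′ v′ left  = leftEdge h
  edgeFlow v h h′ v′ right = rightEdge h′

  flow-edgeFlow : ∀ {n} (o : Orientation n) i q d → flow o i q d ≡
    edgeFlow (vertical o at inject₁ i , q) (horizontal o at i , inject₁ q) (horizontal o at i , suc q) (vertical o at suc i , q) d
  flow-edgeFlow o i q up    = refl
  flow-edgeFlow o i q down  = refl
  flow-edgeFlow o i q left  = refl
  flow-edgeFlow o i q right = refl

  numberOf-cong : ∀ x {f g : Direction → Flow} → (∀ d → f d ≡ g d) → numberOf x f ≡ numberOf x g
  numberOf-cong x {f} {g} f≡g = cong List.length (filter-≐ (λ d → f d ≟ x) (λ d → g d ≟ x)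
    ((λ {d} fd≡x → trans (sym (f≡g d)) fd≡x) , (λ {d} gd≡x → trans (f≡g d) gd≡x))
    (Finite.elements directions))
    where open Finite flows using (_≟_)

  -- At a balanced vertex the vertical edges, and if these agree the right edge, determine the
  -- element. At other vertices the value is an arbitrary default.
  vertexElement : Vertical → Horizontal → Horizontal → Vertical → Element
  vertexElement upward   _         leftward  upward   = NW
  vertexElement upward   _         rightward upward   = NE
  vertexElement upward   _         _         downward = WE
  vertexElement downward _         _         upward   = NS
  vertexElement downward _         leftward  downward = SW
  vertexElement downward _         rightward downward = SE

  markNS : Element → ℤ
  markNS = mark (λ x → x ≟ NS)
    where open Finite elementTypes using (_≟_)

  record Balanced (v : Vertical) (h h′ : Horizontal) (v′ : Vertical) : Set where
    constructor balancedBy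
    field
      two-in   : numberOf incoming (edgeFlow v h h′ v′) ≡ 2
      two-out  : numberOf outgoing (edgeFlow v h h′ v′) ≡ 2
      element  : ∀ d → edgeFlow v h h′ v′ d ≡ flowOf (vertexElement v h h′ v′) d
      weight   : vertexWeight v h h′ v′ ≡ markNS (vertexElement v h h′ v′)

  every : {P : Direction → Set} → P up → P down → P left → P right → ∀ d → P d
  every u d l r up    = u
  every u d l r down  = d
  every u d l r left  = l
  every u d l r right = r

  weight≢0⇒balanced : ∀ v h h′ v′ → vertexWeight v h h′ v′ ≢ 0ℤ → Balanced v h h′ v′
  weight≢0⇒balanced upward   leftward  leftward  upward   _ = balancedBy refl refl (every refl refl refl refl) refl
  weight≢0⇒balanced upward   rightward rightward upward   _ = balancedBy refl refl (every refl refl refl refl) refl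
  weight≢0⇒balanced upward   rightward leftward  downward _ = balancedBy refl refl (every refl refl refl refl) refl
  weight≢0⇒balanced downward leftward  leftward  downward _ = balancedBy refl refl (every refl refl refl refl) refl
  weight≢0⇒balanced downward rightward rightward downward _ = balancedBy refl refl (every refl refl refl refl) refl
  weight≢0⇒balanced downward leftward  rightward upward   _ = balancedBy refl refl (every refl refl refl refl) refl
  weight≢0⇒balanced upward   leftward  leftward  downward ≢0 = contradiction refl ≢0
  weight≢0⇒balanced upward   leftward  rightward upward   ≢0 = contradiction refl ≢0
  weight≢0⇒balanced upward   leftward  rightward downward ≢0 = contradiction refl ≢0
  weight≢0⇒balanced upward   rightward leftward  upward   ≢0 = contradiction refl ≢0
  weight≢0⇒balanced upward   rightward rightward downward ≢0 = contradiction refl ≢0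
  weight≢0⇒balanced downward leftward  leftward  upward   ≢0 = contradiction refl ≢0
  weight≢0⇒balanced downward leftward  rightward downward ≢0 = contradiction refl ≢0
  weight≢0⇒balanced downward rightward leftward  upward   ≢0 = contradiction refl ≢0
  weight≢0⇒balanced downward rightward leftward  downward ≢0 = contradiction refl ≢0
  weight≢0⇒balanced downward rightward rightward upward   ≢0 = contradiction refl ≢0

  two-in⇒weight≢0 : ∀ v h h′ v′ → numberOf incoming (edgeFlow v h h′ v′) ≡ 2 → vertexWeight v h h′ v′ ≢ 0ℤ
  two-in⇒weight≢0 upward   leftward  leftward  upward   _ ()
  two-in⇒weight≢0 upward   rightward rightward upward   _ ()
  two-in⇒weight≢0 upward   rightward leftward  downward _ ()
  two-in⇒weight≢0 downward leftward  leftward  downward _ ()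
  two-in⇒weight≢0 downward rightward rightward downward _ ()
  two-in⇒weight≢0 downward leftward  rightward upward   _ ()
  two-in⇒weight≢0 upward   leftward  leftward  downward ()
  two-in⇒weight≢0 upward   leftward  rightward upward   ()
  two-in⇒weight≢0 upward   leftward  rightward downward ()
  two-in⇒weight≢0 upward   rightward leftward  upward   ()
  two-in⇒weight≢0 upward   rightward rightward downward ()
  two-in⇒weight≢0 downward leftward  leftward  upward   ()
  two-in⇒weight≢0 downward leftward  rightward downward ()
  two-in⇒weight≢0 downward rightward leftward  upward   ()
  two-in⇒weight≢0 downward rightward leftward  downward ()
  two-in⇒weight≢0 downward rightward rightward upward   ()

  elementMatrix : ∀ {n} → Orientation n → Matrix Element (n ℕ.* 2) n
  elementMatrix o = tabulate (λ i → tabulate (λ q → vertexElement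
    (vertical o at inject₁ i , q) (horizontal o at i , inject₁ q) (horizontal o at i , suc q) (vertical o at suc i , q)))

  elementMatrix-at : ∀ {n} (o : Orientation n) i q → elementMatrix o at i , q ≡ vertexElement
    (vertical o at inject₁ i , q) (horizontal o at i , inject₁ q) (horizontal o at i , suc q) (vertical o at suc i , q)
  elementMatrix-at o = at-tabulate (λ i q → vertexElement
    (vertical o at inject₁ i , q) (horizontal o at i , inject₁ q) (horizontal o at i , suc q) (vertical o at suc i , q))

  module _ {n} {o : Orientation n} (ice : IsSquareIce o) where
    open IsSquareIce ice

    balanced : ∀ i q → Balanced (vertical o at inject₁ i , q) (horizontal o at i , inject₁ q)
                                (horizontal o at i , suc q) (vertical o at suc i , q)
    balanced i q = weight≢0⇒balanced _ _ _ _ (two-in⇒weight≢0 _ _ _ _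
      (trans (sym (numberOf-cong incoming (flow-edgeFlow o i q))) (two-in i q)))

    ice⇒isMatrixOf : IsMatrixOf o (elementMatrix o)
    ice⇒isMatrixOf i q d = trans (flow-edgeFlow o i q d)
      (trans (Balanced.element (balanced i q) d) (cong (λ x → flowOf x d) (sym (elementMatrix-at o i q))))

    ice⇒weight : orientationWeight o ≡ + (2 ℕ.^ ns (elementMatrix o))
    ice⇒weight = begin
      orientationWeight o
        ≡⟨ orientationWeight-∏ o ⟩
      ∏ (λ k → pairWeight (horizontal o at oddRow n k , zero) (horizontal o at evenRow n k , zero))
      * (∏ (λ q → isUpward (vertical o at zero , q) *
                  (∏ (λ i → vertexWeightAt o i q) * isDownward (vertical o at fromℕ (n ℕ.* 2) , q)))
         * ∏ (λ i → isLeftward (horizontal o at i , fromℕ n)))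
        ≡⟨ cong₂ _*_ (∏-ones _ (λ k → pair (left-boundary k)))
             (cong₂ _*_ (∏-cong strip) (∏-ones _ (λ i → cong isLeftward (right-boundary i)))) ⟩
      1ℤ * (∏ (λ q → ∏ (λ i → markNS (elementMatrix o at i , q))) * 1ℤ)
        ≡⟨ trans (ℤₚ.*-identityˡ _) (ℤₚ.*-identityʳ _) ⟩
      ∏ (λ q → ∏ (λ i → markNS (elementMatrix o at i , q)))
        -- The weight is built by columns, whereas `ns` counts by rows.
        ≡⟨ ∏-comm (λ q i → markNS (elementMatrix o at i , q)) ⟩
      ∏ (λ i → ∏ (λ q → markNS (elementMatrix o at i , q)))
        ≡⟨ 2^count-concat (λ x → x ≟ NS) (elementMatrix o) ⟨
      + (2 ℕ.^ ns (elementMatrix o)) ∎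
      where
      open Finite elementTypes using (_≟_)
      pair : ∀ {h h′} → (h ≡ rightward × h′ ≡ leftward) ⊎ (h ≡ leftward × h′ ≡ rightward) → pairWeight h h′ ≡ 1ℤ
      pair (inj₁ (refl , refl)) = refl
      pair (inj₂ (refl , refl)) = refl
      strip : ∀ q → isUpward (vertical o at zero , q) *
                    (∏ (λ i → vertexWeightAt o i q) * isDownward (vertical o at fromℕ (n ℕ.* 2) , q))
                  ≡ ∏ (λ i → markNS (elementMatrix o at i , q))
      strip q = trans
        (cong₂ _*_ (cong isUpward (top-boundary q))
          (cong₂ _*_ (∏-cong (λ i → trans (Balanced.weight (balanced i q)) (cong markNS (sym (elementMatrix-at o i q)))))
                     (cong isDownward (bottom-boundary q))))
        (trans (ℤₚ.*-identityˡ _) (ℤₚ.*-identityʳ _))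

  weight≢0⇒ice : ∀ {n} (o : Orientation n) → orientationWeight o ≢ 0ℤ → IsSquareIce o
  weight≢0⇒ice {n} o w≢0 = record
    { two-in  = λ i q → trans (numberOf-cong incoming (flow-edgeFlow o i q)) (Balanced.two-in (balanced′ i q))
    ; two-out = λ i q → trans (numberOf-cong outgoing (flow-edgeFlow o i q)) (Balanced.two-out (balanced′ i q))
    ; right-boundary  = λ i → leftward! (∏-nonzero ends (nonzeroʳ (∏ strip) rest≢0) i)
    ; bottom-boundary = λ q → downward! (nonzeroʳ (∏ (interior q)) (nonzeroʳ (top q) (strip≢0 q)))
    ; top-boundary    = λ q → upward! (nonzeroˡ (top q) (strip≢0 q))
    ; left-boundary   = λ k → pair! (∏-nonzero pairs (nonzeroˡ (∏ pairs) product≢0) k)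
    }
    where
    pairs    = λ k → pairWeight (horizontal o at oddRow n k , zero) (horizontal o at evenRow n k , zero)
    ends     = λ i → isLeftward (horizontal o at i , fromℕ n)
    top      = λ q → isUpward (vertical o at zero , q)
    bottom   = λ q → isDownward (vertical o at fromℕ (n ℕ.* 2) , q)
    interior = λ q i → vertexWeightAt o i q
    strip    = λ q → top q * (∏ (interior q) * bottom q)
    product≢0 : ∏ pairs * (∏ strip * ∏ ends) ≢ 0ℤ
    product≢0 ≡0 = w≢0 (trans (orientationWeight-∏ o) ≡0)
    rest≢0 : ∏ strip * ∏ ends ≢ 0ℤ
    rest≢0 = nonzeroʳ (∏ pairs) product≢0
    strip≢0 : ∀ q → strip q ≢ 0ℤ
    strip≢0 = ∏-nonzero strip (nonzeroˡ (∏ strip) rest≢0)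
    balanced′ = λ i q → weight≢0⇒balanced _ _ _ _
      (∏-nonzero (interior q) (nonzeroˡ (∏ (interior q)) (nonzeroʳ (top q) (strip≢0 q))) i)
    leftward! : ∀ {h} → isLeftward h ≢ 0ℤ → h ≡ leftward
    leftward! {leftward}  _  = refl
    leftward! {rightward} ≢0 = contradiction refl ≢0
    upward! : ∀ {v} → isUpward v ≢ 0ℤ → v ≡ upward
    upward! {upward}   _  = refl
    upward! {downward} ≢0 = contradiction refl ≢0
    downward! : ∀ {v} → isDownward v ≢ 0ℤ → v ≡ downward
    downward! {downward} _  = refl
    downward! {upward}   ≢0 = contradiction refl ≢0
    pair! : ∀ {h h′} → pairWeight h h′ ≢ 0ℤ → (h ≡ rightward × h′ ≡ leftward) ⊎ (h ≡ leftward × h′ ≡ rightward)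
    pair! {rightward} {leftward}  _  = inj₁ (refl , refl)
    pair! {leftward}  {rightward} _  = inj₂ (refl , refl)
    pair! {leftward}  {leftward}  ≢0 = contradiction refl ≢0
    pair! {rightward} {rightward} ≢0 = contradiction refl ≢0

  orientation-sum : ∀ n → sumOver (orientations n) isSquareIce? (λ o → 2 ℕ.^ ns (elementMatrix o)) ≡ 2 ℕ.^ (n ℕ.^ 2)
  orientation-sum n = ℤₚ.+-injective (trans
    (sumOver-total (orientations n) isSquareIce? _ orientationWeight (λ o ice → ice⇒weight ice) off)
    (orientationWeight-total n))
    where
    off : ∀ o → ¬ IsSquareIce o → orientationWeight o ≡ 0ℤ
    off o ¬ice with orientationWeight o ℤ.≟ 0ℤ
    ... | yes ≡0 = ≡0
    ... | no ≢0  = contradiction (weight≢0⇒ice o ≢0) ¬ice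

  -- Ice matrices and their orientations

  elementOf : Flow → Flow → Flow → Element
  elementOf outgoing outgoing _        = WE
  elementOf incoming incoming _        = NS
  elementOf outgoing incoming incoming = NE
  elementOf outgoing incoming outgoing = NW
  elementOf incoming outgoing incoming = SE
  elementOf incoming outgoing outgoing = SW

  elementOf-flowOf : ∀ x → elementOf (flowOf x up) (flowOf x down) (flowOf x left) ≡ x
  elementOf-flowOf WE = refl
  elementOf-flowOf NS = refl
  elementOf-flowOf NE = refl
  elementOf-flowOf SW = refl
  elementOf-flowOf NW = refl
  elementOf-flowOf SE = refl

  flowOf-injective : ∀ {x y} → (∀ d → flowOf x d ≡ flowOf y d) → x ≡ y
  flowOf-injective {x} {y} eq = begin
    x                                                        ≡⟨ elementOf-flowOf x ⟨
    elementOf (flowOf x up) (flowOf x down) (flowOf x left)  ≡⟨ cong₂ (λ a b → elementOf a b (flowOf x left)) (eq up) (eq down) ⟩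
    elementOf (flowOf y up) (flowOf y down) (flowOf x left)  ≡⟨ cong (elementOf (flowOf y up) (flowOf y down)) (eq left) ⟩
    elementOf (flowOf y up) (flowOf y down) (flowOf y left)  ≡⟨ elementOf-flowOf y ⟩
    y                                                        ∎

  orientation-ext : ∀ {n} {o o′ : Orientation n} →
    (∀ i q → vertical o at i , q ≡ vertical o′ at i , q) →
    (∀ i q → horizontal o at i , q ≡ horizontal o′ at i , q) → o ≡ o′
  orientation-ext v≡ h≡ = cong₂ orientation (matrix-ext v≡) (matrix-ext h≡)

  -- Every edge is the lower or the left edge of some vertex, hence read off its element, except
  -- those of the top and right boundary, which are prescribed.
  elementMatrix-injective : ∀ {n} {o o′ : Orientation n} → IsSquareIce o → IsSquareIce o′ →
                            elementMatrix o ≡ elementMatrix o′ → o ≡ o′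
  elementMatrix-injective {n} {o} {o′} ice ice′ M≡M′ = orientation-ext v≡ (λ i p → h≡ i p (view p))
    where
    open IsSquareIce
    flow≡ : ∀ i q d → flow o i q d ≡ flow o′ i q d
    flow≡ i q d = trans (ice⇒isMatrixOf ice i q d)
      (trans (cong (λ M → flowOf (M at i , q) d) M≡M′) (sym (ice⇒isMatrixOf ice′ i q d)))
    downEdge-injective : ∀ {v v′} → downEdge v ≡ downEdge v′ → v ≡ v′
    downEdge-injective {upward}   {upward}   _ = refl
    downEdge-injective {downward} {downward} _ = refl
    leftEdge-injective : ∀ {h h′} → leftEdge h ≡ leftEdge h′ → h ≡ h′
    leftEdge-injective {leftward}  {leftward}  _ = refl
    leftEdge-injective {rightward} {rightward} _ = refl
    v≡ : ∀ i q → vertical o at i , q ≡ vertical o′ at i , q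
    v≡ zero    q = trans (top-boundary ice q) (sym (top-boundary ice′ q))
    v≡ (suc i) q = downEdge-injective (flow≡ i q down)
    h≡ : ∀ i p → Data.Fin.Relation.Unary.Top.View p → horizontal o at i , p ≡ horizontal o′ at i , p
    h≡ i _ ‵fromℕ       = trans (right-boundary ice i) (sym (right-boundary ice′ i))
    h≡ i _ (‵inject₁ q) = leftEdge-injective (flow≡ i q left)

  iceMatrix-sum : ∀ n → sumOver (orientations n) isSquareIce? (λ o → 2 ℕ.^ ns (elementMatrix o))
                      ≡ sumOver (matrices elementTypes (n ℕ.* 2) n) isIceMatrix? (λ M → 2 ℕ.^ ns M)
  iceMatrix-sum n = sumOver-image (orientations n) (matrices elementTypes (n ℕ.* 2) n) isSquareIce? isIceMatrix? _ _
    elementMatrix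
    (λ o ice → o , ice , ice⇒isMatrixOf ice)
    (λ M (o , ice , o-M) → o , ice , matrix-ext (λ i q → flowOf-injective
      (λ d → trans (sym (ice⇒isMatrixOf ice i q d)) (o-M i q d))))
    (λ o o′ ice ice′ → elementMatrix-injective ice ice′)
    (λ _ _ → refl)

  -- U-turn matrices: entries as differences of edges, edges as tail sums

  tailSum : ∀ {n} → (Fin n → ℤ) → Fin (suc n) → ℤ
  tailSum         f zero    = ∑ f
  tailSum {suc n} f (suc p) = tailSum (f ∘ suc) p

  ∑-suc : ∀ {n} (f : Fin (suc n) → ℤ) → ∑ f ≡ f zero + ∑ (f ∘ suc)
  ∑-suc f = cong (λ xs → f zero + foldr _+_ 0ℤ xs) (trans (map-tabulate suc f) (sym (map-tabulate id (f ∘ suc))))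

  ∑-from-zero : ∀ {n} (f : Fin (suc n) → ℤ) → ∑-from zero f ≡ ∑ f
  ∑-from-zero {n} f = cong (foldr _+_ 0ℤ ∘ map f) (filter-all (zero {n} Fin.≤?_) (All.universal (λ _ → ℕ.z≤n) (allFin (suc n))))

  ∑-from-suc : ∀ {n} (p : Fin n) (f : Fin (suc n) → ℤ) → ∑-from (suc p) f ≡ ∑-from p (f ∘ suc)
  ∑-from-suc {n} p f = begin
    foldr _+_ 0ℤ (map f (filter (suc p Fin.≤?_) (List.tabulate suc)))
      ≡⟨ cong (λ xs → foldr _+_ 0ℤ (map f (filter (suc p Fin.≤?_) xs))) (map-tabulate id suc) ⟨
    foldr _+_ 0ℤ (map f (filter (suc p Fin.≤?_) (map suc (allFin n))))
      ≡⟨ go (allFin n) ⟩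
    ∑-from p (f ∘ suc) ∎
    where
    go : ∀ xs → foldr _+_ 0ℤ (map f (filter (suc p Fin.≤?_) (map suc xs)))
              ≡ foldr _+_ 0ℤ (map (f ∘ suc) (filter (p Fin.≤?_) xs))
    go []       = refl
    go (x ∷ xs) = by-cases (p Fin.≤? x)
      where
      by-cases : Dec (p Fin.≤ x) → _
      by-cases (yes p≤x) = begin
        foldr _+_ 0ℤ (map f (filter (suc p Fin.≤?_) (map suc (x ∷ xs))))
          ≡⟨ cong (foldr _+_ 0ℤ ∘ map f) (filter-accept (suc p Fin.≤?_) (ℕ.s≤s p≤x)) ⟩
        f (suc x) + foldr _+_ 0ℤ (map f (filter (suc p Fin.≤?_) (map suc xs)))
          ≡⟨ cong (λ s → f (suc x) + s) (go xs) ⟩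
        f (suc x) + foldr _+_ 0ℤ (map (f ∘ suc) (filter (p Fin.≤?_) xs))
          ≡⟨ cong (foldr _+_ 0ℤ ∘ map (f ∘ suc)) (filter-accept (p Fin.≤?_) p≤x) ⟨
        foldr _+_ 0ℤ (map (f ∘ suc) (filter (p Fin.≤?_) (x ∷ xs))) ∎
      by-cases (no p≰x) = begin
        foldr _+_ 0ℤ (map f (filter (suc p Fin.≤?_) (map suc (x ∷ xs))))
          ≡⟨ cong (foldr _+_ 0ℤ ∘ map f) (filter-reject (suc p Fin.≤?_) (p≰x ∘ ℕ.s≤s⁻¹)) ⟩
        foldr _+_ 0ℤ (map f (filter (suc p Fin.≤?_) (map suc xs)))
          ≡⟨ go xs ⟩
        foldr _+_ 0ℤ (map (f ∘ suc) (filter (p Fin.≤?_) xs))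
          ≡⟨ cong (foldr _+_ 0ℤ ∘ map (f ∘ suc)) (filter-reject (p Fin.≤?_) p≰x) ⟨
        foldr _+_ 0ℤ (map (f ∘ suc) (filter (p Fin.≤?_) (x ∷ xs))) ∎

  -- `tailSum` has one position more than `∑-from`, the empty tail at the end, so that its positions
  -- match the edges along a line, both boundary edges included.
  ∑-from≡tailSum : ∀ {n} (p : Fin n) f → ∑-from p f ≡ tailSum f (inject₁ p)
  ∑-from≡tailSum zero    f = ∑-from-zero f
  ∑-from≡tailSum (suc p) f = trans (∑-from-suc p f) (∑-from≡tailSum p (f ∘ suc))

  tailSum-step : ∀ {n} f (q : Fin n) → tailSum f (inject₁ q) ≡ f q + tailSum f (suc q)
  tailSum-step f zero    = ∑-suc f
  tailSum-step f (suc q) = tailSum-step (f ∘ suc) q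

  tailSum-last : ∀ {n} (f : Fin n → ℤ) → tailSum f (fromℕ n) ≡ 0ℤ
  tailSum-last {zero}  f = refl
  tailSum-last {suc n} f = tailSum-last (f ∘ suc)

  ∑-+ : ∀ {n} (f g : Fin n → ℤ) → ∑ (λ q → f q + g q) ≡ ∑ f + ∑ g
  ∑-+ {zero}  f g = refl
  ∑-+ {suc n} f g = begin
    ∑ (λ q → f q + g q)                                          ≡⟨ ∑-suc (λ q → f q + g q) ⟩
    (f zero + g zero) + ∑ (λ q → f (suc q) + g (suc q))          ≡⟨ cong (λ s → (f zero + g zero) + s) (∑-+ (f ∘ suc) (g ∘ suc)) ⟩
    (f zero + g zero) + (∑ (f ∘ suc) + ∑ (g ∘ suc))              ≡⟨ lemma (f zero) (g zero) (∑ (f ∘ suc)) (∑ (g ∘ suc)) ⟩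
    (f zero + ∑ (f ∘ suc)) + (g zero + ∑ (g ∘ suc))              ≡⟨ cong₂ _+_ (∑-suc f) (∑-suc g) ⟨
    ∑ f + ∑ g                                                    ∎
    where
    lemma : ∀ a b c d → (a + b) + (c + d) ≡ (a + c) + (b + d)
    lemma = solve-∀

  telescope : ∀ {n} (f : Fin n → ℤ) (g : Fin (suc n) → ℤ) → (∀ q → f q ≡ g (inject₁ q) - g (suc q)) →
              g (fromℕ n) ≡ 0ℤ → ∀ p → tailSum f p ≡ g p
  telescope {zero}  f g f≡ last≡0 zero    = sym last≡0
  telescope {suc n} f g f≡ last≡0 (suc p) = telescope (f ∘ suc) (g ∘ suc) (f≡ ∘ suc) last≡0 p
  telescope {suc n} f g f≡ last≡0 zero    = begin
    ∑ f                                  ≡⟨ ∑-suc f ⟩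
    f zero + ∑ (f ∘ suc)                 ≡⟨ cong₂ _+_ (f≡ zero) (telescope (f ∘ suc) (g ∘ suc) (f≡ ∘ suc) last≡0 zero) ⟩
    (g zero - g (suc zero)) + g (suc zero) ≡⟨ lemma (g zero) (g (suc zero)) ⟩
    g zero                               ∎
    where
    lemma : ∀ a b → (a - b) + b ≡ a
    lemma = solve-∀

  horizontalBit : Horizontal → ℤ
  horizontalBit leftward  = 0ℤ
  horizontalBit rightward = 1ℤ

  verticalBit : Vertical → ℤ
  verticalBit downward = 0ℤ
  verticalBit upward   = 1ℤ

  horizontalBit-injective : ∀ {h h′} → horizontalBit h ≡ horizontalBit h′ → h ≡ h′
  horizontalBit-injective {leftward}  {leftward}  _ = refl
  horizontalBit-injective {rightward} {rightward} _ = refl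

  verticalBit-injective : ∀ {v v′} → verticalBit v ≡ verticalBit v′ → v ≡ v′
  verticalBit-injective {downward} {downward} _ = refl
  verticalBit-injective {upward}   {upward}   _ = refl

  horizontalBit-01 : ∀ h → ZeroOrOne (horizontalBit h)
  horizontalBit-01 leftward  = inj₁ refl
  horizontalBit-01 rightward = inj₂ refl

  verticalBit-01 : ∀ v → ZeroOrOne (verticalBit v)
  verticalBit-01 downward = inj₁ refl
  verticalBit-01 upward   = inj₂ refl

  toHorizontal : ℤ → Horizontal
  toHorizontal (+ 1) = rightward
  toHorizontal _     = leftward

  toVertical : ℤ → Vertical
  toVertical (+ 1) = upward
  toVertical _     = downward

  horizontalBit-to : ∀ {x} → ZeroOrOne x → horizontalBit (toHorizontal x) ≡ x
  horizontalBit-to (inj₁ refl) = refl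
  horizontalBit-to (inj₂ refl) = refl

  verticalBit-to : ∀ {x} → ZeroOrOne x → verticalBit (toVertical x) ≡ x
  verticalBit-to (inj₁ refl) = refl
  verticalBit-to (inj₂ refl) = refl

  signOf : Horizontal → Horizontal → Sign
  signOf rightward leftward  = pos
  signOf leftward  rightward = neg
  signOf leftward  leftward  = zer
  signOf rightward rightward = zer

  value-signOf : ∀ h h′ → value (signOf h h′) ≡ horizontalBit h - horizontalBit h′
  value-signOf rightward leftward  = refl
  value-signOf leftward  rightward = refl
  value-signOf leftward  leftward  = refl
  value-signOf rightward rightward = refl

  value-injective : ∀ {x y} → value x ≡ value y → x ≡ y
  value-injective {neg} {neg} _ = refl
  value-injective {zer} {zer} _ = refl
  value-injective {pos} {pos} _ = refl

  markNeg : Sign → ℤ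
  markNeg = mark (λ x → x ≟ neg)
    where open Finite signs using (_≟_)

  -- With bit 1 for rightward and upward edges, the ice rule says that the bit drops by the same
  -- amount across the vertex horizontally and vertically. This drop is the matrix entry, and it is
  -- -1 at NS vertices only.
  conservation : ∀ v h h′ v′ → vertexWeight v h h′ v′ ≢ 0ℤ →
    horizontalBit h - horizontalBit h′ ≡ verticalBit v - verticalBit v′
    × markNS (vertexElement v h h′ v′) ≡ markNeg (signOf h h′)
  conservation upward   leftward  leftward  upward   _ = refl , refl
  conservation upward   rightward rightward upward   _ = refl , refl
  conservation upward   rightward leftward  downward _ = refl , refl
  conservation downward leftward  leftward  downward _ = refl , refl
  conservation downward rightward rightward downward _ = refl , refl
  conservation downward leftward  rightward upward   _ = refl , refl
  conservation upward   leftward  leftward  downward ≢0 = contradiction refl ≢0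
  conservation upward   leftward  rightward upward   ≢0 = contradiction refl ≢0
  conservation upward   leftward  rightward downward ≢0 = contradiction refl ≢0
  conservation upward   rightward leftward  upward   ≢0 = contradiction refl ≢0
  conservation upward   rightward rightward downward ≢0 = contradiction refl ≢0
  conservation downward leftward  leftward  upward   ≢0 = contradiction refl ≢0
  conservation downward leftward  rightward downward ≢0 = contradiction refl ≢0
  conservation downward rightward leftward  upward   ≢0 = contradiction refl ≢0
  conservation downward rightward leftward  downward ≢0 = contradiction refl ≢0
  conservation downward rightward rightward upward   ≢0 = contradiction refl ≢0

  conservation⁻¹ : ∀ v h h′ v′ → horizontalBit h - horizontalBit h′ ≡ verticalBit v - verticalBit v′ →
                   vertexWeight v h h′ v′ ≢ 0ℤ
  conservation⁻¹ upward   leftward  leftward  upward   _ ()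
  conservation⁻¹ upward   rightward rightward upward   _ ()
  conservation⁻¹ upward   rightward leftward  downward _ ()
  conservation⁻¹ downward leftward  leftward  downward _ ()
  conservation⁻¹ downward rightward rightward downward _ ()
  conservation⁻¹ downward leftward  rightward upward   _ ()
  conservation⁻¹ upward   leftward  leftward  downward ()
  conservation⁻¹ upward   leftward  rightward downward ()
  conservation⁻¹ downward rightward leftward  upward   ()
  conservation⁻¹ downward rightward rightward upward   ()

  signMatrix : ∀ {n} → Orientation n → Matrix Sign (n ℕ.* 2) n
  signMatrix o = tabulate (λ i → tabulate (λ q → signOf (horizontal o at i , inject₁ q) (horizontal o at i , suc q)))

  signMatrix-at : ∀ {n} (o : Orientation n) i q →
    signMatrix o at i , q ≡ signOf (horizontal o at i , inject₁ q) (horizontal o at i , suc q)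
  signMatrix-at o = at-tabulate (λ i q → signOf (horizontal o at i , inject₁ q) (horizontal o at i , suc q))

  value-signMatrix : ∀ {n} (o : Orientation n) i q → value (signMatrix o at i , q)
    ≡ horizontalBit (horizontal o at i , inject₁ q) - horizontalBit (horizontal o at i , suc q)
  value-signMatrix o i q = trans (cong value (signMatrix-at o i q)) (value-signOf _ _)

  module _ {n} {o : Orientation n} (ice : IsSquareIce o) where
    open IsSquareIce ice

    weightAt≢0 : ∀ i q → vertexWeightAt o i q ≢ 0ℤ
    weightAt≢0 i q = two-in⇒weight≢0 _ _ _ _ (trans (sym (numberOf-cong incoming (flow-edgeFlow o i q))) (two-in i q))

    -- The entries are drops of edge bits, so they telescope; the right boundary supplies the final
    -- bit 0. Thus the tail sums of a U-turn matrix are the edges themselves.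
    row-tailSum : ∀ i p → tailSum (λ q → value (signMatrix o at i , q)) p ≡ horizontalBit (horizontal o at i , p)
    row-tailSum i = telescope _ (λ p → horizontalBit (horizontal o at i , p)) (value-signMatrix o i)
      (cong horizontalBit (right-boundary i))

    column-tailSum : ∀ q j → tailSum (λ i → value (signMatrix o at i , q)) j ≡ verticalBit (vertical o at j , q)
    column-tailSum q = telescope _ (λ j → verticalBit (vertical o at j , q))
      (λ i → trans (value-signMatrix o i q) (proj₁ (conservation
        (vertical o at inject₁ i , q) (horizontal o at i , inject₁ q)
        (horizontal o at i , suc q) (vertical o at suc i , q) (weightAt≢0 i q))))
      (cong verticalBit (bottom-boundary q))

    ice⇒uTurn : IsUTurn (signMatrix o)
    ice⇒uTurn = record
      { row-tails    = λ i p → subst ZeroOrOne (sym (trans (∑-from≡tailSum p _) (row-tailSum i (inject₁ p)))) (horizontalBit-01 _)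
      ; column-tails = λ j q → subst ZeroOrOne (sym (trans (∑-from≡tailSum j _) (column-tailSum q (inject₁ j)))) (verticalBit-01 _)
      ; row-pairs    = λ k → trans (∑-+ (λ q → value (signMatrix o at oddRow n k , q)) (λ q → value (signMatrix o at evenRow n k , q)))
          (trans (cong₂ _+_ (row-tailSum (oddRow n k) zero) (row-tailSum (evenRow n k) zero)) (pair (left-boundary k)))
      ; columns      = λ q → trans (column-tailSum q zero) (cong verticalBit (top-boundary q))
      }
      where
      pair : ∀ {h h′} → (h ≡ rightward × h′ ≡ leftward) ⊎ (h ≡ leftward × h′ ≡ rightward) →
             horizontalBit h + horizontalBit h′ ≡ 1ℤ
      pair (inj₁ (refl , refl)) = refl
      pair (inj₂ (refl , refl)) = refl

    ice⇒ns≡negs : 2 ℕ.^ ns (elementMatrix o) ≡ 2 ℕ.^ negs (signMatrix o)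
    ice⇒ns≡negs = ℤₚ.+-injective (begin
      + (2 ℕ.^ ns (elementMatrix o))
        ≡⟨ 2^count-concat (λ x → Finite._≟_ elementTypes x NS) (elementMatrix o) ⟩
      ∏ (λ i → ∏ (λ q → markNS (elementMatrix o at i , q)))
        ≡⟨ ∏-cong (λ i → ∏-cong (λ q → trans (cong markNS (elementMatrix-at o i q))
             (trans (proj₂ (conservation _ _ _ _ (weightAt≢0 i q))) (cong markNeg (sym (signMatrix-at o i q)))))) ⟩
      ∏ (λ i → ∏ (λ q → markNeg (signMatrix o at i , q)))
        ≡⟨ 2^count-concat (λ x → Finite._≟_ signs x neg) (signMatrix o) ⟨
      + (2 ℕ.^ negs (signMatrix o)) ∎)

  signMatrix-injective : ∀ {n} {o o′ : Orientation n} → IsSquareIce o → IsSquareIce o′ →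
                         signMatrix o ≡ signMatrix o′ → o ≡ o′
  signMatrix-injective ice ice′ M≡M′ = orientation-ext
    (λ j q → verticalBit-injective (trans (sym (column-tailSum ice q j))
      (trans (cong (λ M → tailSum (λ i → value (M at i , q)) j) M≡M′) (column-tailSum ice′ q j))))
    (λ i p → horizontalBit-injective (trans (sym (row-tailSum ice i p))
      (trans (cong (λ M → tailSum (λ q → value (M at i , q)) p) M≡M′) (row-tailSum ice′ i p))))

  module _ {n} {M : Matrix Sign (n ℕ.* 2) n} (uTurn : IsUTurn M) where
    open IsUTurn uTurn

    private
      rowOf : Fin (n ℕ.* 2) → Fin n → ℤ
      rowOf i q = a i q
      columnOf : Fin n → Fin (n ℕ.* 2) → ℤ
      columnOf q i = a i q

      tailSum-01 : ∀ {n} (f : Fin n → ℤ) → (∀ p → ZeroOrOne (∑-from p f)) → ∀ p → ZeroOrOne (tailSum f p)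
      tailSum-01 f tails p with view p
      ... | ‵fromℕ     = inj₁ (tailSum-last f)
      ... | ‵inject₁ q = subst ZeroOrOne (∑-from≡tailSum q f) (tails q)

      step : ∀ {n} (f : Fin n → ℤ) q → tailSum f (inject₁ q) - tailSum f (suc q) ≡ f q
      step f q = trans (cong (λ s → s - tailSum f (suc q)) (tailSum-step f q)) (lemma (f q) (tailSum f (suc q)))
        where
        lemma : ∀ a b → (a + b) - b ≡ a
        lemma = solve-∀

    -- `toHorizontal` and `toVertical` treat every integer other than 1 as bit 0; the conditions on
    -- tails ensure that nothing is lost.
    uTurn⇒orientation : Orientation n
    uTurn⇒orientation = orientation
      (tabulate (λ j → tabulate (λ q → toVertical (tailSum (columnOf q) j))))
      (tabulate (λ i → tabulate (λ p → toHorizontal (tailSum (rowOf i) p))))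

    private
      o = uTurn⇒orientation

      verticalBit-o : ∀ j q → verticalBit (vertical o at j , q) ≡ tailSum (columnOf q) j
      verticalBit-o j q = trans (cong verticalBit (at-tabulate (λ j q → toVertical (tailSum (columnOf q) j)) j q))
        (verticalBit-to (tailSum-01 (columnOf q) (λ j → column-tails j q) j))

      horizontalBit-o : ∀ i p → horizontalBit (horizontal o at i , p) ≡ tailSum (rowOf i) p
      horizontalBit-o i p = trans (cong horizontalBit (at-tabulate (λ i p → toHorizontal (tailSum (rowOf i) p)) i p))
        (horizontalBit-to (tailSum-01 (rowOf i) (row-tails i) p))

      horizontal-difference : ∀ i q → horizontalBit (horizontal o at i , inject₁ q) - horizontalBit (horizontal o at i , suc q) ≡ a i q
      horizontal-difference i q = trans (cong₂ _-_ (horizontalBit-o i (inject₁ q)) (horizontalBit-o i (suc q))) (step (rowOf i) q)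

      vertical-difference : ∀ i q → verticalBit (vertical o at inject₁ i , q) - verticalBit (vertical o at suc i , q) ≡ a i q
      vertical-difference i q = trans (cong₂ _-_ (verticalBit-o (inject₁ i) q) (verticalBit-o (suc i) q)) (step (columnOf q) i)

      balanced-o : ∀ i q → Balanced (vertical o at inject₁ i , q) (horizontal o at i , inject₁ q)
                                    (horizontal o at i , suc q) (vertical o at suc i , q)
      balanced-o i q = weight≢0⇒balanced _ _ _ _ (conservation⁻¹ _ _ _ _
        (trans (horizontal-difference i q) (sym (vertical-difference i q))))

    -- At each vertex the horizontal and the vertical drop both equal the matrix entry, which is the
    -- ice rule by `conservation⁻¹`. The conditions `columns` and `row-pairs` become the top and
    -- left boundary.
    uTurn⇒ice : IsSquareIce uTurn⇒orientation
    uTurn⇒ice = record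
      { two-in  = λ i q → trans (numberOf-cong incoming (flow-edgeFlow o i q)) (Balanced.two-in (balanced-o i q))
      ; two-out = λ i q → trans (numberOf-cong outgoing (flow-edgeFlow o i q)) (Balanced.two-out (balanced-o i q))
      ; right-boundary  = λ i → horizontalBit-injective (trans (horizontalBit-o i (fromℕ n)) (tailSum-last (rowOf i)))
      ; bottom-boundary = λ q → verticalBit-injective (trans (verticalBit-o (fromℕ (n ℕ.* 2)) q) (tailSum-last (columnOf q)))
      ; top-boundary    = λ q → verticalBit-injective (trans (verticalBit-o zero q) (columns q))
      ; left-boundary   = λ k → pair (trans
          (cong₂ _+_ (horizontalBit-o (oddRow n k) zero) (horizontalBit-o (evenRow n k) zero))
          (trans (sym (∑-+ (rowOf (oddRow n k)) (rowOf (evenRow n k)))) (row-pairs k)))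
      }
      where
      pair : ∀ {h h′} → horizontalBit h + horizontalBit h′ ≡ 1ℤ →
             (h ≡ rightward × h′ ≡ leftward) ⊎ (h ≡ leftward × h′ ≡ rightward)
      pair {rightward} {leftward}  _ = inj₁ (refl , refl)
      pair {leftward}  {rightward} _ = inj₂ (refl , refl)

    signMatrix-uTurn : signMatrix uTurn⇒orientation ≡ M
    signMatrix-uTurn = matrix-ext (λ i q → value-injective (trans (value-signMatrix o i q) (horizontal-difference i q)))

  uTurn-sum : ∀ n → sumOver (orientations n) isSquareIce? (λ o → 2 ℕ.^ ns (elementMatrix o))
                  ≡ sumOver (matrices signs (n ℕ.* 2) n) isUTurn? (λ M → 2 ℕ.^ negs M)
  uTurn-sum n = sumOver-image (orientations n) (matrices signs (n ℕ.* 2) n) isSquareIce? isUTurn? _ _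
    signMatrix
    (λ o → ice⇒uTurn)
    (λ M uTurn → uTurn⇒orientation uTurn , uTurn⇒ice uTurn , signMatrix-uTurn uTurn)
    (λ o o′ ice ice′ → signMatrix-injective ice ice′)
    (λ o → ice⇒ns≡negs)

  -- Monotone triangles of letters

  rangeSum : (ℕ → ℤ) → ℕ → ℤ
  rangeSum g zero    = 0ℤ
  rangeSum g (suc m) = g 0 + rangeSum (g ∘ suc) m

  rangeSum-cong : ∀ {f g} m → (∀ a → f a ≡ g a) → rangeSum f m ≡ rangeSum g m
  rangeSum-cong zero    f≡g = refl
  rangeSum-cong (suc m) f≡g = cong₂ _+_ (f≡g 0) (rangeSum-cong m (f≡g ∘ suc))

  total-fins-suc : ∀ n (f : Fin (suc n) → ℤ) → total (fins (suc n)) f ≡ f zero + total (fins n) (f ∘ suc)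
  total-fins-suc n f = begin
    sumBy f (map id (allFin (suc n)))      ≡⟨ cong (sumBy f) (map-id (allFin (suc n))) ⟩
    f zero + sumBy f (List.tabulate suc)            ≡⟨ cong (λ xs → f zero + sumBy f xs) (map-tabulate id suc) ⟨
    f zero + sumBy f (map suc (allFin n))           ≡⟨ cong (λ s → f zero + s) (sumBy-map f suc (allFin n)) ⟩
    f zero + sumBy (f ∘ suc) (allFin n)             ≡⟨ cong (λ xs → f zero + sumBy (f ∘ suc) xs) (map-id (allFin n)) ⟨
    f zero + total (fins n) (f ∘ suc)               ∎

  total-letters : ∀ n (f : Letter n → ℤ) →
    total (letters n) f ≡ total (fins n) (f ∘ bar) + total (fins n) (f ∘ plain)
  total-letters n f = trans (sym (total-inverse (fins n ⊎-finite fins n) (letters n) letter f))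
                            (total-⊎ (fins n) (fins n) _)
    where
    letter = mk↔ₛ′ (λ { (inj₁ k) → bar k ; (inj₂ k) → plain k }) (λ { (bar k) → inj₁ k ; (plain k) → inj₂ k })
                   (λ { (bar _) → refl ; (plain _) → refl }) (λ { (inj₁ _) → refl ; (inj₂ _) → refl })

  -- Barred and plain letters have the even and the odd ranks below 2n. Ranks now play the part that
  -- row indices play for ice.
  total-rank : ∀ n (g : ℕ → ℤ) → total (letters n) (g ∘ rank) ≡ rangeSum g (n ℕ.* 2)
  total-rank n g = trans (total-letters n (g ∘ rank)) (go n g)
    where
    go : ∀ n (g : ℕ → ℤ) → total (fins n) (λ k → g (2 ℕ.* toℕ k)) + total (fins n) (λ k → g (suc (2 ℕ.* toℕ k)))
                         ≡ rangeSum g (n ℕ.* 2)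
    go zero    g = refl
    go (suc n) g = begin
      total (fins (suc n)) (λ k → g (2 ℕ.* toℕ k)) + total (fins (suc n)) (λ k → g (suc (2 ℕ.* toℕ k)))
        ≡⟨ cong₂ _+_ (total-fins-suc n (λ k → g (2 ℕ.* toℕ k))) (total-fins-suc n (λ k → g (suc (2 ℕ.* toℕ k)))) ⟩
      (g 0 + total (fins n) (λ k → g (2 ℕ.* suc (toℕ k)))) + (g 1 + total (fins n) (λ k → g (suc (2 ℕ.* suc (toℕ k)))))
        ≡⟨ cong₂ (λ x y → (g 0 + x) + (g 1 + y))
             (total-cong (fins n) (λ k → cong g (ℕₚ.*-suc 2 (toℕ k))))
             (total-cong (fins n) (λ k → cong (g ∘ suc) (ℕₚ.*-suc 2 (toℕ k)))) ⟩
      (g 0 + total (fins n) (λ k → g (2 ℕ.+ 2 ℕ.* toℕ k))) + (g 1 + total (fins n) (λ k → g (3 ℕ.+ 2 ℕ.* toℕ k)))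
        ≡⟨ lemma (g 0) _ (g 1) (total (fins n) (λ k → g (3 ℕ.+ 2 ℕ.* toℕ k))) ⟩
      g 0 + (g 1 + (total (fins n) (λ k → g (2 ℕ.+ 2 ℕ.* toℕ k)) + total (fins n) (λ k → g (3 ℕ.+ 2 ℕ.* toℕ k))))
        ≡⟨ cong (λ s → g 0 + (g 1 + s)) (go n (λ a → g (2 ℕ.+ a))) ⟩
      rangeSum g (suc n ℕ.* 2) ∎
      where
      lemma : ∀ a b c d → (a + b) + (c + d) ≡ a + (c + (b + d))
      lemma = solve-∀

  -- 2 for a < r and 1 for a = r, so that differences in r are twice the weights
  -- of the trapezoidal rule.
  below-weight : ℕ → ℕ → ℤ
  below-weight zero    zero    = 1ℤ
  below-weight zero    (suc a) = 0ℤ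
  below-weight (suc r) zero    = + 2
  below-weight (suc r) (suc a) = below-weight r a

  -- For x < y the weight is 1 at both ends, 2 strictly between and 0 elsewhere. In the other cases
  -- it is signed, which keeps the summation formula uniform in x and y.
  trapezoid : ℕ → ℕ → ℕ → ℤ
  trapezoid x y z = below-weight y z - below-weight x z

  -- 2 G(0) + ... + 2 G(r - 1) + G(r) is the trapezoidal sum from 0 to r with G(0) counted once
  -- more. This surplus is the same for all r and cancels in `trapezoid`.
  rangeSum-below-weight : ∀ (G E : ℕ → ℤ) {m} r → r ℕ.< m → (∀ r → E (suc r) ≡ E r + (G r + G (suc r))) →
    rangeSum (λ a → below-weight r a * G a) m ≡ (E r - E 0) + G 0
  rangeSum-below-weight G E {suc m} zero    _         E-suc = begin
    1ℤ * G 0 + rangeSum (λ a → 0ℤ * G (suc a)) m   ≡⟨ cong (λ s → 1ℤ * G 0 + s) (zeros m (G ∘ suc)) ⟩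
    1ℤ * G 0 + 0ℤ                                  ≡⟨ lemma (G 0) (E 0) ⟩
    (E 0 - E 0) + G 0                              ∎
    where
    zeros : ∀ m G → rangeSum (λ a → 0ℤ * G a) m ≡ 0ℤ
    zeros zero    G = refl
    zeros (suc m) G = trans (ℤₚ.+-identityˡ _) (zeros m (G ∘ suc))
    lemma : ∀ g e → 1ℤ * g + 0ℤ ≡ (e - e) + g
    lemma = solve-∀
  rangeSum-below-weight G E {suc m} (suc r) (ℕ.s≤s r<m) E-suc = begin
    + 2 * G 0 + rangeSum (λ a → below-weight r a * G (suc a)) m
      ≡⟨ cong (λ s → + 2 * G 0 + s) (rangeSum-below-weight (G ∘ suc) (E ∘ suc) r r<m (E-suc ∘ suc)) ⟩
    + 2 * G 0 + ((E (suc r) - E 1) + G 1)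
      ≡⟨ cong (λ e → + 2 * G 0 + ((E (suc r) - e) + G 1)) (E-suc 0) ⟩
    + 2 * G 0 + ((E (suc r) - (E 0 + (G 0 + G 1))) + G 1)
      ≡⟨ lemma (G 0) (G 1) (E 0) (E (suc r)) ⟩
    (E (suc r) - E 0) + G 0 ∎
    where
    lemma : ∀ g g′ e e′ → + 2 * g + ((e′ - (e + (g + g′))) + g′) ≡ (e′ - e) + g
    lemma = solve-∀

  rangeSum-minus : ∀ f g m → rangeSum (λ a → f a - g a) m ≡ rangeSum f m - rangeSum g m
  rangeSum-minus f g zero    = refl
  rangeSum-minus f g (suc m) = trans (cong (λ s → f 0 - g 0 + s) (rangeSum-minus (f ∘ suc) (g ∘ suc) m))
    (lemma (f 0) (g 0) (rangeSum (f ∘ suc) m) (rangeSum (g ∘ suc) m))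
    where
    lemma : ∀ a b c d → (a - b) + (c - d) ≡ (a + c) - (b + d)
    lemma = solve-∀

  rangeSum-trapezoid : ∀ (G E : ℕ → ℤ) {m} x y → x ℕ.< m → y ℕ.< m → (∀ r → E (suc r) ≡ E r + (G r + G (suc r))) →
    rangeSum (λ a → trapezoid x y a * G a) m ≡ E y - E x
  rangeSum-trapezoid G E {m} x y x<m y<m E-suc = begin
    rangeSum (λ a → trapezoid x y a * G a) m
      ≡⟨ rangeSum-cong m (λ a → distrib (below-weight y a) (below-weight x a) (G a)) ⟩
    rangeSum (λ a → below-weight y a * G a - below-weight x a * G a) m
      ≡⟨ rangeSum-minus (λ a → below-weight y a * G a) (λ a → below-weight x a * G a) m ⟩
    rangeSum (λ a → below-weight y a * G a) m - rangeSum (λ a → below-weight x a * G a) m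
      ≡⟨ cong₂ _-_ (rangeSum-below-weight G E y y<m E-suc) (rangeSum-below-weight G E x x<m E-suc) ⟩
    ((E y - E 0) + G 0) - ((E x - E 0) + G 0)
      ≡⟨ lemma (E y) (E x) (E 0) (G 0) ⟩
    E y - E x ∎
    where
    distrib : ∀ a b c → (a - b) * c ≡ a * c - b * c
    distrib = solve-∀
    lemma : ∀ a b c d → ((a - c) + d) - ((b - c) + d) ≡ a - b
    lemma = solve-∀

  rank< : ∀ {n} (x : Letter n) → rank x ℕ.< n ℕ.* 2
  rank< {n} (bar k)   = ℕₚ.<-trans (ℕₚ.n<1+n _) (rank< (plain k))
  rank< {n} (plain k) = subst (ℕ._≤ n ℕ.* 2) (trans (ℕₚ.*-comm (suc (toℕ k)) 2) (ℕₚ.*-suc 2 (toℕ k)))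
                              (ℕₚ.*-monoˡ-≤ 2 (Finₚ.toℕ<n k))

  module _ {N : ℕ} where

    interlacing : ∀ {m} → Vec (Letter N) (suc m) → Vec (Letter N) m → ℤ
    interlacing (x ∷ [])    []      = 1ℤ
    interlacing (x ∷ y ∷ d) (z ∷ s) = trapezoid (rank x) (rank y) (rank z) * interlacing (y ∷ d) s

    increasing : ∀ {m} → Vec (Letter N) m → ℤ
    increasing []          = 1ℤ
    increasing (x ∷ [])    = 1ℤ
    increasing (x ∷ y ∷ d) = (1ℤ when (rank x ℕ.<? rank y)) * increasing (y ∷ d)

    letterRows : ∀ k {m} → Vec (Letter N) m → List (Vec ℤ k)
    letterRows k []      = []
    letterRows k (x ∷ d) = basis k (rank x) ∷ letterRows k d

    letterIntegrals : ∀ k {m} → Vec (Letter N) m → List (Vec ℤ k)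
    letterIntegrals k []      = []
    letterIntegrals k (x ∷ d) = integral k (rank x) ∷ letterIntegrals k d

    letterRows-suc : ∀ k {m} (d : Vec (Letter N) m) → letterRows (suc k) d ≡ map (1ℤ ∷_) (letterIntegrals k d)
    letterRows-suc k []      = refl
    letterRows-suc k (x ∷ d) = cong (_ ∷_) (letterRows-suc k d)

    -- Each letter of `s` varies independently in its own interval, and additivity of `F` in the
    -- corresponding row turns the weights into a difference of integrals. Strictness of `s` is
    -- dealt with in `chainWeight-total`.
    interlacing-total : ∀ {k} {F : List (Vec ℤ k) → ℤ} → Alternating F → ∀ {m} x (d : Vec (Letter N) m) →
      total (vecs (letters N) m) (λ s → interlacing (x ∷ d) s * F (letterRows k s))
      ≡ F (differences (integral k (rank x)) (letterIntegrals k d))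
    interlacing-total {k} {F} A {zero}  x []      =
      trans (total-vecs-0 (letters N) (λ s → interlacing (x ∷ []) s * F (letterRows k s))) (ℤₚ.*-identityˡ (F []))
    interlacing-total {k} {F} A {suc m} x (y ∷ d) = begin
      total (vecs (letters N) (suc m)) (λ s → interlacing (x ∷ y ∷ d) s * F (letterRows k s))
        ≡⟨ total-vecs (letters N) m (λ s → interlacing (x ∷ y ∷ d) s * F (letterRows k s)) ⟩
      total (letters N) (λ z → total (vecs (letters N) m) (λ s → w z * interlacing (y ∷ d) s * F (basis k (rank z) ∷ letterRows k s)))
        ≡⟨ total-cong (letters N) (λ z → trans
             (total-cong (vecs (letters N) m) (λ s → ℤₚ.*-assoc (w z) (interlacing (y ∷ d) s) (F (basis k (rank z) ∷ letterRows k s))))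
             (trans (total-* (vecs (letters N) m) (w z) (λ s → interlacing (y ∷ d) s * F (basis k (rank z) ∷ letterRows k s)))
                    (cong (w z *_) (interlacing-total (fix-first A (basis k (rank z))) y d)))) ⟩
      total (letters N) (λ z → w z * F (basis k (rank z) ∷ ws))
        ≡⟨ total-rank N (λ a → trapezoid (rank x) (rank y) a * F (basis k a ∷ ws)) ⟩
      rangeSum (λ a → trapezoid (rank x) (rank y) a * F (basis k a ∷ ws)) (N ℕ.* 2)
        ≡⟨ rangeSum-trapezoid (λ a → F (basis k a ∷ ws)) (λ a → F (integral k a ∷ ws)) (rank x) (rank y) (rank< x) (rank< y)
             (λ r → trans (additive A [] (integral k r) _ ws) (cong (λ s → F (integral k r ∷ ws) + s) (additive A [] _ _ ws))) ⟩
      F (integral k (rank y) ∷ ws) - F (integral k (rank x) ∷ ws)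
        ≡⟨ subtractive A (integral k (rank y)) (integral k (rank x)) ws ⟨
      F ((integral k (rank y) ⊖ integral k (rank x)) ∷ ws) ∎
      where
      ws = differences (integral k (rank y)) (letterIntegrals k d)
      w : Letter N → ℤ
      w z = trapezoid (rank x) (rank y) (rank z)

  below-weight-self : ∀ r → below-weight r r ≡ 1ℤ
  below-weight-self zero    = refl
  below-weight-self (suc r) = below-weight-self r

  below-weight-< : ∀ {r a} → a ℕ.< r → below-weight r a ≡ + 2
  below-weight-< {suc r} {zero}  _           = refl
  below-weight-< {suc r} {suc a} (ℕ.s≤s a<r) = below-weight-< a<r

  below-weight-> : ∀ {r a} → r ℕ.< a → below-weight r a ≡ 0ℤ
  below-weight-> {zero}  {suc a} _           = refl
  below-weight-> {suc r} {suc a} (ℕ.s≤s r<a) = below-weight-> r<a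

  trapezoid-left : ∀ {x y} → x ℕ.< y → trapezoid x y x ≡ 1ℤ
  trapezoid-left {x} x<y = cong₂ _-_ (below-weight-< x<y) (below-weight-self x)

  trapezoid-right : ∀ {x y} → x ℕ.< y → trapezoid x y y ≡ 1ℤ
  trapezoid-right {x} {y} x<y = cong₂ _-_ (below-weight-self y) (below-weight-> x<y)

  trapezoid-interior : ∀ {x y z} → x ℕ.< z → z ℕ.< y → trapezoid x y z ≡ + 2
  trapezoid-interior x<z z<y = cong₂ _-_ (below-weight-< z<y) (below-weight-> x<z)

  trapezoid-bounds : ∀ {x y z} → x ℕ.< y → trapezoid x y z ≢ 0ℤ → x ℕ.≤ z × z ℕ.≤ y
  trapezoid-bounds {x} {y} {z} x<y ≢0 with z ℕ.<? x | y ℕ.<? z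
  ... | yes z<x | _       = contradiction (cong₂ _-_ (below-weight-< (ℕₚ.<-trans z<x x<y)) (below-weight-< z<x)) ≢0
  ... | no  _   | yes y<z = contradiction (cong₂ _-_ (below-weight-> y<z) (below-weight-> (ℕₚ.<-trans x<y y<z))) ≢0
  ... | no z≮x  | no y≮z  = ℕₚ.≮⇒≥ z≮x , ℕₚ.≮⇒≥ y≮z

  module _ {N : ℕ} where

    increasing-∷ : ∀ {m} x y (d : Vec (Letter N) m) → increasing (x ∷ y ∷ d) ≢ 0ℤ → x ≺ y × increasing (y ∷ d) ≢ 0ℤ
    increasing-∷ x y d ≢0 with rank x ℕ.<? rank y
    ... | yes x≺y = x≺y , nonzeroʳ (1ℤ when (rank x ℕ.<? rank y)) ≢0
    ... | no x⊀y  = contradiction (cong (_* increasing (y ∷ d)) (when-no (rank x ℕ.<? rank y) x⊀y)) ≢0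

    increasing-≺ : ∀ {m} x y (d : Vec (Letter N) m) → x ≺ y → increasing (x ∷ y ∷ d) ≡ increasing (y ∷ d)
    increasing-≺ x y d x≺y = trans (cong (_* increasing (y ∷ d)) (when-yes (rank x ℕ.<? rank y) x≺y))
                                           (ℤₚ.*-identityˡ (increasing (y ∷ d)))

    increasing-01 : ∀ {m} (d : Vec (Letter N) m) → ZeroOrOne (increasing d)
    increasing-01 []          = inj₂ refl
    increasing-01 (x ∷ [])    = inj₂ refl
    increasing-01 (x ∷ y ∷ d) with increasing-01 (y ∷ d) | rank x ℕ.<? rank y
    ... | ih | yes x≺y = subst ZeroOrOne (sym (increasing-≺ x y d x≺y)) ih
    ... | _  | no  x⊀y = inj₁ (cong (_* increasing (y ∷ d)) (when-no (rank x ℕ.<? rank y) x⊀y))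

    -- A vector interlacing an increasing one can only fail to increase by
    -- repeating an entry, and then the determinant vanishes.
    interlacing-degenerate : ∀ {k} {F : List (Vec ℤ k) → ℤ} → Alternating F → ∀ {m}
      (d : Vec (Letter N) (suc m)) (s : Vec (Letter N) m) → increasing d ≢ 0ℤ → increasing s ≡ 0ℤ →
      interlacing d s ≢ 0ℤ → F (letterRows k s) ≡ 0ℤ
    interlacing-degenerate A d [] _ () _
    interlacing-degenerate A d (z ∷ []) _ () _
    interlacing-degenerate {k} {F} A (x ∷ y ∷ w ∷ d) (z ∷ z′ ∷ s) d≢0 s≡0 i≢0 = by-cases (rank z ℕ.<? rank z′)
      (interlacing-degenerate (fix-first A (basis k (rank z))) (y ∷ w ∷ d) (z′ ∷ s))
      where
      x≺y   = proj₁ (increasing-∷ x y (w ∷ d) d≢0)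
      yd≢0  = proj₂ (increasing-∷ x y (w ∷ d) d≢0)
      y≺w   = proj₁ (increasing-∷ y w d yd≢0)
      rest≢0 = nonzeroʳ (trapezoid (rank x) (rank y) (rank z)) i≢0
      z≼y   = proj₂ (trapezoid-bounds x≺y (nonzeroˡ (trapezoid (rank x) (rank y) (rank z)) i≢0))
      y≼z′  = proj₁ (trapezoid-bounds y≺w (nonzeroˡ (trapezoid (rank y) (rank w) (rank z′)) rest≢0))
      by-cases : Dec (z ≺ z′) →
        (increasing (y ∷ w ∷ d) ≢ 0ℤ → increasing (z′ ∷ s) ≡ 0ℤ → interlacing (y ∷ w ∷ d) (z′ ∷ s) ≢ 0ℤ →
          F (letterRows k (z ∷ z′ ∷ s)) ≡ 0ℤ) →
        F (letterRows k (z ∷ z′ ∷ s)) ≡ 0ℤ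
      by-cases (yes z≺z′) recurse = recurse yd≢0 (trans (sym (increasing-≺ z z′ s z≺z′)) s≡0) rest≢0
      by-cases (no z⊀z′)  _       = trans
        (cong (λ r → F (basis k r ∷ letterRows k (z′ ∷ s))) (ℕₚ.≤-antisym (ℕₚ.≤-trans z≼y y≼z′) (ℕₚ.≮⇒≥ z⊀z′)))
        (repeated A [] (basis k (rank z′)) (letterRows k s))

    -- Separated from `chainWeight` so that the first diagonal can be constrained by its levels
    -- instead of by `increasing`.
    link : ∀ {m} → Vec (Letter N) (suc m) → Triangle (Letter N) m → ℤ
    link d []       = 1ℤ
    link d (d′ ∷ D) = interlacing d d′

    chainWeight : ∀ {m} → Triangle (Letter N) m → ℤ
    chainWeight []      = 1ℤ
    chainWeight (d ∷ D) = increasing d * (link d D * chainWeight D)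

    chainWeight-total : ∀ {m} (d : Vec (Letter N) (suc m)) → increasing d ≢ 0ℤ →
      total (triangles (letters N) m) (λ D → link d D * chainWeight D) ≡ det (suc m) (letterRows (suc m) d)
    chainWeight-total {zero}  (x ∷ []) _ = total-triangles-0 (letters N) (λ D → link (x ∷ []) D * chainWeight D)
    chainWeight-total {suc m} d@(x ∷ d₁) d≢0 = begin
      total (triangles L (suc m)) (λ D → link d D * chainWeight D)
        ≡⟨ total-triangles L m (λ D → link d D * chainWeight D) ⟩
      total V (λ s → total T (λ D → interlacing d s * (increasing s * (link s D * chainWeight D))))
        ≡⟨ total-cong V (λ s → trans (total-* T (interlacing d s) (λ D → increasing s * (link s D * chainWeight D)))
             (cong (interlacing d s *_) (total-* T (increasing s) (λ D → link s D * chainWeight D)))) ⟩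
      total V (λ s → interlacing d s * (increasing s * total T (λ D → link s D * chainWeight D)))
        -- The factor `increasing s` is absorbed: an interlacing `s` that does not increase repeats
        -- a letter, so its determinant is 0 anyway.
        ≡⟨ total-cong V (λ s → strictness s (increasing-01 s)) ⟩
      total V (λ s → interlacing d s * det (suc m) (letterRows (suc m) s))
        ≡⟨ interlacing-total (det-alternating (suc m)) x d₁ ⟩
      det (suc m) (differences (integral (suc m) (rank x)) (letterIntegrals (suc m) d₁))
        ≡⟨ ℤₚ.*-identityˡ _ ⟨
      1ℤ * det (suc m) (differences (integral (suc m) (rank x)) (letterIntegrals (suc m) d₁))
        ≡⟨ contract-constant (det-alternating (suc m)) 1ℤ (integral (suc m) (rank x)) (letterIntegrals (suc m) d₁) ⟨
      contract (det (suc m)) (map (1ℤ ∷_) (letterIntegrals (suc m) d))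
        ≡⟨ cong (contract (det (suc m))) (letterRows-suc (suc m) d) ⟨
      det (suc (suc m)) (letterRows (suc (suc m)) d) ∎
      where
      L = letters N
      V = vecs L (suc m)
      T = triangles L m
      strictness : ∀ s → ZeroOrOne (increasing s) →
        interlacing d s * (increasing s * total T (λ D → link s D * chainWeight D))
        ≡ interlacing d s * det (suc m) (letterRows (suc m) s)
      strictness s (inj₂ ≡1) = cong (interlacing d s *_) (trans
        (cong₂ _*_ ≡1 (chainWeight-total s (λ ≡0 → contradiction (trans (sym ≡1) ≡0) λ ())))
        (ℤₚ.*-identityˡ (det (suc m) (letterRows (suc m) s))))
      strictness s (inj₁ ≡0) with interlacing d s ℤ.≟ 0ℤ
      ... | yes i≡0 = trans (cong (_* (increasing s * total T (λ D → link s D * chainWeight D))) i≡0)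
                            (sym (cong (_* det (suc m) (letterRows (suc m) s)) i≡0))
      ... | no  i≢0 = cong (interlacing d s *_) (trans
        (cong (_* total T (λ D → link s D * chainWeight D)) ≡0)
        (sym (interlacing-degenerate (det-alternating (suc m)) d s d≢0 ≡0 i≢0)))

  total-single : {A : Set} (F : Finite A) (a : A) (f : A → ℤ) → (∀ x → x ≢ a → f x ≡ 0ℤ) → total F f ≡ f a
  total-single F a f off = go (elements-unique F) (Finite.complete F a)
    where
    zeros : ∀ xs → All (a ≢_) xs → sumBy f xs ≡ 0ℤ
    zeros []       []         = refl
    zeros (x ∷ xs) (a≢x ∷ ps) = cong₂ _+_ (off x (λ x≡a → a≢x (sym x≡a))) (zeros xs ps)
    go : ∀ {xs} → Unique xs → a ∈ xs → sumBy f xs ≡ f a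
    go (a∉ ∷ xs!) (here refl) = trans (cong (λ s → f a + s) (zeros _ a∉)) (ℤₚ.+-identityʳ (f a))
    go (x∉ ∷ xs!) (there a∈)  = trans (cong₂ _+_ (off _ (All.lookup x∉ a∈)) (go xs! a∈)) (ℤₚ.+-identityˡ (f a))

  -- The main diagonal and the total over triangles of letters

  levelIndicator : ∀ {N} → Fin N → Letter N → ℤ
  levelIndicator k (bar j)   = 1ℤ when (j Fin.≟ k)
  levelIndicator k (plain j) = 1ℤ when (j Fin.≟ k)

  levelIndicator-total : ∀ {N} (k : Fin N) (f : Letter N → ℤ) →
    total (letters N) (λ x → levelIndicator k x * f x) ≡ f (bar k) + f (plain k)
  levelIndicator-total {N} k f = trans (total-letters N _) (cong₂ _+_ (pick (f ∘ bar)) (pick (f ∘ plain)))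
    where
    pick : ∀ g → total (fins N) (λ j → (1ℤ when (j Fin.≟ k)) * g j) ≡ g k
    pick g = trans (total-single (fins N) k _ off) on
      where
      off : ∀ j → j ≢ k → (1ℤ when (j Fin.≟ k)) * g j ≡ 0ℤ
      off j j≢k with j Fin.≟ k
      ... | yes j≡k = contradiction j≡k j≢k
      ... | no  _   = refl
      on : (1ℤ when (k Fin.≟ k)) * g k ≡ g k
      on with k Fin.≟ k
      ... | yes _  = ℤₚ.*-identityˡ (g k)
      ... | no k≢k = contradiction refl k≢k

  levelsIndicator : ∀ {N m} → (Fin m → Fin N) → Vec (Letter N) m → ℤ
  levelsIndicator φ []      = 1ℤ
  levelsIndicator φ (x ∷ d) = levelIndicator (φ zero) x * levelsIndicator (φ ∘ suc) d

  -- The two letters of a level have consecutive ranks, so additivity merges their rows into an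
  -- average. The offset `a` serves the induction: the tail of `d` begins at a higher level of the
  -- same alphabet.
  levelsIndicator-total : ∀ {k N} {F : List (Vec ℤ k) → ℤ} → Alternating F → ∀ {m} a (φ : Fin m → Fin N) →
    (∀ i → toℕ (φ i) ≡ a ℕ.+ toℕ i) →
    total (vecs (letters N) m) (λ d → levelsIndicator φ d * F (letterRows k d))
    ≡ F (everyOther (average (basis k)) (2 ℕ.* a) m)
  levelsIndicator-total {k} {N} {F} A {zero}  a φ φ≡ = trans
    (total-vecs-0 (letters N) (λ d → levelsIndicator φ d * F (letterRows k d))) (ℤₚ.*-identityˡ (F []))
  levelsIndicator-total {k} {N} {F} A {suc m} a φ φ≡ = begin
    total (vecs L (suc m)) (λ d → levelsIndicator φ d * F (letterRows k d))
      ≡⟨ total-vecs L m (λ d → levelsIndicator φ d * F (letterRows k d)) ⟩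
    total L (λ x → total (vecs L m) (λ d → levelIndicator (φ zero) x * levelsIndicator (φ ∘ suc) d * F (basis k (rank x) ∷ letterRows k d)))
      ≡⟨ total-cong L (λ x → trans
           (total-cong (vecs L m) (λ d → ℤₚ.*-assoc (levelIndicator (φ zero) x) (levelsIndicator (φ ∘ suc) d) (F (basis k (rank x) ∷ letterRows k d))))
           (trans (total-* (vecs L m) (levelIndicator (φ zero) x) (λ d → levelsIndicator (φ ∘ suc) d * F (basis k (rank x) ∷ letterRows k d)))
                  (cong (levelIndicator (φ zero) x *_)
                    (levelsIndicator-total (fix-first A (basis k (rank x))) (suc a) (φ ∘ suc)
                      (λ i → trans (φ≡ (suc i)) (ℕₚ.+-suc a (toℕ i))))))) ⟩
    total L (λ x → levelIndicator (φ zero) x * F (basis k (rank x) ∷ ws))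
      ≡⟨ levelIndicator-total (φ zero) (λ x → F (basis k (rank x) ∷ ws)) ⟩
    F (basis k (2 ℕ.* toℕ (φ zero)) ∷ ws) + F (basis k (suc (2 ℕ.* toℕ (φ zero))) ∷ ws)
      ≡⟨ additive A [] (basis k (2 ℕ.* toℕ (φ zero))) (basis k (suc (2 ℕ.* toℕ (φ zero)))) ws ⟨
    F (average (basis k) (2 ℕ.* toℕ (φ zero)) ∷ ws)
      ≡⟨ cong₂ (λ b c → F (average (basis k) (2 ℕ.* b) ∷ everyOther (average (basis k)) c m))
           (trans (φ≡ zero) (ℕₚ.+-identityʳ a)) (ℕₚ.*-suc 2 a) ⟩
    F (everyOther (average (basis k)) (2 ℕ.* a) (suc m)) ∎
    where
    L  = letters N
    ws = everyOther (average (basis k)) (2 ℕ.* suc a) m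

  diagonalsWeight : ∀ {N m} → (Fin m → Fin N) → Triangle (Letter N) m → ℤ
  diagonalsWeight φ []      = 1ℤ
  diagonalsWeight φ (d ∷ D) = levelsIndicator φ d * (link d D * chainWeight D)

  levelIndicator-≢0 : ∀ {N} (k : Fin N) x → levelIndicator k x ≢ 0ℤ → x ≡ plain k ⊎ x ≡ bar k
  levelIndicator-≢0 k (bar j) ≢0 with j Fin.≟ k
  ... | yes refl = inj₂ refl
  ... | no  _    = contradiction refl ≢0
  levelIndicator-≢0 k (plain j) ≢0 with j Fin.≟ k
  ... | yes refl = inj₁ refl
  ... | no  _    = contradiction refl ≢0

  level-≺ : ∀ {N} {k l : Fin N} {x y} → toℕ k ℕ.< toℕ l → x ≡ plain k ⊎ x ≡ bar k → y ≡ plain l ⊎ y ≡ bar l → x ≺ y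
  level-≺ {k = k} {l} {x} {y} k<l x∈ y∈ = ℕₚ.≤-trans (ℕ.s≤s (upper x∈)) (ℕₚ.≤-trans
    (subst (ℕ._≤ 2 ℕ.* toℕ l) (ℕₚ.*-suc 2 (toℕ k)) (ℕₚ.*-monoʳ-≤ 2 k<l)) (lower y∈))
    where
    upper : x ≡ plain k ⊎ x ≡ bar k → rank x ℕ.≤ suc (2 ℕ.* toℕ k)
    upper (inj₁ refl) = ℕₚ.≤-refl
    upper (inj₂ refl) = ℕₚ.n≤1+n _
    lower : y ≡ plain l ⊎ y ≡ bar l → 2 ℕ.* toℕ l ℕ.≤ rank y
    lower (inj₁ refl) = ℕₚ.n≤1+n _
    lower (inj₂ refl) = ℕₚ.≤-refl

  levels-increasing : ∀ {N m} (φ : Fin m → Fin N) → (∀ i j → toℕ i ℕ.< toℕ j → toℕ (φ i) ℕ.< toℕ (φ j)) →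
    ∀ d → levelsIndicator φ d ≢ 0ℤ → increasing d ≡ 1ℤ
  levels-increasing φ mono []          _  = refl
  levels-increasing φ mono (x ∷ [])    _  = refl
  levels-increasing φ mono (x ∷ y ∷ d) ≢0
    with levels-increasing (φ ∘ suc) (λ i j i<j → mono (suc i) (suc j) (ℕ.s≤s i<j)) (y ∷ d)
           (nonzeroʳ (levelIndicator (φ zero) x) ≢0)
       | rank x ℕ.<? rank y
  ... | ih | yes x≺y = trans (increasing-≺ x y d x≺y) ih
  ... | _  | no x⊀y = contradiction (level-≺ (mono zero (suc zero) (ℕ.s≤s ℕ.z≤n))
    (levelIndicator-≢0 (φ zero) x (nonzeroˡ (levelIndicator (φ zero) x) ≢0))
    (levelIndicator-≢0 (φ (suc zero)) y (nonzeroˡ (levelIndicator (φ (suc zero)) y) (nonzeroʳ (levelIndicator (φ zero) x) ≢0)))) x⊀y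

  diagonalsWeight-total : ∀ n → total (triangles (letters n) n) (diagonalsWeight id) ≡ + (2 ℕ.^ (n ℕ.^ 2))
  diagonalsWeight-total zero    = total-triangles-0 (letters zero) (diagonalsWeight id)
  diagonalsWeight-total n@(suc m) = begin
    total (triangles L n) (diagonalsWeight id)
      ≡⟨ total-triangles L m (diagonalsWeight id) ⟩
    total V (λ d → total T (λ D → levelsIndicator id d * (link d D * chainWeight D)))
      ≡⟨ total-cong V (λ d → trans (total-* T (levelsIndicator id d) (λ D → link d D * chainWeight D)) (evaluate d)) ⟩
    total V (λ d → levelsIndicator id d * det n (letterRows n d))
      ≡⟨ levelsIndicator-total (det-alternating n) 0 id (λ _ → refl) ⟩
    det n (everyOther (average (basis n)) 0 n)
      ≡⟨ det-averages n 1 0 ⟩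
    + (2 ℕ.^ (n ℕ.* 1 ℕ.+ n ℕ.* (n ℕ.∸ 1)))
      ≡⟨ cong (λ p → + (2 ℕ.^ p)) (n*1+n*[n∸1]≡n^2 n) ⟩
    + (2 ℕ.^ (n ℕ.^ 2)) ∎
    where
    L = letters n
    V = vecs L n
    T = triangles L m
    evaluate : ∀ d → levelsIndicator id d * total T (λ D → link d D * chainWeight D)
                   ≡ levelsIndicator id d * det n (letterRows n d)
    evaluate d with levelsIndicator id d ℤ.≟ 0ℤ
    ... | yes ≡0 = trans (cong (_* total T (λ D → link d D * chainWeight D)) ≡0) (sym (cong (_* det n (letterRows n d)) ≡0))
    ... | no  ≢0 = cong (levelsIndicator id d *_) (chainWeight-total d (λ inc≡0 →
      contradiction (trans (sym (levels-increasing id (λ _ _ i<j → i<j) d ≢0)) inc≡0) λ ()))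

  -- Shifted tableaux as monotone triangles of diagonals

  open Box

  -- Deleting the main diagonal of a shifted staircase leaves a smaller one, moved one column to the
  -- right. `glue` restores the diagonal.
  glue : {A : Set} → ∀ {m} → Vec A (suc m) → Triangle A m → Triangle A (suc m)
  glue (x ∷ [])      []      = (x ∷ []) ∷ []
  glue (x ∷ y ∷ d) (r ∷ T) = (x ∷ r) ∷ glue (y ∷ d) T

  peel : {A : Set} → ∀ {m} → Triangle A (suc m) → Vec A (suc m) × Triangle A m
  peel {m = zero}  ((x ∷ []) ∷ []) = x ∷ [] , []
  peel {m = suc m} ((x ∷ r) ∷ T)   = x ∷ proj₁ (peel T) , r ∷ proj₂ (peel T)

  glue-peel : {A : Set} → ∀ {m} (T : Triangle A (suc m)) → glue (proj₁ (peel T)) (proj₂ (peel T)) ≡ T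
  glue-peel {m = zero}  ((x ∷ []) ∷ []) = refl
  glue-peel {m = suc m} ((x ∷ r) ∷ T) with peel T | glue-peel T
  ... | y ∷ d , T′ | eq = cong ((x ∷ r) ∷_) eq

  peel-glue : {A : Set} → ∀ {m} (d : Vec A (suc m)) (T : Triangle A m) → peel (glue d T) ≡ (d , T)
  peel-glue (x ∷ [])    []      = refl
  peel-glue (x ∷ y ∷ d) (r ∷ T) = cong (λ (d , T) → x ∷ d , r ∷ T) (peel-glue (y ∷ d) T)

  -- `Triangle` is read in two ways: as the rows of a filling, and as its diagonals from the main
  -- one outwards.
  fromDiagonals : {A : Set} → ∀ {m} → Triangle A m → Triangle A m
  fromDiagonals []      = []
  fromDiagonals (d ∷ D) = glue d (fromDiagonals D)

  toDiagonals : {A : Set} → ∀ {m} → Triangle A m → Triangle A m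
  toDiagonals {m = zero}  []  = []
  toDiagonals {m = suc m} T = proj₁ (peel T) ∷ toDiagonals (proj₂ (peel T))

  from∘toDiagonals : {A : Set} → ∀ {m} (T : Triangle A m) → fromDiagonals (toDiagonals T) ≡ T
  from∘toDiagonals {m = zero}  [] = refl
  from∘toDiagonals {m = suc m} T = trans (cong (glue (proj₁ (peel T))) (from∘toDiagonals (proj₂ (peel T)))) (glue-peel T)

  to∘fromDiagonals : {A : Set} → ∀ {m} (D : Triangle A m) → toDiagonals (fromDiagonals D) ≡ D
  to∘fromDiagonals []      = refl
  to∘fromDiagonals (d ∷ D) = trans (cong (λ (e , T) → e ∷ toDiagonals T) (peel-glue d (fromDiagonals D)))
                                   (cong (d ∷_) (to∘fromDiagonals D))

  diagonals↔ : {A : Set} → ∀ {m} → Triangle A m ↔ Triangle A m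
  diagonals↔ = mk↔ₛ′ fromDiagonals toDiagonals from∘toDiagonals to∘fromDiagonals

  diagonalBox : ∀ {m} → Fin m → Box m
  diagonalBox i = box i i ℕₚ.≤-refl

  shift : ∀ {m} → Box m → Box (suc m)
  shift (box i j i≤j) = box (inject₁ i) (suc j) (lemma i≤j)
    where
    lemma : i Fin.≤ j → inject₁ i Fin.≤ suc j
    lemma i≤j = ℕₚ.≤-trans (ℕₚ.≤-reflexive (Finₚ.toℕ-inject₁ i)) (ℕₚ.m≤n⇒m≤1+n i≤j)

  entry-diagonal : {A : Set} → ∀ {m} (d : Vec A (suc m)) (T : Triangle A m) i → entry (glue d T) (diagonalBox i) ≡ lookup d i
  entry-diagonal (x ∷ [])    []      zero    = refl
  entry-diagonal (x ∷ y ∷ d) (r ∷ T) zero    = refl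
  entry-diagonal (x ∷ y ∷ d) (r ∷ T) (suc i) = entry-diagonal (y ∷ d) T i

  entry-shift : {A : Set} → ∀ {m} (d : Vec A (suc m)) (T : Triangle A m) b → entry (glue d T) (shift b) ≡ entry T b
  entry-shift (x ∷ y ∷ d) (r ∷ T) (box zero    j       _)  = refl
  entry-shift (x ∷ y ∷ d) (r ∷ T) (box (suc i) (suc j) le) = entry-shift (y ∷ d) T (box i j (ℕ.s≤s⁻¹ le))

  row≤col! : ∀ {m} (b : Box m) → toℕ (row b) ℕ.≤ toℕ (col b)
  row≤col! (box i j le) = recompute (i Fin.≤? j) le

  data BoxView {m} : Box (suc m) → Set where
    onDiagonal  : ∀ i → BoxView (diagonalBox i)
    offDiagonal : ∀ b → BoxView (shift b)

  boxView : ∀ {m} (b : Box (suc m)) → BoxView b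
  boxView         (box zero    zero          _)  = onDiagonal zero
  boxView {suc m} (box zero    (suc j)       _)  = offDiagonal (box zero j ℕ.z≤n)
  -- Moving a box along its diagonal preserves whether it is on the main diagonal.
  boxView {suc m} (box (suc i) (suc j) le) = lift (boxView (box i j (ℕ.s≤s⁻¹ le)))
    where
    lift : ∀ {b} → BoxView b → BoxView (box (suc (row b)) (suc (col b)) (ℕ.s≤s (row≤col! b)))
    lift (onDiagonal i)             = onDiagonal (suc i)
    lift (offDiagonal (box i j le)) = offDiagonal (box (suc i) (suc j) (ℕ.s≤s le))

  box-ext : ∀ {m} {b b′ : Box m} → row b ≡ row b′ → col b ≡ col b′ → b ≡ b′
  box-ext {b = box i j _} {box .i .j _} refl refl = refl

  shift-injective : ∀ {m} {b b′ : Box m} → shift b ≡ shift b′ → b ≡ b′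
  shift-injective eq = box-ext (Finₚ.inject₁-injective (cong row eq)) (Finₚ.suc-injective (cong col eq))

  diagonal≢shift : ∀ {m} i (b : Box m) → diagonalBox i ≢ shift b
  diagonal≢shift i b eq = ℕₚ.<⇒≢ (ℕ.s≤s (row≤col! b))
    (trans (sym (Finₚ.toℕ-inject₁ (row b))) (cong toℕ (trans (sym (cong row eq)) (cong col eq))))

  -- `boxes` is built by rows, while the argument on tableaux removes diagonals; this passes from
  -- one recursion to the other.
  total-boxes : ∀ m (f : Box (suc m) → ℤ) →
    total (boxes (suc m)) f ≡ total (fins (suc m)) (f ∘ diagonalBox) ℤ.+ total (boxes m) (f ∘ shift)
  total-boxes m f = trans
    (sym (total-inverse (fins (suc m) ⊎-finite boxes m) (boxes (suc m)) split f))
    (total-⊎ (fins (suc m)) (boxes m) (f ∘ to))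
    where
    to : Fin (suc m) ⊎ Box m → Box (suc m)
    to (inj₁ i) = diagonalBox i
    to (inj₂ b) = shift b
    from : ∀ {b} → BoxView b → Fin (suc m) ⊎ Box m
    from (onDiagonal i)  = inj₁ i
    from (offDiagonal b) = inj₂ b
    to∘from : ∀ {b} (v : BoxView b) → to (from v) ≡ b
    to∘from (onDiagonal i)  = refl
    to∘from (offDiagonal b) = refl
    to-injective : ∀ {x y} → to x ≡ to y → x ≡ y
    to-injective {inj₁ i} {inj₁ .i} refl = refl
    to-injective {inj₂ b} {inj₂ b′} eq   = cong inj₂ (shift-injective eq)
    to-injective {inj₁ i} {inj₂ b}  eq   = contradiction eq (diagonal≢shift i b)
    to-injective {inj₂ b} {inj₁ i}  eq   = contradiction (sym eq) (diagonal≢shift i b)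
    split : (Fin (suc m) ⊎ Box m) ↔ Box (suc m)
    split = mk↔ₛ′ to (λ b → from (boxView b)) (λ b → to∘from (boxView b))
                  (λ x → to-injective (to∘from (boxView (to x))))

  module _ {m} {b b′ : Box m} where

    RightOf-shift : RightOf b b′ → RightOf (shift b) (shift b′)
    RightOf-shift (row≡ , col≡) = cong inject₁ row≡ , cong suc col≡

    RightOf-unshift : RightOf (shift b) (shift b′) → RightOf b b′
    RightOf-unshift (row≡ , col≡) = Finₚ.inject₁-injective row≡ , ℕₚ.suc-injective col≡

    Below-shift : Below b b′ → Below (shift b) (shift b′)
    Below-shift (row≡ , col≡) =
      trans (Finₚ.toℕ-inject₁ (row b′)) (trans row≡ (cong suc (sym (Finₚ.toℕ-inject₁ (row b))))) , cong suc col≡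

    Below-unshift : Below (shift b) (shift b′) → Below b b′
    Below-unshift (row≡ , col≡) =
      trans (sym (Finₚ.toℕ-inject₁ (row b′))) (trans row≡ (cong suc (Finₚ.toℕ-inject₁ (row b)))) , Finₚ.suc-injective col≡

    Diagonal-shift : Diagonal b b′ → Diagonal (shift b) (shift b′)
    Diagonal-shift (row≡ , col≡) =
      trans (Finₚ.toℕ-inject₁ (row b′)) (trans row≡ (cong suc (sym (Finₚ.toℕ-inject₁ (row b))))) , cong suc col≡

    Diagonal-unshift : Diagonal (shift b) (shift b′) → Diagonal b b′
    Diagonal-unshift (row≡ , col≡) =
      trans (sym (Finₚ.toℕ-inject₁ (row b′))) (trans row≡ (cong suc (Finₚ.toℕ-inject₁ (row b)))) , ℕₚ.suc-injective col≡

  1+n≰n : ∀ {m n} → m ≡ suc n → ¬ m ℕ.≤ n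
  1+n≰n refl = ℕₚ.1+n≰n

  toℕ-row-shift : ∀ {m} (b : Box m) → toℕ (row (shift b)) ≡ toℕ (row b)
  toℕ-row-shift b = Finₚ.toℕ-inject₁ (row b)

  row<col-shift : ∀ {m} (b : Box m) → toℕ (row (shift b)) ℕ.< toℕ (col (shift b))
  row<col-shift b = ℕ.s≤s (ℕₚ.≤-trans (ℕₚ.≤-reflexive (toℕ-row-shift b)) (row≤col! b))

  -- A box of the main diagonal has no neighbour to its left or below. Hence a horizontal adjacency
  -- meeting that diagonal leaves it, a vertical one arrives in it, and both involve the second
  -- diagonal: these are the two inequalities of `Interlaced`.
  data RightView {m} : Box (suc m) → Box (suc m) → Set where
    leaving : ∀ i → RightView (diagonalBox (inject₁ i)) (shift (diagonalBox i))
    shifted : ∀ {b b′} → RightOf b b′ → RightView (shift b) (shift b′)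

  rightView : ∀ {m} {b b′ : Box (suc m)} → RightOf b b′ → RightView b b′
  rightView {b = b} {b′} r = go (boxView b) (boxView b′) r
    where
    go : ∀ {b b′} → BoxView b → BoxView b′ → RightOf b b′ → RightView b b′
    go (onDiagonal i)  (onDiagonal j)  (refl , col≡) = contradiction ℕₚ.≤-refl (1+n≰n col≡)
    go (offDiagonal b) (onDiagonal j)  (refl , col≡) =
      contradiction (ℕₚ.≤-trans (ℕₚ.≤-trans (ℕₚ.≤-reflexive (toℕ-row-shift b)) (row≤col! b)) (ℕₚ.n≤1+n _)) (1+n≰n col≡)
    go (offDiagonal b) (offDiagonal c) r             = shifted {b = b} {c} (RightOf-unshift {b = b} {c} r)
    go (onDiagonal _)  (offDiagonal b) (refl , col≡) =
      subst (λ c → RightView (diagonalBox (inject₁ (row b))) (shift c)) (box-ext {b = diagonalBox (row b)} {b} refl eq) (leaving (row b))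
      where
      eq : row b ≡ col b
      eq = Finₚ.toℕ-injective (sym (trans (ℕₚ.suc-injective col≡) (toℕ-row-shift b)))

  data BelowView {m} : Box (suc m) → Box (suc m) → Set where
    arriving : ∀ i → BelowView (shift (diagonalBox i)) (diagonalBox (suc i))
    shifted  : ∀ {b b′} → Below b b′ → BelowView (shift b) (shift b′)

  belowView : ∀ {m} {b b′ : Box (suc m)} → Below b b′ → BelowView b b′
  belowView {b = b} {b′} r = go (boxView b) (boxView b′) r
    where
    go : ∀ {b b′} → BoxView b → BoxView b′ → Below b b′ → BelowView b b′
    go (onDiagonal i)  (onDiagonal j)  (row≡ , refl) = contradiction ℕₚ.≤-refl (1+n≰n row≡)
    go (onDiagonal _)  (offDiagonal b) (row≡ , refl) =
      contradiction (ℕₚ.<⇒≤ (row<col-shift b)) (1+n≰n row≡)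
    go (offDiagonal b) (offDiagonal c) r             = shifted {b = b} {c} (Below-unshift {b = b} {c} r)
    go (offDiagonal b) (onDiagonal _)  (row≡ , refl) =
      subst (λ c → BelowView (shift c) (diagonalBox (suc (col b)))) (box-ext {b = diagonalBox (col b)} {b} (sym eq) refl) (arriving (col b))
      where
      eq : row b ≡ col b
      eq = Finₚ.toℕ-injective (sym (trans (ℕₚ.suc-injective row≡) (toℕ-row-shift b)))

  data DiagonalView {m} : Box (suc m) → Box (suc m) → Set where
    along   : ∀ i j → toℕ j ≡ suc (toℕ i) → DiagonalView (diagonalBox i) (diagonalBox j)
    shifted : ∀ {b b′} → Diagonal b b′ → DiagonalView (shift b) (shift b′)

  diagonalView : ∀ {m} {b b′ : Box (suc m)} → Diagonal b b′ → DiagonalView b b′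
  diagonalView {b = b} {b′} r = go (boxView b) (boxView b′) r
    where
    go : ∀ {b b′} → BoxView b → BoxView b′ → Diagonal b b′ → DiagonalView b b′
    go (onDiagonal i)  (onDiagonal j)  (row≡ , _)    = along i j row≡
    go (onDiagonal i)  (offDiagonal b) (row≡ , col≡) =
      contradiction (trans row≡ (sym col≡)) (ℕₚ.<⇒≢ (row<col-shift b))
    go (offDiagonal b) (onDiagonal j)  (row≡ , col≡) =
      contradiction (ℕₚ.suc-injective (trans (sym row≡) col≡)) (ℕₚ.<⇒≢ (row<col-shift b))
    go (offDiagonal b) (offDiagonal c) r             = shifted {b = b} {c} (Diagonal-unshift {b = b} {c} r)

  -- Tableau conditions in terms of diagonals

  record Monotone {N m} (T : Triangle (Letter N) m) : Set where
    field
      rows      : ∀ b b′ → RightOf b b′ → entry T b ≼ entry T b′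
      columns   : ∀ b b′ → Below b b′ → entry T b ≼ entry T b′
      diagonals : ∀ b b′ → Diagonal b b′ → entry T b ≺ entry T b′

  Strict : ∀ {N m} → Vec (Letter N) m → Set
  Strict d = ∀ i j → toℕ j ≡ suc (toℕ i) → lookup d i ≺ lookup d j

  Interlaced : ∀ {N m} → Vec (Letter N) (suc m) → (Fin m → Letter N) → Set
  Interlaced d s = ∀ i → lookup d (inject₁ i) ≼ s i × s i ≼ lookup d (suc i)

  module _ {N m} {d : Vec (Letter N) (suc m)} {T : Triangle (Letter N) m} where

    monotone-glue : Strict d → Interlaced d (entry T ∘ diagonalBox) → Monotone T → Monotone (glue d T)
    monotone-glue strict interlaced mono = record
      { rows      = λ b b′ r → along-row (rightView r)
      ; columns   = λ b b′ r → down-column (belowView r)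
      ; diagonals = λ b b′ r → along-diagonal (diagonalView r)
      }
      where
      open Monotone mono
      along-row : ∀ {b b′} → RightView b b′ → entry (glue d T) b ≼ entry (glue d T) b′
      along-row (leaving i) rewrite entry-diagonal d T (inject₁ i) | entry-shift d T (diagonalBox i) = proj₁ (interlaced i)
      along-row (shifted {b} {b′} r) rewrite entry-shift d T b | entry-shift d T b′ = rows b b′ r
      down-column : ∀ {b b′} → BelowView b b′ → entry (glue d T) b ≼ entry (glue d T) b′
      down-column (arriving i) rewrite entry-diagonal d T (suc i) | entry-shift d T (diagonalBox i) = proj₂ (interlaced i)
      down-column (shifted {b} {b′} r) rewrite entry-shift d T b | entry-shift d T b′ = columns b b′ r
      along-diagonal : ∀ {b b′} → DiagonalView b b′ → entry (glue d T) b ≺ entry (glue d T) b′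
      along-diagonal (along i j i+1≡j) rewrite entry-diagonal d T i | entry-diagonal d T j = strict i j i+1≡j
      along-diagonal (shifted {b} {b′} r) rewrite entry-shift d T b | entry-shift d T b′ = diagonals b b′ r

    module _ (mono : Monotone (glue d T)) where
      open Monotone mono

      monotone-strict : Strict d
      monotone-strict i j i+1≡j = subst₂ _≺_ (entry-diagonal d T i) (entry-diagonal d T j)
        (diagonals (diagonalBox i) (diagonalBox j) (i+1≡j , i+1≡j))

      monotone-interlaced : Interlaced d (entry T ∘ diagonalBox)
      monotone-interlaced i =
          subst₂ _≼_ (entry-diagonal d T (inject₁ i)) (entry-shift d T (diagonalBox i))
            (rows (diagonalBox (inject₁ i)) (shift (diagonalBox i)) (refl , cong suc (sym (Finₚ.toℕ-inject₁ i))))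
        , subst₂ _≼_ (entry-shift d T (diagonalBox i)) (entry-diagonal d T (suc i))
            (columns (shift (diagonalBox i)) (diagonalBox (suc i)) (cong suc (sym (Finₚ.toℕ-inject₁ i)) , refl))

      monotone-tail : Monotone T
      monotone-tail = record
        { rows      = λ b b′ r → subst₂ _≼_ (entry-shift d T b) (entry-shift d T b′) (rows (shift b) (shift b′) (RightOf-shift {b = b} {b′} r))
        ; columns   = λ b b′ r → subst₂ _≼_ (entry-shift d T b) (entry-shift d T b′) (columns (shift b) (shift b′) (Below-shift {b = b} {b′} r))
        ; diagonals = λ b b′ r → subst₂ _≺_ (entry-shift d T b) (entry-shift d T b′) (diagonals (shift b) (shift b′) (Diagonal-shift {b = b} {b′} r))
        }

  rank-injective : ∀ {N} {x y : Letter N} → rank x ≡ rank y → x ≡ y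
  rank-injective {x = bar k}   {bar l}   eq = cong bar (Finₚ.toℕ-injective (ℕₚ.*-cancelˡ-≡ (toℕ k) (toℕ l) 2 eq))
  rank-injective {x = plain k} {plain l} eq = cong plain (Finₚ.toℕ-injective (ℕₚ.*-cancelˡ-≡ (toℕ k) (toℕ l) 2 (ℕₚ.suc-injective eq)))
  rank-injective {x = bar k}   {plain l} eq = contradiction eq (ℕₚ.even≢odd (toℕ k) (toℕ l))
  rank-injective {x = plain k} {bar l}   eq = contradiction (sym eq) (ℕₚ.even≢odd (toℕ l) (toℕ k))

  strict⇒increasing : ∀ {N m} (d : Vec (Letter N) m) → Strict d → increasing d ≡ 1ℤ
  strict⇒increasing []          _      = refl
  strict⇒increasing (x ∷ [])    _      = refl
  strict⇒increasing (x ∷ y ∷ d) strict = trans (increasing-≺ x y d (strict zero (suc zero) refl))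
    (strict⇒increasing (y ∷ d) (λ i j i+1≡j → strict (suc i) (suc j) (cong suc i+1≡j)))

  increasing⇒strict : ∀ {N m} (d : Vec (Letter N) m) → increasing d ≢ 0ℤ → Strict d
  increasing⇒strict (x ∷ y ∷ d) ≢0 zero    (suc zero) _     = proj₁ (increasing-∷ x y d ≢0)
  increasing⇒strict (x ∷ y ∷ d) ≢0 (suc i) (suc j)    i+1≡j =
    increasing⇒strict (y ∷ d) (proj₂ (increasing-∷ x y d ≢0)) i j (ℕₚ.suc-injective i+1≡j)

  failures : {P : Set} → Dec P → ℕ
  failures (yes _) = 0
  failures (no _)  = 1

  module _ {N : ℕ} where
    open Finite (letters N) using (_≟_)

    touches? : ∀ x y z → Dec (x ≡ z ⊎ y ≡ z)
    touches? x y z = (x ≟ z) ⊎-dec (y ≟ z)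

    newness : Letter N → Letter N → Letter N → ℕ
    newness x y z = failures (touches? x y z)

    fresh : ∀ {m} → Vec (Letter N) (suc m) → Vec (Letter N) m → ℕ
    fresh (x ∷ [])    []      = 0
    fresh (x ∷ y ∷ d) (z ∷ s) = newness x y z ℕ.+ fresh (y ∷ d) s

    trapezoid-newness : ∀ x y z → x ≺ y → x ≼ z → z ≼ y → trapezoid (rank x) (rank y) (rank z) ≡ + (2 ℕ.^ newness x y z)
    trapezoid-newness x y z x≺y x≼z z≼y = by-cases (touches? x y z)
      where
      by-cases : (touch? : Dec (x ≡ z ⊎ y ≡ z)) → trapezoid (rank x) (rank y) (rank z) ≡ + (2 ℕ.^ failures touch?)
      by-cases (yes (inj₁ refl)) = trapezoid-left x≺y
      by-cases (yes (inj₂ refl)) = trapezoid-right x≺y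
      by-cases (no ¬touch)       = trapezoid-interior (ℕₚ.≤∧≢⇒< x≼z (¬touch ∘ inj₁ ∘ rank-injective))
                                                      (ℕₚ.≤∧≢⇒< z≼y (¬touch ∘ inj₂ ∘ sym ∘ rank-injective))

    interlaced⇒interlacing : ∀ {m} (d : Vec (Letter N) (suc m)) s → Strict d → Interlaced d (lookup s) →
                             interlacing d s ≡ + (2 ℕ.^ fresh d s)
    interlaced⇒interlacing (x ∷ [])    []      _      _     = refl
    interlaced⇒interlacing (x ∷ y ∷ d) (z ∷ s) strict inter = begin
      trapezoid (rank x) (rank y) (rank z) * interlacing (y ∷ d) s
        ≡⟨ cong₂ _*_ (trapezoid-newness x y z (strict zero (suc zero) refl) (proj₁ (inter zero)) (proj₂ (inter zero)))
             (interlaced⇒interlacing (y ∷ d) s (λ i j i+1≡j → strict (suc i) (suc j) (cong suc i+1≡j)) (inter ∘ suc)) ⟩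
      + (2 ℕ.^ newness x y z) * + (2 ℕ.^ fresh (y ∷ d) s)
        ≡⟨ ℤₚ.pos-* (2 ℕ.^ newness x y z) (2 ℕ.^ fresh (y ∷ d) s) ⟨
      + (2 ℕ.^ newness x y z ℕ.* 2 ℕ.^ fresh (y ∷ d) s)
        ≡⟨ cong +_ (ℕₚ.^-distribˡ-+-* 2 (newness x y z) (fresh (y ∷ d) s)) ⟨
      + (2 ℕ.^ fresh (x ∷ y ∷ d) (z ∷ s)) ∎

    interlacing⇒interlaced : ∀ {m} (d : Vec (Letter N) (suc m)) s → Strict d → interlacing d s ≢ 0ℤ → Interlaced d (lookup s)
    interlacing⇒interlaced (x ∷ y ∷ d) (z ∷ s) strict ≢0 zero    =
      trapezoid-bounds (strict zero (suc zero) refl) (nonzeroˡ (trapezoid (rank x) (rank y) (rank z)) ≢0)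
    interlacing⇒interlaced (x ∷ y ∷ d) (z ∷ s) strict ≢0 (suc i) =
      interlacing⇒interlaced (y ∷ d) s (λ i j i+1≡j → strict (suc i) (suc j) (cong suc i+1≡j))
        (nonzeroʳ (trapezoid (rank x) (rank y) (rank z)) ≢0) i

    interlaced-cong : ∀ {m} (d : Vec (Letter N) (suc m)) {s s′} → (∀ i → s i ≡ s′ i) → Interlaced d s → Interlaced d s′
    interlaced-cong d s≡s′ inter i =
      subst (lookup d (inject₁ i) ≼_) (s≡s′ i) (proj₁ (inter i)) , subst (_≼ lookup d (suc i)) (s≡s′ i) (proj₂ (inter i))

    freshLink : ∀ {m} → Vec (Letter N) (suc m) → Triangle (Letter N) m → ℕ
    freshLink d []       = 0
    freshLink d (d′ ∷ D) = fresh d d′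

    -- The exponent of 2 in `chainWeight`: each letter that `fresh` counts lies strictly inside its
    -- interval. `starts-total` shows that it is what remains of the starts after removing those on
    -- the main diagonal.
    excess : ∀ {m} → Triangle (Letter N) m → ℕ
    excess []      = 0
    excess (d ∷ D) = freshLink d D ℕ.+ excess D

    monotone⇒weight : ∀ {m} (d : Vec (Letter N) (suc m)) D → Monotone (fromDiagonals (d ∷ D)) →
                      link d D * chainWeight D ≡ + (2 ℕ.^ excess (d ∷ D))
    monotone⇒weight d []       mono = refl
    monotone⇒weight d (d′ ∷ D) mono = begin
      interlacing d d′ * (increasing d′ * (link d′ D * chainWeight D))
        ≡⟨ cong₂ _*_ (interlaced⇒interlacing d d′ (monotone-strict mono)
               (interlaced-cong d (entry-diagonal d′ (fromDiagonals D)) (monotone-interlaced mono)))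
             (cong₂ _*_ (strict⇒increasing d′ (monotone-strict (monotone-tail mono))) (monotone⇒weight d′ D (monotone-tail mono))) ⟩
      + (2 ℕ.^ fresh d d′) * (1ℤ * + (2 ℕ.^ excess (d′ ∷ D)))
        ≡⟨ cong (λ w → + (2 ℕ.^ fresh d d′) * w) (ℤₚ.*-identityˡ (+ (2 ℕ.^ excess (d′ ∷ D)))) ⟩
      + (2 ℕ.^ fresh d d′) * + (2 ℕ.^ excess (d′ ∷ D))
        ≡⟨ ℤₚ.pos-* (2 ℕ.^ fresh d d′) (2 ℕ.^ excess (d′ ∷ D)) ⟨
      + (2 ℕ.^ fresh d d′ ℕ.* 2 ℕ.^ excess (d′ ∷ D))
        ≡⟨ cong +_ (ℕₚ.^-distribˡ-+-* 2 (fresh d d′) (excess (d′ ∷ D))) ⟨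
      + (2 ℕ.^ excess (d ∷ d′ ∷ D)) ∎

    monotone-[] : Monotone {N} []
    monotone-[] = record { rows = λ { (box () _ _) } ; columns = λ { (box () _ _) } ; diagonals = λ { (box () _ _) } }

    weight⇒monotone : ∀ {m} (d : Vec (Letter N) (suc m)) D → increasing d ≢ 0ℤ → link d D * chainWeight D ≢ 0ℤ →
                      Monotone (fromDiagonals (d ∷ D))
    weight⇒monotone d []       d≢0 _  = monotone-glue (increasing⇒strict d d≢0) (λ ()) monotone-[]
    weight⇒monotone d (d′ ∷ D) d≢0 ≢0 = monotone-glue strict
      (interlaced-cong d (λ i → sym (entry-diagonal d′ (fromDiagonals D) i))
        (interlacing⇒interlaced d d′ strict (nonzeroˡ (interlacing d d′) ≢0)))
      (weight⇒monotone d′ D (nonzeroˡ (increasing d′) (nonzeroʳ (interlacing d d′) ≢0))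
        (nonzeroʳ (increasing d′) (nonzeroʳ (interlacing d d′) ≢0)))
      where
      strict = increasing⇒strict d d≢0

    levels⇒indicator : ∀ {m} (φ : Fin m → Fin N) d → (∀ i → lookup d i ≡ plain (φ i) ⊎ lookup d i ≡ bar (φ i)) →
                       levelsIndicator φ d ≡ 1ℤ
    levels⇒indicator φ []      _      = refl
    levels⇒indicator φ (x ∷ d) levels = cong₂ _*_ (level (levels zero)) (levels⇒indicator (φ ∘ suc) d (levels ∘ suc))
      where
      level : ∀ {x k} → x ≡ plain k ⊎ x ≡ bar k → levelIndicator k x ≡ 1ℤ
      level {k = k} (inj₁ refl) = when-yes (k Fin.≟ k) refl
      level {k = k} (inj₂ refl) = when-yes (k Fin.≟ k) refl

    indicator⇒levels : ∀ {m} (φ : Fin m → Fin N) d → levelsIndicator φ d ≢ 0ℤ →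
                       ∀ i → lookup d i ≡ plain (φ i) ⊎ lookup d i ≡ bar (φ i)
    indicator⇒levels φ (x ∷ d) ≢0 zero    = levelIndicator-≢0 (φ zero) x (nonzeroˡ (levelIndicator (φ zero) x) ≢0)
    indicator⇒levels φ (x ∷ d) ≢0 (suc i) = indicator⇒levels (φ ∘ suc) d (nonzeroʳ (levelIndicator (φ zero) x) ≢0) i

  tableau⇒monotone : ∀ {n} {T : Filling n} → IsShiftedTableau T → Monotone T
  tableau⇒monotone tab = record { rows = along-rows ; columns = down-columns ; diagonals = along-diagonals }
    where open IsShiftedTableau tab

  tableau⇒weight : ∀ {n} (D : Filling n) → IsShiftedTableau (fromDiagonals D) →
                   diagonalsWeight id D ≡ + (2 ℕ.^ excess D)
  tableau⇒weight []      _   = refl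
  tableau⇒weight (d ∷ D) tab = trans
    (cong₂ _*_
      (levels⇒indicator id d (λ i → subst (λ x → x ≡ plain i ⊎ x ≡ bar i) (entry-diagonal d (fromDiagonals D) i) (diagonal i)))
      (monotone⇒weight d D (tableau⇒monotone tab)))
    (ℤₚ.*-identityˡ (+ (2 ℕ.^ excess (d ∷ D))))
    where open IsShiftedTableau tab

  weight⇒tableau : ∀ {n} (D : Filling n) → diagonalsWeight id D ≢ 0ℤ → IsShiftedTableau (fromDiagonals D)
  weight⇒tableau []      _  = record
    { diagonal = λ () ; along-rows = λ { (box () _ _) } ; down-columns = λ { (box () _ _) } ; along-diagonals = λ { (box () _ _) } }
  weight⇒tableau (d ∷ D) ≢0 = record
    { diagonal = λ i → subst (λ x → x ≡ plain i ⊎ x ≡ bar i) (sym (entry-diagonal d (fromDiagonals D) i))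
        (indicator⇒levels id d levels≢0 i)
    ; along-rows = rows ; down-columns = columns ; along-diagonals = diagonals }
    where
    levels≢0 : levelsIndicator id d ≢ 0ℤ
    levels≢0 = nonzeroˡ (levelsIndicator id d) ≢0
    increasing≢0 : increasing d ≢ 0ℤ
    increasing≢0 ≡0 = contradiction (trans (sym (levels-increasing id (λ _ _ i<j → i<j) d levels≢0)) ≡0) λ ()
    mono = weight⇒monotone d D increasing≢0 (nonzeroʳ (levelsIndicator id d) ≢0)
    open Monotone mono

  -- The south-western end of a connected component.
  Start : ∀ {N m} → Triangle (Letter N) m → Box m → Set
  Start T b = ∀ b′ → RightOf b′ b ⊎ Below b b′ → entry T b′ ≢ entry T b

  start? : ∀ {N m} (T : Triangle (Letter N) m) b → Dec (Start T b)
  start? {N} {m} T b = ∀? (λ b′ → (rightOf? b′ b ⊎-dec below? b b′) →-dec ¬? (entry T b′ ≟ entry T b))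
    where
    open Finite (boxes m) using (∀?)
    open Finite (letters N) using (_≟_)

  no-left-neighbour : ∀ {m} (i : Fin (suc m)) b → ¬ RightOf b (diagonalBox i)
  no-left-neighbour i b r = go (rightView {b = b} {diagonalBox i} r) refl
    where
    go : ∀ {b c} → RightView b c → c ≢ diagonalBox i
    go (leaving j)          eq = diagonal≢shift i (diagonalBox j) (sym eq)
    go (shifted {b′ = c} _) eq = diagonal≢shift i c (sym eq)

  no-lower-neighbour : ∀ {m} (i : Fin (suc m)) b → ¬ Below (diagonalBox i) b
  no-lower-neighbour i b r = go (belowView {b = diagonalBox i} {b} r) refl
    where
    go : ∀ {b c} → BelowView b c → b ≢ diagonalBox i
    go (arriving j)        eq = diagonal≢shift i (diagonalBox j) (sym eq)
    go (shifted {b = c} _) eq = diagonal≢shift i c (sym eq)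

  -- Nothing lies to the left of or below a box of the main diagonal. These are the starts that the
  -- exponent `str T ∸ n` discounts.
  start-diagonal : ∀ {N m} (T : Triangle (Letter N) (suc m)) i → Start T (diagonalBox i)
  start-diagonal T i b (inj₁ r) = contradiction r (no-left-neighbour i b)
  start-diagonal T i b (inj₂ r) = contradiction r (no-lower-neighbour i b)

  module _ {N m} (d : Vec (Letter N) (suc (suc m))) (d′ : Vec (Letter N) (suc m)) (T : Triangle (Letter N) m) where
    private
      T′ = glue d′ T

    -- The left and lower neighbours of a box on the second diagonal are the two main-diagonal boxes
    -- between which it interlaces. Any other adjacency would lie within `T′`, where this box is
    -- itself on the main diagonal.
    fresh⇒start : ∀ i → ¬ (lookup d (inject₁ i) ≡ lookup d′ i ⊎ lookup d (suc i) ≡ lookup d′ i) →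
                  Start (glue d T′) (shift (diagonalBox i))
    fresh⇒start i ¬touch b (inj₁ r) = go (rightView {b = b} {shift (diagonalBox i)} r) refl
      where
      go : ∀ {b c} → RightView b c → c ≡ shift (diagonalBox i) → entry (glue d T′) b ≢ entry (glue d T′) (shift (diagonalBox i))
      go (leaving j) eq with refl ← cong col eq
        rewrite entry-diagonal d T′ (inject₁ i) | entry-shift d T′ (diagonalBox i) | entry-diagonal d′ T i = ¬touch ∘ inj₁
      go (shifted {b} {c} r) eq with refl ← shift-injective {b = c} {diagonalBox i} eq = contradiction r (no-left-neighbour i b)
    fresh⇒start i ¬touch b (inj₂ r) = go (belowView {b = shift (diagonalBox i)} {b} r) refl
      where
      go : ∀ {c b} → BelowView c b → c ≡ shift (diagonalBox i) → entry (glue d T′) b ≢ entry (glue d T′) (shift (diagonalBox i))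
      go (arriving j) eq with refl ← cong col eq
        rewrite entry-diagonal d T′ (suc i) | entry-shift d T′ (diagonalBox i) | entry-diagonal d′ T i = ¬touch ∘ inj₂
      go (shifted {c} {b} r) eq with refl ← shift-injective {b = c} {diagonalBox i} eq = contradiction r (no-lower-neighbour i b)

    start⇒fresh : ∀ i → Start (glue d T′) (shift (diagonalBox i)) →
                  ¬ (lookup d (inject₁ i) ≡ lookup d′ i ⊎ lookup d (suc i) ≡ lookup d′ i)
    start⇒fresh i start (inj₁ eq) = start (diagonalBox (inject₁ i)) (inj₁ (refl , cong suc (sym (Finₚ.toℕ-inject₁ i))))
      (trans (entry-diagonal d T′ (inject₁ i)) (trans eq (sym (trans (entry-shift d T′ (diagonalBox i)) (entry-diagonal d′ T i)))))
    start⇒fresh i start (inj₂ eq) = start (diagonalBox (suc i)) (inj₂ (cong suc (sym (Finₚ.toℕ-inject₁ i)) , refl))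
      (trans (entry-diagonal d T′ (suc i)) (trans eq (sym (trans (entry-shift d T′ (diagonalBox i)) (entry-diagonal d′ T i)))))

    -- From the third diagonal on, the left and lower neighbours lie off the main diagonal, so
    -- attaching that diagonal creates and destroys no starts there.
    start-shift : ∀ b → Start T′ (shift b) → Start (glue d T′) (shift (shift b))
    start-shift b start e (inj₁ r) = go (rightView {b = e} {shift (shift b)} r) refl
      where
      go : ∀ {e c} → RightView e c → c ≡ shift (shift b) → entry (glue d T′) e ≢ entry (glue d T′) (shift (shift b))
      go (leaving j) eq = contradiction (shift-injective {b = diagonalBox j} {shift b} eq) (diagonal≢shift j b)
      go (shifted {e} {c} r) eq with refl ← shift-injective {b = c} {shift b} eq
        rewrite entry-shift d T′ e | entry-shift d T′ (shift b) = start e (inj₁ r)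
    start-shift b start e (inj₂ r) = go (belowView {b = shift (shift b)} {e} r) refl
      where
      go : ∀ {c e} → BelowView c e → c ≡ shift (shift b) → entry (glue d T′) e ≢ entry (glue d T′) (shift (shift b))
      go (arriving j) eq = contradiction (shift-injective {b = diagonalBox j} {shift b} eq) (diagonal≢shift j b)
      go (shifted {c} {e} r) eq with refl ← shift-injective {b = c} {shift b} eq
        rewrite entry-shift d T′ e | entry-shift d T′ (shift b) = start e (inj₂ r)

    start-unshift : ∀ b → Start (glue d T′) (shift (shift b)) → Start T′ (shift b)
    start-unshift b start e neighbour eq = start (shift e) (raise neighbour)
      (trans (entry-shift d T′ e) (trans eq (sym (entry-shift d T′ (shift b)))))
      where
      raise : RightOf e (shift b) ⊎ Below (shift b) e → RightOf (shift e) (shift (shift b)) ⊎ Below (shift (shift b)) (shift e)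
      raise (inj₁ r) = inj₁ (RightOf-shift {b = e} {shift b} r)
      raise (inj₂ r) = inj₂ (Below-shift {b = shift b} {e} r)

  fresh-total : ∀ {N m} (d : Vec (Letter N) (suc m)) s →
    total (fins m) (λ i → 1ℤ when ¬? (touches? (lookup d (inject₁ i)) (lookup d (suc i)) (lookup s i))) ≡ + fresh d s
  fresh-total (x ∷ [])    []      = refl
  fresh-total {m = suc m} (x ∷ y ∷ d) (z ∷ s) = begin
    total (fins (suc m)) (λ i → 1ℤ when ¬? (touches? (lookup (x ∷ y ∷ d) (inject₁ i)) (lookup (y ∷ d) i) (lookup (z ∷ s) i)))
      ≡⟨ total-fins-suc m (λ i → 1ℤ when ¬? (touches? (lookup (x ∷ y ∷ d) (inject₁ i)) (lookup (y ∷ d) i) (lookup (z ∷ s) i))) ⟩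
    (1ℤ when ¬? (touches? x y z)) ℤ.+ total (fins m) (λ i → 1ℤ when ¬? (touches? (lookup (y ∷ d) (inject₁ i)) (lookup d i) (lookup s i)))
      ≡⟨ cong₂ ℤ._+_ (indicator (touches? x y z)) (fresh-total (y ∷ d) s) ⟩
    + newness x y z ℤ.+ + fresh (y ∷ d) s
      ≡⟨ ℤₚ.pos-+ (newness x y z) (fresh (y ∷ d) s) ⟨
    + fresh (x ∷ y ∷ d) (z ∷ s) ∎
    where
    indicator : ∀ {P : Set} (P? : Dec P) → (1ℤ when ¬? P?) ≡ + failures P?
    indicator (yes _) = refl
    indicator (no _)  = refl

  starts-shifted : ∀ {N m} (d : Vec (Letter N) (suc m)) D →
    total (boxes m) (λ b → 1ℤ when start? (fromDiagonals (d ∷ D)) (shift b)) ≡ + excess (d ∷ D)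
  starts-shifted         d []       = refl
  starts-shifted {m = suc m} d (d′ ∷ D) = begin
    total (boxes (suc m)) (λ b → 1ℤ when start? T (shift b))
      ≡⟨ total-boxes m (λ b → 1ℤ when start? T (shift b)) ⟩
    total (fins (suc m)) (λ i → 1ℤ when start? T (shift (diagonalBox i))) ℤ.+ total (boxes m) (λ b → 1ℤ when start? T (shift (shift b)))
      ≡⟨ cong₂ ℤ._+_
           (total-cong (fins (suc m)) (λ i → when-⇔ (start? T (shift (diagonalBox i)))
              (¬? (touches? (lookup d (inject₁ i)) (lookup d (suc i)) (lookup d′ i)))
              (start⇒fresh d d′ (fromDiagonals D) i) (fresh⇒start d d′ (fromDiagonals D) i)))
           (total-cong (boxes m) (λ b → when-⇔ (start? T (shift (shift b))) (start? (fromDiagonals (d′ ∷ D)) (shift b))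
              (start-unshift d d′ (fromDiagonals D) b) (start-shift d d′ (fromDiagonals D) b))) ⟩
    total (fins (suc m)) (λ i → 1ℤ when ¬? (touches? (lookup d (inject₁ i)) (lookup d (suc i)) (lookup d′ i)))
      ℤ.+ total (boxes m) (λ b → 1ℤ when start? (fromDiagonals (d′ ∷ D)) (shift b))
      ≡⟨ cong₂ ℤ._+_ (fresh-total d d′) (starts-shifted d′ D) ⟩
    + fresh d d′ ℤ.+ + excess (d′ ∷ D)
      ≡⟨ ℤₚ.pos-+ (fresh d d′) (excess (d′ ∷ D)) ⟨
    + excess (d ∷ d′ ∷ D) ∎
    where
    T = fromDiagonals (d ∷ d′ ∷ D)

  starts-total : ∀ {N m} (D : Triangle (Letter N) m) →
    total (boxes m) (λ b → 1ℤ when start? (fromDiagonals D) b) ≡ + (m ℕ.+ excess D)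
  starts-total []              = refl
  starts-total {m = suc m} (d ∷ D) = begin
    total (boxes (suc m)) (λ b → 1ℤ when start? T b)
      ≡⟨ total-boxes m (λ b → 1ℤ when start? T b) ⟩
    total (fins (suc m)) (λ i → 1ℤ when start? T (diagonalBox i)) ℤ.+ total (boxes m) (λ b → 1ℤ when start? T (shift b))
      ≡⟨ cong₂ ℤ._+_
           (trans (total-cong (fins (suc m)) (λ i → when-yes (start? T (diagonalBox i)) (start-diagonal T i))) (ones (suc m)))
           (starts-shifted d D) ⟩
    + suc m ℤ.+ + excess (d ∷ D)
      ≡⟨ ℤₚ.pos-+ (suc m) (excess (d ∷ D)) ⟨
    + (suc m ℕ.+ excess (d ∷ D)) ∎
    where
    T = fromDiagonals (d ∷ D)
    ones : ∀ n → total (fins n) (λ _ → 1ℤ) ≡ + n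
    ones zero    = refl
    ones (suc n) = trans (total-fins-suc n (λ _ → 1ℤ)) (trans (cong (λ s → 1ℤ ℤ.+ s) (ones n)) (sym (ℤₚ.pos-+ 1 n)))

  -- Connected components

  -- Each class meeting xs contains exactly one root, and that root lies in xs.
  module _ {A : Set} {R : Rel A 0ℓ} (R-equivalence : IsEquivalence R) (R? : Decidable₂ R)
           {IsRoot : Pred A 0ℓ} (root? : Decidable IsRoot) (root : A → A)
           (root-cong : ∀ {x y} → R x y → root x ≡ root y)
           (root-fixed : ∀ {x} → IsRoot x → root x ≡ x)
           (root-isRoot : ∀ x → IsRoot (root x))
           {xs : List A} (xs! : Unique xs)
           (root-related : ∀ {x} → x ∈ xs → R x (root x))
           (root-∈ : ∀ {x} → x ∈ xs → root x ∈ xs) where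
    private
      module R = IsEquivalence R-equivalence

      decSetoid : DecSetoid 0ℓ 0ℓ
      decSetoid = record { isDecEquivalence = record { isEquivalence = R-equivalence ; _≟_ = R? } }

      ys = deduplicate R? xs

      separate : ∀ {zs} → (∀ {z} → z ∈ zs → z ∈ xs) → AllPairs (λ x y → ¬ R x y) zs → Unique (map root zs)
      separate zs⊆ []         = []
      separate {z ∷ zs} zs⊆ (z≁ ∷ zs!) =
        All.tabulate (λ w∈ root≡w → let y , y∈ , w≡ = ∈-map⁻ root w∈ in
          All.lookup z≁ y∈ (R.trans (root-related (zs⊆ (here refl)))
            (R.trans (R.reflexive (trans root≡w w≡)) (R.sym (root-related (zs⊆ (there y∈)))))))
        ∷ separate (zs⊆ ∘ there) zs!

      to : ∀ {z} → z ∈ map root ys → z ∈ filter root? xs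
      to z∈ with ∈-map⁻ root z∈
      ... | y , y∈ , refl = ∈-filter⁺ root? (root-∈ (∈-deduplicate⁻ R? xs y∈)) (root-isRoot y)

      from : ∀ {z} → z ∈ filter root? xs → z ∈ map root ys
      from {z} z∈ with ∈-filter⁻ root? {xs = xs} z∈
      -- Having root `z` is invariant under `R`, so it survives `deduplicate`; in `xs` it is
      -- witnessed by `z` itself.
      ... | z∈xs , isRoot with find (Anyₚ.deduplicate⁺ R? (λ {x} {y} Ryx root≡ → trans (root-cong Ryx) root≡)
                                      (Any.map (λ { refl → root-fixed isRoot }) z∈xs))
      ...   | y , y∈ , root≡z = subst (_∈ map root ys) root≡z (∈-map⁺ root y∈)

    -- `root` maps the representatives kept by `deduplicate` bijectively to the roots in `xs`.
    length-deduplicate : length (deduplicate R? xs) ≡ length (filter root? xs)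
    length-deduplicate = trans (sym (length-map root ys)) (↭-length (same-members⇒↭
      (separate (∈-deduplicate⁻ R? xs) (DecUniqueₚ.deduplicate-! decSetoid xs)) (Uniqueₚ.filter⁺ root? xs!) to from))

  length-as-sumBy : {A : Set} {P : Pred A 0ℓ} (P? : Decidable P) → ∀ xs → + length (filter P? xs) ≡ sumBy (λ x → 1ℤ when P? x) xs
  length-as-sumBy P? xs = trans (ones (filter P? xs)) (sumBy-filter P? (λ _ → 1ℤ) xs)
    where
    ones : ∀ {A : Set} (xs : List A) → + length xs ≡ sumBy (λ _ → 1ℤ) xs
    ones []       = refl
    ones (x ∷ xs) = trans (ℤₚ.pos-+ 1 (length xs)) (cong (λ s → 1ℤ ℤ.+ s) (ones xs))

  module _ {n} (T : Filling n) (mono : Monotone T) where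
    open Finite (letters n) using (_≟_)

    Step : Box n → Box n → Set
    Step b b′ = (RightOf b′ b ⊎ Below b b′) × entry T b′ ≡ entry T b

    step? : ∀ b → Dec (∃ (Step b))
    step? b = Finite.∃? (boxes n) (λ b′ → (rightOf? b′ b ⊎-dec below? b b′) ×-dec (entry T b′ ≟ entry T b))

    -- The left and the lower neighbour of a box are diagonal neighbours of each other, so
    -- strictness along diagonals prevents both from carrying its letter. Components are therefore
    -- strips without branching.
    step-deterministic : ∀ {b b₁ b₂} → Step b b₁ → Step b b₂ → b₁ ≡ b₂
    step-deterministic (inj₁ (r₁ , c₁) , _) (inj₁ (r₂ , c₂) , _) =
      box-ext (trans (sym r₁) r₂) (Finₚ.toℕ-injective (ℕₚ.suc-injective (trans (sym c₁) c₂)))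
    step-deterministic (inj₂ (r₁ , c₁) , _) (inj₂ (r₂ , c₂) , _) =
      box-ext (Finₚ.toℕ-injective (trans r₁ (sym r₂))) (trans c₁ (sym c₂))
    step-deterministic {b} {b₁} {b₂} (inj₁ (r₁ , c₁) , e₁) (inj₂ (r₂ , c₂) , e₂) =
      contradiction (cong rank (trans e₁ (sym e₂))) (ℕₚ.<⇒≢ (Monotone.diagonals mono b₁ b₂
        (trans r₂ (cong (suc ∘ toℕ) r₁) , trans (cong toℕ c₂) c₁)))
    step-deterministic {b} {b₁} {b₂} (inj₂ (r₁ , c₁) , e₁) (inj₁ (r₂ , c₂) , e₂) =
      contradiction (cong rank (trans e₂ (sym e₁))) (ℕₚ.<⇒≢ (Monotone.diagonals mono b₂ b₁
        (trans r₁ (cong (suc ∘ toℕ) r₂) , trans (cong toℕ c₁) c₂)))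

    -- A relation, so that the ends of two walks can be compared without reference to the bound with
    -- which `descend` computes them.
    data Descends (b : Box n) : Box n → Set where
      stop   : Start T b → Descends b b
      follow : ∀ {b′ r} → Step b b′ → Descends b′ r → Descends b r

    descends-deterministic : ∀ {b r r′} → Descends b r → Descends b r′ → r ≡ r′
    descends-deterministic (stop _)     (stop _)                = refl
    descends-deterministic (stop start) (follow (nb , eq) _)        = contradiction eq (start _ nb)
    descends-deterministic (follow (nb , eq) _) (stop start)        = contradiction eq (start _ nb)
    descends-deterministic (follow s d) (follow s′ d′) with refl ← step-deterministic s s′ = descends-deterministic d d′

    -- Steps go left or down, and either lowers this number by one.
    height : Box n → ℕ
    height b = toℕ (col b) ℕ.+ (n ℕ.∸ toℕ (row b))

    step-height : ∀ {b b′} → Step b b′ → height b′ ℕ.< height b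
    step-height {b} {b′} (inj₁ (r , c) , _) rewrite c | r = ℕₚ.≤-refl
    step-height {b} {b′} (inj₂ (r , c) , _) rewrite c | r =
      ℕₚ.+-monoʳ-< (toℕ (col b)) (ℕₚ.∸-monoʳ-< (ℕₚ.n<1+n (toℕ (row b))) (subst (ℕ._≤ n) r (ℕₚ.<⇒≤ (Finₚ.toℕ<n (row b′)))))

    descend : ∀ k b → height b ℕ.< k → ∃ (Descends b)
    descend (suc k) b (ℕ.s≤s h≤k) with step? b
    ... | no ¬step = b , stop (λ b′ nb eq → ¬step (b′ , nb , eq))
    ... | yes (b′ , step) = let r , d = descend k b′ (ℕₚ.<-≤-trans (step-height step) h≤k) in r , follow step d

    root : Box n → Box n
    root b = proj₁ (descend (suc (height b)) b ℕₚ.≤-refl)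

    descends-root : ∀ b → Descends b (root b)
    descends-root b = proj₂ (descend (suc (height b)) b ℕₚ.≤-refl)

    descends-start : ∀ {b r} → Descends b r → Start T r
    descends-start (stop start) = start
    descends-start (follow _ d)     = descends-start d

    root-start : ∀ {b} → Start T b → root b ≡ b
    root-start {b} start = descends-deterministic (descends-root b) (stop start)

    root-step : ∀ {b b′} → Step b b′ → root b ≡ root b′
    root-step {b} {b′} step = descends-deterministic (descends-root b) (follow step (descends-root b′))

    module _ (c : Letter n) where

      descends-connected : ∀ {b r} → Descends b r → entry T b ≡ c → Connected T c b r × entry T r ≡ c
      descends-connected (stop _)              b≡c = ε , b≡c
      descends-connected {b} (follow {b′} (nb , eq) d) b≡c =
        let path , r≡c = descends-connected d b′≡c in (adjacent nb , b≡c , b′≡c) ◅ path , r≡c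
        where
        b′≡c = trans eq b≡c
        adjacent : RightOf b′ b ⊎ Below b b′ → Adjacent b b′
        adjacent (inj₁ r) = inj₂ (inj₁ r)
        adjacent (inj₂ r) = inj₂ (inj₂ (inj₁ r))

      -- Of two adjacent boxes with the same letter one steps to the other; as walks are
      -- deterministic, both end in the same box.
      connected-root : ∀ {b b′} → Connected T c b b′ → root b ≡ root b′
      connected-root ε = refl
      connected-root (_◅_ {b} {b′} (adjacent , b≡c , b′≡c) path) = trans (adjacent-root adjacent) (connected-root path)
        where
        adjacent-root : Adjacent b b′ → root b ≡ root b′
        adjacent-root (inj₁ r)               = sym (root-step (inj₁ r , trans b≡c (sym b′≡c)))
        adjacent-root (inj₂ (inj₁ r))        = root-step (inj₁ r , trans b′≡c (sym b≡c))
        adjacent-root (inj₂ (inj₂ (inj₁ r))) = root-step (inj₂ r , trans b′≡c (sym b≡c))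
        adjacent-root (inj₂ (inj₂ (inj₂ r))) = sym (root-step (inj₂ r , trans b≡c (sym b′≡c)))

      connected-equivalence : IsEquivalence (Connected T c)
      connected-equivalence = record
        { refl  = ε
        ; sym   = reverse (λ {b} {b′} (adjacent , b≡c , b′≡c) → adjacent-sym {b} {b′} adjacent , b′≡c , b≡c)
        ; trans = _◅◅_
        }
        where
        adjacent-sym : ∀ {b b′} → Adjacent b b′ → Adjacent b′ b
        adjacent-sym (inj₁ r)               = inj₂ (inj₁ r)
        adjacent-sym (inj₂ (inj₁ r))        = inj₁ r
        adjacent-sym (inj₂ (inj₂ (inj₁ r))) = inj₂ (inj₂ (inj₂ r))
        adjacent-sym (inj₂ (inj₂ (inj₂ r))) = inj₂ (inj₂ (inj₁ r))

      coloured : List (Box n)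
      coloured = filter (λ b → entry T b ≟ c) (Finite.elements (boxes n))

      coloured⇒entry : ∀ {b} → b ∈ coloured → entry T b ≡ c
      coloured⇒entry b∈ = proj₂ (∈-filter⁻ (λ b → entry T b ≟ c) {xs = Finite.elements (boxes n)} b∈)

      components≡starts : components T c ≡ length (filter (start? T) coloured)
      components≡starts = length-deduplicate connected-equivalence (connected? T c) (start? T) root
        connected-root root-start (λ b → descends-start (descends-root b))
        (Uniqueₚ.filter⁺ (λ b → entry T b ≟ c) (elements-unique (boxes n)))
        (λ b∈ → proj₁ (descends-connected (descends-root _) (coloured⇒entry b∈)))
        (λ {b} b∈ → ∈-filter⁺ (λ b → entry T b ≟ c) (Finite.complete (boxes n) (root b))
          (proj₂ (descends-connected (descends-root _) (coloured⇒entry b∈))))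

    str≡starts : + str T ≡ total (boxes n) (λ b → 1ℤ when start? T b)
    str≡starts = begin
      + str T
        ≡⟨ sum-as-sumBy (components T) (Finite.elements (letters n)) ⟩
      total (letters n) (λ c → + components T c)
        ≡⟨ total-cong (letters n) (λ c → begin
             + components T c                                   ≡⟨ cong +_ (components≡starts c) ⟩
             + length (filter (start? T) (coloured c))          ≡⟨ length-as-sumBy (start? T) (coloured c) ⟩
             sumBy (λ b → 1ℤ when start? T b) (coloured c)      ≡⟨ sumBy-filter (λ b → entry T b ≟ c) _ (Finite.elements (boxes n)) ⟩
             total (boxes n) (λ b → (1ℤ when start? T b) when (entry T b ≟ c)) ∎) ⟩
      total (letters n) (λ c → total (boxes n) (λ b → (1ℤ when start? T b) when (entry T b ≟ c)))
        ≡⟨ total-swap (letters n) (boxes n) (λ c b → (1ℤ when start? T b) when (entry T b ≟ c)) ⟩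
      total (boxes n) (λ b → total (letters n) (λ c → (1ℤ when start? T b) when (entry T b ≟ c)))
        -- Each box carries a single letter, so one summand remains.
        ≡⟨ total-cong (boxes n) (λ b → trans
             (total-single (letters n) (entry T b) _ (λ c c≢ → when-no (entry T b ≟ c) (λ eq → c≢ (sym eq))))
             (when-yes (entry T b ≟ entry T b) refl)) ⟩
      total (boxes n) (λ b → 1ℤ when start? T b) ∎

  tableau-sum : ∀ n → sumOver (fillings n) isShiftedTableau? (λ T → 2 ℕ.^ (str T ℕ.∸ n)) ≡ 2 ℕ.^ (n ℕ.^ 2)
  tableau-sum n = ℤₚ.+-injective (begin
    + sumOver (fillings n) isShiftedTableau? (λ T → 2 ℕ.^ (str T ℕ.∸ n))
      ≡⟨ sumOver-total (fillings n) isShiftedTableau? _ (λ T → diagonalsWeight id (toDiagonals T)) on off ⟩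
    total (fillings n) (λ T → diagonalsWeight id (toDiagonals T))
      ≡⟨ total-inverse (fillings n) (fillings n) diagonals↔ (λ T → diagonalsWeight id (toDiagonals T)) ⟨
    total (fillings n) (λ D → diagonalsWeight id (toDiagonals (fromDiagonals D)))
      ≡⟨ total-cong (fillings n) (λ D → cong (diagonalsWeight id) (to∘fromDiagonals D)) ⟩
    total (fillings n) (diagonalsWeight id)
      ≡⟨ diagonalsWeight-total n ⟩
    + (2 ℕ.^ (n ℕ.^ 2)) ∎)
    where
    str-fromDiagonals : ∀ D → Monotone (fromDiagonals D) → str (fromDiagonals D) ℕ.∸ n ≡ excess D
    str-fromDiagonals D mono = trans
      (cong (ℕ._∸ n) (ℤₚ.+-injective (trans (str≡starts (fromDiagonals D) mono) (starts-total D))))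
      -- `str` equals `n` plus the excess, so the truncated subtraction is exact.
      (ℕₚ.m+n∸m≡n n (excess D))
    on′ : ∀ D → IsShiftedTableau (fromDiagonals D) → diagonalsWeight id D ≡ + (2 ℕ.^ (str (fromDiagonals D) ℕ.∸ n))
    on′ D tab = trans (tableau⇒weight D tab) (cong (λ k → + (2 ℕ.^ k)) (sym (str-fromDiagonals D (tableau⇒monotone tab))))
    on : ∀ T → IsShiftedTableau T → diagonalsWeight id (toDiagonals T) ≡ + (2 ℕ.^ (str T ℕ.∸ n))
    on T tab = subst (λ T′ → diagonalsWeight id (toDiagonals T) ≡ + (2 ℕ.^ (str T′ ℕ.∸ n))) (from∘toDiagonals T)
      (on′ (toDiagonals T) (subst IsShiftedTableau (sym (from∘toDiagonals T)) tab))
    off : ∀ T → ¬ IsShiftedTableau T → diagonalsWeight id (toDiagonals T) ≡ 0ℤ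
    off T ¬tab with diagonalsWeight id (toDiagonals T) ℤ.≟ 0ℤ
    ... | yes ≡0 = ≡0
    ... | no  ≢0 = contradiction (subst IsShiftedTableau (from∘toDiagonals T) (weight⇒tableau (toDiagonals T) ≢0)) ¬tab

open import Data.Nat using (_≥_; _^_; _∸_; _*_)

corollary6p9 : ∀ (n : ℕ) → n ≥ 1 →
    2 ^ (n ^ 2) ≡ sumOver (fillings n) isShiftedTableau? (λ T → 2 ^ (str T ∸ n))
    × sumOver (fillings n) isShiftedTableau? (λ T → 2 ^ (str T ∸ n))
    ≡ sumOver (matrices signs (n * 2) n) isUTurn? (λ M → 2 ^ negs M)
    × sumOver (matrices signs (n * 2) n) isUTurn? (λ M → 2 ^ negs M)
    ≡ sumOver (matrices elementTypes (n * 2) n) isIceMatrix? (λ M → 2 ^ ns M)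
corollary6p9 n _ =
    sym (tableau-sum n)
  , trans (tableau-sum n) (trans (sym (orientation-sum n)) (uTurn-sum n))
  , trans (sym (uTurn-sum n)) (iceMatrix-sum n)
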